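{- Let $\eta$ be the morphism on $\{0,1,2,3\}^*$ defined by $\eta(0)=010203$, $\eta(1)=2013$, $\eta(2)=0132$, $\eta(3)=0102013203$, let $\eta^\omega(0)$ be its infinite fixed point starting with $0$, and let $\gamma:\{0,1,2,3\}^*\to\{0,1,2\}^*$ be the morphism defined by $\gamma(0)=012021201210120102$, $\gamma(1)=012101202120102$, $\gamma(2)=012021201020121$, $\gamma(3)=012021201210120212010201210120102$. Then: (a) $\gamma(\eta^\omega(0))$ contains exactly $16$ distinct palindromes (including the empty word) and is $\tfrac{41}{22}^+$-free. (b) Every bi-infinite word over $\{0,1,2\}$ that is $\tfrac{52}{27}$-free and contains at most $16$ distinct palindromes (including the empty word) has the same set of finite factors as either $\gamma(\eta^\omega(0))$ or its reversal $\gamma(\eta^\omega(0))^R$. (c) Every recurrent infinite word over $\{0,1,2\}$ that is $\tfrac{25}{13}$-free and contains at most $17$ distinct palindromes (including the empty word) has the same set of finite factors as either $\gamma(\eta^\omega(0))$ or its reversal $\gamma(\eta^\omega(0))^R$.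
   Context: For a nonempty finite word $u$ and a rational $r>1$, a word $v$ is an $r$-power (of $u$) if $v$ is a prefix of the infinite periodic word $uuu\cdots$ and $|v|/|u|=r$. A (finite, infinite or bi-infinite) word is $\beta$-free (resp. $\beta^+$-free) if none of its factors is an $r$-power with $r\ge\beta$ (resp. $r>\beta$). A palindrome is a finite word equal to its reversal; a word contains a palindrome if the palindrome is one of its factors. An infinite word is recurrent if each of its factors occurs infinitely often in it. For an infinite word $\mathbf u$, the set of factors of $\mathbf u^R$ is the set of reversals of the factors of $\mathbf u$. Morphisms extend to infinite words by letterwise application and concatenation; $\eta^\omega(0)=\lim_{n\to\infty}\eta^n(0)$. -}

module Defs where

open import Data.Fin.Base using (Fin; fromℕ<)
open import Data.Fin.Patterns using (0F; 1F; 2F; 3F)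
open import Data.Integer.Base as ℤ using (ℤ)
open import Data.List.Base
  using (List; []; _∷_; [_]; _++_; length; lookup; reverse; applyUpTo; concatMap)
open import Data.List.NonEmpty.Base as List⁺ using (List⁺; _∷_)
open import Data.List.Properties
  using (length-++; concatMap-++; ++-assoc; ++-identityʳ)
open import Data.List.Relation.Unary.All using (All)
open import Data.List.Relation.Unary.Unique.Propositional using (Unique)
open import Data.Nat.Base
  using (ℕ; zero; suc; _+_; _≤_; _<_; _≥_; _≤′_; ≤′-refl; ≤′-step; z≤n; s≤s)
open import Data.Nat.DivMod using (_mod_)
open import Data.Nat.GeneralisedArithmetic using (fold)
open import Data.Nat.Properties
  using (≤-trans; ≤-reflexive; ≤⇒≤′; ≤-total; +-mono-≤; +-suc)
open import Data.Product.Base using (_×_; _,_; ∃-syntax)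
open import Data.Rational.Base as ℚ using (ℚ; 1ℚ)
open import Data.Sum.Base using (inj₁; inj₂)
open import Function.Base using (_∘_)
open import Level using (0ℓ)
open import Relation.Binary.PropositionalEquality
  using (_≡_; refl; sym; trans; cong; cong₂)
open import Relation.Nullary.Negation using (¬_)
open import Relation.Unary using (Pred)

private
  variable
    A B : Set

ω-Word : Set → Set
ω-Word A = ℕ → A

ℤ-Word : Set → Set
ℤ-Word A = ℤ → A

OccursAt : ω-Word A → List A → ℕ → Set
OccursAt w v i = applyUpTo (λ k → w (i + k)) (length v) ≡ v

OccursAtℤ : ℤ-Word A → List A → ℤ → Set
OccursAtℤ w v i = applyUpTo (λ k → w (i ℤ.+ ℤ.+ k)) (length v) ≡ v

Factors : ω-Word A → Pred (List A) 0ℓ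
Factors w v = ∃[ i ] OccursAt w v i

Factorsℤ : ℤ-Word A → Pred (List A) 0ℓ
Factorsℤ w v = ∃[ i ] OccursAtℤ w v i

Recurrent : ω-Word A → Set
Recurrent w = ∀ v → Factors w v → ∀ n → ∃[ i ] (i ≥ n × OccursAt w v i)

infix 8 _ᴿ

_ᴿ : Pred (List A) 0ℓ → Pred (List A) 0ℓ
(L ᴿ) v = ∃[ u ] (L u × v ≡ reverse u)

_^ω : List⁺ A → ω-Word A
(u ^ω) i = lookup (List⁺.toList u) (i mod List⁺.length u)

record IsPower (r : ℚ) (u : List⁺ A) (v : List A) : Set where
  field
    r>1    : r ℚ.> 1ℚ
    prefix : OccursAt (u ^ω) v 0
    ratio  : ℤ.+ length v ℚ./ List⁺.length u ≡ r

-- Freeness is a property of the set L of factors of a word, so that it applies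
-- to infinite and bi-infinite words alike.
Free : ℚ → Pred (List A) 0ℓ → Set
Free β L = ∀ r u v → L v → r ℚ.≥ β → ¬ IsPower r u v

Free⁺ : ℚ → Pred (List A) 0ℓ → Set
Free⁺ β L = ∀ r u v → L v → r ℚ.> β → ¬ IsPower r u v

Palindrome : Pred (List A) 0ℓ
Palindrome v = reverse v ≡ v

AtLeast AtMost Exactly : ℕ → Pred A 0ℓ → Set
AtLeast n P = ∃[ xs ] (Unique xs × All P xs × length xs ≡ n)
AtMost  n P = ∀ xs → Unique xs → All P xs → length xs ≤ n
Exactly n P = AtLeast n P × AtMost n P

-- Images of letters are nonempty, so every morphism here extends to infinite words.

Morphism : Set → Set → Set
Morphism A B = A → List⁺ B

_* : Morphism A B → List A → List B
σ * = concatMap (List⁺.toList ∘ σ)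

-- emit u σ w is the word u σ(w₀) σ(w₁) σ(w₂) ⋯
emit : List⁺ B → Morphism A B → ω-Word A → ω-Word B
emit (b ∷ _)      σ w zero    = b
emit (_ ∷ [])     σ w (suc i) = emit (σ (w 0)) σ (w ∘ suc) i
emit (_ ∷ b ∷ bs) σ w (suc i) = emit (b ∷ bs) σ w i

_⟨_⟩ : Morphism A B → ω-Word A → ω-Word B
σ ⟨ w ⟩ = emit (σ (w 0)) σ (w ∘ suc)

η : Morphism (Fin 4) (Fin 4)
η 0F = 0F ∷ 1F ∷ 0F ∷ 2F ∷ 0F ∷ 3F ∷ []
η 1F = 2F ∷ 0F ∷ 1F ∷ 3F ∷ []
η 2F = 0F ∷ 1F ∷ 3F ∷ 2F ∷ []
η 3F = 0F ∷ 1F ∷ 0F ∷ 2F ∷ 0F ∷ 1F ∷ 3F ∷ 2F ∷ 0F ∷ 3F ∷ []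

γ : Morphism (Fin 4) (Fin 3)
γ 0F = 0F ∷ 1F ∷ 2F ∷ 0F ∷ 2F ∷ 1F ∷ 2F ∷ 0F ∷ 1F ∷ 2F ∷ 1F ∷ 0F ∷ 1F ∷ 2F ∷ 0F ∷
       1F ∷ 0F ∷ 2F ∷ []
γ 1F = 0F ∷ 1F ∷ 2F ∷ 1F ∷ 0F ∷ 1F ∷ 2F ∷ 0F ∷ 2F ∷ 1F ∷ 2F ∷ 0F ∷ 1F ∷ 0F ∷ 2F ∷
       []
γ 2F = 0F ∷ 1F ∷ 2F ∷ 0F ∷ 2F ∷ 1F ∷ 2F ∷ 0F ∷ 1F ∷ 0F ∷ 2F ∷ 0F ∷ 1F ∷ 2F ∷ 1F ∷
       []
γ 3F = 0F ∷ 1F ∷ 2F ∷ 0F ∷ 2F ∷ 1F ∷ 2F ∷ 0F ∷ 1F ∷ 2F ∷ 1F ∷ 0F ∷ 1F ∷ 2F ∷ 0F ∷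
       2F ∷ 1F ∷ 2F ∷ 0F ∷ 1F ∷ 0F ∷ 2F ∷ 0F ∷ 1F ∷ 2F ∷ 1F ∷ 0F ∷ 1F ∷ 2F ∷ 0F ∷
       1F ∷ 0F ∷ 2F ∷ []

η^_⟨0⟩ : ℕ → List (Fin 4)
η^ n ⟨0⟩ = fold [ 0F ] (η *) n

private
  η*-length : ∀ u → length u + length u ≤ length ((η *) u)
  η*-length []      = z≤n
  η*-length (a ∷ u) = ≤-trans (≤-reflexive (shift (length u)))
    (≤-trans (+-mono-≤ (two a) (η*-length u))
             (≤-reflexive (sym (length-++ (List⁺.toList (η a))))))
    where
    shift : ∀ m → suc m + suc m ≡ 2 + (m + m)
    shift m = cong suc (+-suc m m)
    two : ∀ a → 2 ≤ List⁺.length (η a)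
    two 0F = s≤s (s≤s z≤n)
    two 1F = s≤s (s≤s z≤n)
    two 2F = s≤s (s≤s z≤n)
    two 3F = s≤s (s≤s z≤n)

η^-length : ∀ n → n < length (η^ n ⟨0⟩)
η^-length zero    = s≤s z≤n
η^-length (suc n) = ≤-trans
  (+-mono-≤ {1} (≤-trans (s≤s z≤n) (η^-length n)) (η^-length n))
  (η*-length (η^ n ⟨0⟩))

-- The limit of the words ηⁿ(0): each is a prefix of the next and ηⁱ(0) has
-- more than i letters, so letter i can be read off ηⁱ(0).
η^ω⟨0⟩ : ω-Word (Fin 4)
η^ω⟨0⟩ i = lookup (η^ i ⟨0⟩) (fromℕ< (η^-length i))

private
  η^-step : ∀ n → ∃[ s ] (η^ suc n ⟨0⟩ ≡ η^ n ⟨0⟩ ++ s)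
  η^-step zero = _ , refl
  η^-step (suc n) with s , eq ← η^-step n =
    (η *) s , trans (cong (η *) eq) (concatMap-++ (List⁺.toList ∘ η) (η^ n ⟨0⟩) s)

  η^-prefix : ∀ {m n} → m ≤′ n → ∃[ s ] (η^ n ⟨0⟩ ≡ η^ m ⟨0⟩ ++ s)
  η^-prefix ≤′-refl = [] , sym (++-identityʳ _)
  η^-prefix {m} (≤′-step {n} m≤n) with s , p ← η^-prefix m≤n | t , q ← η^-step n =
    s ++ t , trans q (trans (cong (_++ t) p) (++-assoc (η^ m ⟨0⟩) s t))

  lookup-prefix : ∀ {x y : List A} s → y ≡ x ++ s → ∀ {i} (p : i < length x) (q : i < length y) →
                  lookup y (fromℕ< q) ≡ lookup x (fromℕ< p)
  lookup-prefix {x = a ∷ x} s refl {zero}  p       q       = refl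
  lookup-prefix {x = a ∷ x} s refl {suc i} (s≤s p) (s≤s q) = lookup-prefix {x = x} s refl p q

  η^ω-lookup : ∀ n {i} (p : i < length (η^ n ⟨0⟩)) → η^ω⟨0⟩ i ≡ lookup (η^ n ⟨0⟩) (fromℕ< p)
  η^ω-lookup n {i} p with ≤-total n i
  ... | inj₁ n≤i with s , eq ← η^-prefix (≤⇒≤′ n≤i) = lookup-prefix s eq p (η^-length i)
  ... | inj₂ i≤n with s , eq ← η^-prefix (≤⇒≤′ i≤n) = sym (lookup-prefix s eq (η^-length i) p)

  applyUpTo-lookup : ∀ (w : ω-Word A) x → (∀ {i} (p : i < length x) → w i ≡ lookup x (fromℕ< p)) →
                     applyUpTo w (length x) ≡ x
  applyUpTo-lookup w []      h = refl
  applyUpTo-lookup w (a ∷ x) h =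
    cong₂ _∷_ (h (s≤s z≤n)) (applyUpTo-lookup (w ∘ suc) x (λ p → h (s≤s p)))

η^ω-limit : ∀ n → OccursAt η^ω⟨0⟩ (η^ n ⟨0⟩) 0
η^ω-limit n = applyUpTo-lookup η^ω⟨0⟩ (η^ n ⟨0⟩) (η^ω-lookup n)

γη^ω⟨0⟩ : ω-Word (Fin 3)
γη^ω⟨0⟩ = γ ⟨ η^ω⟨0⟩ ⟩

-- Let F be the set of factors of a word as in (b) or (c). Exhaustive search shows that F contains
-- the 16 palindromes ε, a, aba and cabac. In (c) there may be one more, of 7 letters; but if
-- it has the form abcacba, then every continuation ends in a set of windows that is closed under
-- shifts and does not meet abcacba, against recurrence, and otherwise a power is unavoidable.
-- Without palindromes of 7 letters, the windows of 11 letters are those of γ(η^ω(0)) or their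
-- reversals, and the two kinds do not mix. Marker words then allow to write F as the set of
-- factors of γ(G) for a language G over four letters, and to desubstitute G by η again and again:
-- the few factors that could prevent this have images under all γηⁿ that contain powers of
-- exponent at least 52/27. So the factors of F are those of the words γηⁿ(ab), where ab runs
-- through the factors of η^ω(0), and conversely γηⁿ(0) is in F for all n.
-- For (a), a repetition with a long period in η^ω(0) or γ(η^ω(0)) is desubstituted as well. Two
-- linear weights control its exponent from one level to the next, and the short periods are
-- inspected.

{-# OPTIONS --safe #-}
module Submission where

open import Defs
open import Data.Fin.Base using (Fin)
open import Data.Integer.Base using (+_)
open import Data.Product.Base using (_×_)
open import Data.Rational.Base using (_/_)
open import Data.Sum.Base using (_⊎_)
open import Relation.Unary using (_∩_; _≐_)

open import Data.Bool.Base using (Bool; _∧_; _∨_; false; if_then_else_; not; true)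
open import Data.Bool.Properties using (T-≡)
open import Data.Empty using (⊥; ⊥-elim)
open import Data.Fin.Base using (suc; toℕ; zero)
open import Data.Fin.Patterns using (0F; 1F; 2F; 3F)
open import Data.Fin.Properties as Fin using (toℕ-fromℕ<; toℕ-injective; toℕ<n)
open import Data.Integer.Base as ℤ using (ℤ)
import Data.Integer.Properties as ℤ
open import Data.List.Base
  using (List; []; [_]; _++_; _∷_; _∷ʳ_; applyUpTo; concatMap; drop; length; lookup; map;
         reverse; take)
open import Data.List.Membership.Propositional using (_∈_)
open import Data.List.Membership.Propositional.Properties
  using (∈-++⁺ʳ; ∈-++⁺ˡ; ∈-++⁻; ∈-map⁻; ∈-∃++)
open import Data.List.NonEmpty.Base as List⁺ using (List⁺; _∷_)
open import Data.List.Properties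
  using (++-assoc; ++-identityʳ; applyUpTo-∷ʳ; concatMap-++; length-++; length-applyUpTo;
         length-reverse; length-take; reverse-++; reverse-involutive; take++drop≡id;
         unfold-reverse; ∷-injective; ∷-injectiveʳ; ∷-injectiveˡ; ∷ʳ-injectiveˡ; ≡-dec)
open import Data.List.Relation.Unary.All as All using (All; []; _∷_)
open import Data.List.Relation.Unary.All.Properties using (++⁺)
open import Data.List.Relation.Unary.AllPairs using ([]; _∷_)
open import Data.List.Relation.Unary.Any using (here; there)
open import Data.List.Relation.Unary.Unique.Propositional using (Unique)
open import Data.Nat.Base
  using (>-nonZero; _*_; _+_; _<_; _<ᵇ_; _∸_; _≡ᵇ_; _≤_; _≤ᵇ_; pred; suc; s≤s; z<s; zero; z≤n;
         ℕ)
open import Data.Nat.DivMod using ([m+n]%n≡m%n; _%_; _mod_; m<n⇒m%n≡m)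
open import Data.Nat.GeneralisedArithmetic using (fold)
open import Data.Nat.Properties
  using (*-cancelˡ-<; *-cancelˡ-≤; *-comm; *-identityʳ; *-monoʳ-≤; *-monoˡ-<; *-suc; *-zeroʳ;
         +-assoc; +-cancelʳ-≤; +-cancelˡ-≡; +-cancelˡ-≤; +-comm; +-identityʳ; +-mono-≤;
         +-monoʳ-<; +-monoʳ-≤; +-monoˡ-≤; +-suc; <-irrefl; <-≤-trans; <ᵇ⇒<; <⇒≢; <⇒≤; <⇒≱;
         _<?_; _≤?_; m+[n∸m]≡n; m≤m+n; m≤n+m; m≤n⇒m⊓n≡m; ≡ᵇ⇒≡; ≤-refl; ≤-reflexive; ≤-total;
         ≤-trans; ≤ᵇ⇒≤; ≤⇒≤ᵇ; ≮⇒≥; ≰⇒>)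
open import Data.Nat.Tactic.RingSolver using (solve-∀)
open import Data.Product.Base using (_,_; proj₁; proj₂; Σ; ∃-syntax)
open import Data.Rational.Base as ℚ using (fromℚᵘ; ℚ)
import Data.Rational.Properties as ℚ
open import Data.Rational.Unnormalised.Base as ℚᵘ using (*<*; *≤*; mkℚᵘ)
import Data.Rational.Unnormalised.Properties as ℚᵘ
open import Data.Sum.Base using ([_,_]′; inj₁; inj₂)
open import Function.Base using (_∘_; const; id)
open import Function.Bundles using (Equivalence)
open import Level using (0ℓ)
open import Relation.Binary.PropositionalEquality
  using (_≡_; _≢_; cong; cong₂; module ≡-Reasoning; refl; subst; subst₂; sym; trans)
open import Relation.Nullary using (Dec; no; yes)
open import Relation.Nullary.Decidable using (from-yes)
open import Relation.Nullary.Negation using (¬_)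
open import Relation.Unary using (Pred)

-- The 16 palindromes are all the square-free ones with at most 5 letters, so a further one without
-- squares contains one of 7 letters; hence 7 is the length to watch. The obstacle in (b) and (c) is
-- that power-freeness is not handed down by desubstitution: letters have images of different
-- lengths, which moreover share prefixes and suffixes, so exponents change from level to level. At
-- level n only the images under γηⁿ are known to lie in F, and a factor to be ruled out has to fail
-- for all n at once. This is done with two weights `θ` and `κ` whose span is stable under η and
-- contains the length under γ: a repetition heavy in both stays so. The threshold 52/27 = 156/81 is
-- reached exactly in γ(032013203), with period 81. In (a) the shared prefixes and suffixes lengthen
-- a repetition at each level; a constant added to its excess lets the induction close. One class of
-- repetitions may miss the strengthened bound, but meets it again one level higher. The finite
-- parts are Boolean functions with soundness proofs, evaluated by `refl`.

private
  variable
    A B : Set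
    n : ℕ

-- Languages of factors, and powers as border equations.

Word : ℕ → Set
Word n = List (Fin n)

∨-true : ∀ b {c} → b ∨ c ≡ true → b ≡ true ⊎ c ≡ true
∨-true true  _ = inj₁ refl
∨-true false p = inj₂ p

≤ᵇ-true : ∀ m {n} → (m ≤ᵇ n) ≡ true → m ≤ n
≤ᵇ-true m p = ≤ᵇ⇒≤ m _ (Equivalence.from T-≡ p)

++-split : ∀ (v : List A) {t} k {s} → v ++ t ≡ k ++ s → length k ≤ length v →
           ∃[ e ] (v ≡ k ++ e × s ≡ e ++ t)
++-split v       []      eq _       = v , refl , sym eq
++-split (a ∷ v) (b ∷ k) eq (s≤s l) with ∷-injective eq
... | refl , eq′ with ++-split v k eq′ l
... | e , refl , q = e , refl , q

++-cancel-length : ∀ (v : List A) {t} k {s} → v ++ t ≡ k ++ s → length v ≡ length k → v ≡ k × t ≡ s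
++-cancel-length []      []      eq _ = refl , eq
++-cancel-length (a ∷ v) (b ∷ k) eq l with ∷-injective eq
... | refl , eq′ with ++-cancel-length v k eq′ (cong pred l)
... | refl , q = refl , q

-- What the factor sets of bi-infinite and of recurrent words, and their preimages under γ and η,
-- have in common. The extension fields allow a search to grow a word at either end.
record Language (F : Pred (List A) 0ℓ) : Set where
  field
    inhabited : F []
    prefix    : ∀ v {t} → F (v ++ t) → F v
    suffix    : ∀ s {v} → F (s ++ v) → F v
    extendˡ   : ∀ v → F v → ∃[ a ] F (a ∷ v)
    extendʳ   : ∀ v → F v → ∃[ a ] F (v ∷ʳ a)

  infixʷ : ∀ s v {t} → F (s ++ v ++ t) → F v
  infixʷ s v = prefix v ∘ suffix s

  extendʳ* : ∀ n v → F v → ∃[ e ] (length e ≡ n × F (v ++ e))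
  extendʳ* zero    v p = [] , refl , subst F (sym (++-identityʳ v)) p
  extendʳ* (suc n) v p with extendʳ v p
  ... | a , q with extendʳ* n (v ∷ʳ a) q
  ... | e , refl , r = a ∷ e , refl , subst F (++-assoc v [ a ] e) r

  extendˡ* : ∀ n v → F v → ∃[ e ] (length e ≡ n × F (e ++ v))
  extendˡ* zero    v p = [] , refl , p
  extendˡ* (suc n) v p with extendˡ* n v p
  ... | e , refl , q with extendˡ (e ++ v) q
  ... | a , r = a ∷ e , refl , r

open Language

reverse-language : {F : Pred (List A) 0ℓ} → Language F → Language (F ∘ reverse)
reverse-language {F = F} L = record
  { inhabited = inhabited L
  ; prefix    = λ v {t} p → suffix L (reverse t) (subst F (reverse-++ v t) p)
  ; suffix    = λ s {v} p → prefix L (reverse v) (subst F (reverse-++ s v) p)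
  ; extendˡ   = λ v p → let a , q = extendʳ L (reverse v) p in a , subst F (sym (unfold-reverse a v)) q
  ; extendʳ   = λ v p → let a , q = extendˡ L (reverse v) p in a , subst F (sym (reverse-++ v [ a ])) q
  }

-- A word u ++ k with u ++ k ≡ k ++ t has period |u| and exponent (|u| + |k|) / |u|.
PowerFree : ℕ → ℕ → Pred (List A) 0ℓ → Set
PowerFree a b F = ∀ u k t → 0 < length u → u ++ k ≡ k ++ t → F (u ++ k) →
                  ¬ a * length u ≤ b * (length u + length k)

-- Read backwards, `k ++ t` is a power of `reverse t`, and `t` is as long as `u`.
powerFree-reverse : ∀ a b {F : Pred (List A) 0ℓ} → PowerFree a b F → PowerFree a b (F ∘ reverse)
powerFree-reverse a b {F} free u k t 0<u eq p le =
  free (reverse t) (reverse k) (reverse u) (subst (0 <_) (sym |t|) 0<u)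
    (trans (sym (reverse-++ k t)) (trans (cong reverse (sym eq)) (reverse-++ u k)))
    (subst F (trans (cong reverse eq) (reverse-++ k t)) p)
    (subst (λ m → a * m ≤ b * (m + length (reverse k))) (sym |t|)
      (subst (λ m → a * length u ≤ b * (length u + m)) (sym (length-reverse k)) le))
  where
  |t| : length (reverse t) ≡ length u
  |t| = trans (length-reverse t) (+-cancelˡ-≡ (length k) _ _ (trans (sym (length-++ k))
          (trans (cong length (sym eq)) (trans (length-++ u) (+-comm (length u) _)))))

-- Comparison of fractions with exponents of powers.

fromℚᵘ-mono-≤ : ∀ p q → p ℚᵘ.≤ q → fromℚᵘ p ℚ.≤ fromℚᵘ q
fromℚᵘ-mono-≤ p q le = ℚ.toℚᵘ-cancel-≤
  (ℚᵘ.≤-respˡ-≃ (ℚᵘ.≃-sym (ℚ.toℚᵘ-fromℚᵘ p)) (ℚᵘ.≤-respʳ-≃ (ℚᵘ.≃-sym (ℚ.toℚᵘ-fromℚᵘ q)) le))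

fromℚᵘ-mono-< : ∀ p q → p ℚᵘ.< q → fromℚᵘ p ℚ.< fromℚᵘ q
fromℚᵘ-mono-< p q le = ℚ.toℚᵘ-cancel-<
  (ℚᵘ.<-respˡ-≃ (ℚᵘ.≃-sym (ℚ.toℚᵘ-fromℚᵘ p)) (ℚᵘ.<-respʳ-≃ (ℚᵘ.≃-sym (ℚ.toℚᵘ-fromℚᵘ q)) le))

/-mono-≤ : ∀ a b m n → a * suc n ≤ m * suc b → + a / suc b ℚ.≤ + m / suc n
/-mono-≤ a b m n le = fromℚᵘ-mono-≤ (mkℚᵘ (+ a) b) (mkℚᵘ (+ m) n)
  (*≤* (subst₂ ℤ._≤_ (ℤ.pos-* a (suc n)) (ℤ.pos-* m (suc b)) (ℤ.+≤+ le)))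

/-mono-< : ∀ a b m n → a * suc n < m * suc b → + a / suc b ℚ.< + m / suc n
/-mono-< a b m n le = fromℚᵘ-mono-< (mkℚᵘ (+ a) b) (mkℚᵘ (+ m) n)
  (*<* (subst₂ ℤ._<_ (ℤ.pos-* a (suc n)) (ℤ.pos-* m (suc b)) (ℤ.+<+ le)))

-- Prefixes of u^ω.

applyUpTo-cong : ∀ {f g : ℕ → A} → (∀ i → f i ≡ g i) → ∀ n → applyUpTo f n ≡ applyUpTo g n
applyUpTo-cong h zero    = refl
applyUpTo-cong h (suc n) = cong₂ _∷_ (h 0) (applyUpTo-cong (h ∘ suc) n)

applyUpTo-+ : ∀ (f : ℕ → A) m n → applyUpTo f (m + n) ≡ applyUpTo f m ++ applyUpTo (λ i → f (m + i)) n
applyUpTo-+ f zero    n = refl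
applyUpTo-+ f (suc m) n = cong (f 0 ∷_) (applyUpTo-+ (f ∘ suc) m n)

applyUpTo-lookup : ∀ (f : ℕ → A) u → (∀ i → f (toℕ i) ≡ lookup u i) → applyUpTo f (length u) ≡ u
applyUpTo-lookup f []      h = refl
applyUpTo-lookup f (a ∷ u) h = cong₂ _∷_ (h zero) (applyUpTo-lookup (f ∘ suc) u (h ∘ suc))

module _ (u : List⁺ A) where
  private
    ū = List⁺.toList u
    p = length ū

  powerPrefix : ℕ → List A
  powerPrefix = applyUpTo (u ^ω)

  ^ω-shift : ∀ i → (u ^ω) (p + i) ≡ (u ^ω) i
  ^ω-shift i = cong (lookup ū) (toℕ-injective (trans (toℕ-fromℕ< _)
    (trans (trans (cong (_% p) (+-comm p i)) ([m+n]%n≡m%n i p)) (sym (toℕ-fromℕ< _)))))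

  powerPrefix-period : powerPrefix p ≡ ū
  powerPrefix-period = applyUpTo-lookup (u ^ω) ū
    (λ i → cong (lookup ū) (toℕ-injective (trans (toℕ-fromℕ< _) (m<n⇒m%n≡m (toℕ<n i)))))

  powerPrefix-+ : ∀ n → powerPrefix (p + n) ≡ ū ++ powerPrefix n
  powerPrefix-+ n = trans (applyUpTo-+ (u ^ω) p n)
    (cong₂ _++_ powerPrefix-period (applyUpTo-cong ^ω-shift n))

  powerPrefix-border : ∀ n → ∃[ t ] ū ++ powerPrefix n ≡ powerPrefix n ++ t
  powerPrefix-border n = _ , trans (sym (powerPrefix-+ n))
    (trans (cong powerPrefix (+-comm p n)) (applyUpTo-+ (u ^ω) n p))

  private
    take-++ : ∀ n (x y z : List A) → take n y ≡ take n z → take n (x ++ y) ≡ take n (x ++ z)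
    take-++ n       []      y z eq = eq
    take-++ zero    (a ∷ x) y z eq = refl
    take-++ (suc n) (a ∷ x) y z eq = cong (a ∷_) (take-++ n x y z (take-pred n y z eq))
      where
      take-pred : ∀ n (y z : List A) → take (suc n) y ≡ take (suc n) z → take n y ≡ take n z
      take-pred zero    y       z       eq = refl
      take-pred (suc n) []      []      eq = refl
      take-pred (suc n) (a ∷ y) (b ∷ z) eq = cong₂ _∷_ (∷-injectiveˡ eq) (take-pred n y z (∷-injectiveʳ eq))

    take-length : ∀ (x : List A) t → take (length x) (x ++ t) ≡ x
    take-length []      t = refl
    take-length (a ∷ x) t = cong (a ∷_) (take-length x t)

    take-≤ : ∀ n (x : List A) t → n ≤ length x → take n (x ++ t) ≡ take n x
    take-≤ zero    x       t l       = refl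
    take-≤ (suc n) (a ∷ x) t (s≤s l) = cong (a ∷_) (take-≤ n x t l)

    -- The first n + 1 letters of `k` are those of `ū ++ k`, and as `ū` is nonempty these depend on
    -- the first n letters of `k` only.
    unique : ∀ n {k s k′ s′} → ū ++ k ≡ k ++ s → ū ++ k′ ≡ k′ ++ s′ →
             n ≤ length k → n ≤ length k′ → take n k ≡ take n k′
    unique zero    eq eq′ l l′ = refl
    unique (suc n) {k} {s} {k′} {s′} eq eq′ l l′ =
      trans (sym (take-≤ (suc n) k s l)) (trans (cong (take (suc n)) (sym eq))
        (trans (cong (List⁺.head u ∷_) (take-++ n (List⁺.tail u) k k′ (unique n eq eq′ (<⇒≤ l) (<⇒≤ l′))))
          (trans (cong (take (suc n)) eq′) (take-≤ (suc n) k′ s′ l′))))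

  border-powerPrefix : ∀ {k s} → ū ++ k ≡ k ++ s → powerPrefix (length k) ≡ k
  border-powerPrefix {k} {s} eq = trans (sym (take-all (powerPrefix (length k)) _
      (length-applyUpTo (u ^ω) (length k))))
    (trans (unique (length k) (proj₂ (powerPrefix-border (length k))) eq
      (≤-reflexive (sym (length-applyUpTo (u ^ω) (length k)))) ≤-refl) (take-all k _ refl))
    where
    take-all : ∀ (x : List A) n → length x ≡ n → take n x ≡ x
    take-all []      _ refl = refl
    take-all (a ∷ x) _ refl = cong (a ∷_) (take-all x _ refl)

*<-cancel : ∀ a b p m → b < a → 0 < p → a * p ≤ b * m → p < m
*<-cancel a b p@(suc _) m b<a _ le = *-cancelˡ-< b p m (<-≤-trans (*-monoˡ-< p b<a) le)

-- `suc b < a` makes the exponent exceed 1, as `IsPower` demands; the prefix condition holds because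
-- a border is determined by `u` and its length.
Free⇒PowerFree : ∀ a b {F : Pred (List A) 0ℓ} → suc b < a →
                 Free (+ a / suc b) F → PowerFree a (suc b) F
Free⇒PowerFree a b b<a free u@(c ∷ u′) k t 0<u eq Fv le =
  free (+ length v / length u) u⁺ v Fv
    (/-mono-≤ a b (length v) (length u′) (subst (a * length u ≤_) (trans (*-comm (suc b) _)
      (cong (λ l → l * suc b) (sym (length-++ u)))) le))
    record
    { r>1    = /-mono-< 1 0 (length v) (length u′) (subst₂ _<_
                 (sym (+-identityʳ _)) (trans (sym (length-++ u)) (sym (*-identityʳ _)))
                 (*<-cancel a (suc b) (length u) _ b<a 0<u le))
    ; prefix = trans (cong (powerPrefix u⁺) (length-++ u))
                 (trans (powerPrefix-+ u⁺ (length k)) (cong (u ++_) (border-powerPrefix u⁺ eq)))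
    ; ratio  = refl
    }
  where
  u⁺ = c ∷ u′
  v  = u ++ k

PowerFree⁺ : ℕ → ℕ → Pred (List A) 0ℓ → Set
PowerFree⁺ a b F = ∀ u k t → 0 < length u → u ++ k ≡ k ++ t → F (u ++ k) →
                   b * (length u + length k) ≤ a * length u

PowerFree⁺⇒Free⁺ : ∀ a b {F : Pred (List A) 0ℓ} → PowerFree⁺ a (suc b) F → Free⁺ (+ a / suc b) F
PowerFree⁺⇒Free⁺ a b {F} free r u@(c ∷ u′) v Fv r>β record { r>1 = r>1 ; prefix = pre ; ratio = refl } =
  ℚ.<-irrefl refl (ℚ.<-≤-trans r>β (/-mono-≤ (length v) (length u′) a b
    (subst (λ l → l ≤ a * p) (trans (*-comm (suc b) _) (cong (λ l → l * suc b) (sym |v|)))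
      (free ū k _ z<s (proj₂ (powerPrefix-border u m)) (subst F (sym v≡) Fv)))))
  where
  ū = List⁺.toList u
  p = length ū
  p≤|v| : p ≤ length v
  p≤|v| = ≮⇒≥ λ lt → ℚ.<-irrefl refl (ℚ.<-≤-trans r>1 (/-mono-≤ (length v) (length u′) 1 0
    (subst₂ _≤_ (sym (*-identityʳ _)) (sym (+-identityʳ _)) (<⇒≤ lt))))
  -- The subtraction is not truncated: the exponent exceeds 1.
  m = length v ∸ p
  k = powerPrefix u m
  v≡ : ū ++ k ≡ v
  v≡ = trans (sym (powerPrefix-+ u m)) (trans (cong (powerPrefix u) (m+[n∸m]≡n p≤|v|)) pre)
  |v| : length v ≡ p + length k
  |v| = trans (cong length (sym v≡)) (length-++ ū)

-- Boolean tests on words and their soundness.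

infix 4 _==_ _==ʷ_ _∈ᵇ_

_==_ : Fin n → Fin n → Bool
zero  == zero  = true
suc i == suc j = i == j
_     == _     = false

==-sound : (i j : Fin n) → (i == j) ≡ true → i ≡ j
==-sound zero    zero    _ = refl
==-sound (suc i) (suc j) p = cong suc (==-sound i j p)

==-refl : (i : Fin n) → (i == i) ≡ true
==-refl zero    = refl
==-refl (suc i) = ==-refl i

startsWith : Word n → Word n → Bool
startsWith []      _       = true
startsWith (a ∷ u) []      = false
startsWith (a ∷ u) (b ∷ v) = if a == b then startsWith u v else false

startsWith-sound : (u v : Word n) → startsWith u v ≡ true → ∃[ t ] v ≡ u ++ t
startsWith-sound []      v       _ = v , refl
startsWith-sound (a ∷ u) (b ∷ v) p with a == b in a==b
... | true with ==-sound a b a==b | startsWith-sound u v p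
... | refl | t , refl = t , refl

_==ʷ_ : Word n → Word n → Bool
[]      ==ʷ []      = true
(a ∷ u) ==ʷ (b ∷ v) = if a == b then u ==ʷ v else false
_       ==ʷ _       = false

==ʷ-sound : (u v : Word n) → (u ==ʷ v) ≡ true → u ≡ v
==ʷ-sound []      []      _ = refl
==ʷ-sound (a ∷ u) (b ∷ v) p with a == b in a==b
... | true = cong₂ _∷_ (==-sound a b a==b) (==ʷ-sound u v p)

==ʷ-refl : (u : Word n) → (u ==ʷ u) ≡ true
==ʷ-refl []      = refl
==ʷ-refl (a ∷ u) rewrite ==-refl a = ==ʷ-refl u

_∈ᵇ_ : Word n → List (Word n) → Bool
v ∈ᵇ []       = false
v ∈ᵇ (u ∷ us) = if v ==ʷ u then true else v ∈ᵇ us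

∈ᵇ-sound : ∀ (v : Word n) us → (v ∈ᵇ us) ≡ true → v ∈ us
∈ᵇ-sound v (u ∷ us) p with v ==ʷ u in v==u
... | true  = here (==ʷ-sound v u v==u)
... | false = there (∈ᵇ-sound v us p)

∈ᵇ-complete : ∀ (v : Word n) us → v ∈ us → (v ∈ᵇ us) ≡ true
∈ᵇ-complete v (u ∷ us) (here refl) rewrite ==ʷ-refl v = refl
∈ᵇ-complete v (u ∷ us) (there p) with v ==ʷ u
... | true  = refl
... | false = ∈ᵇ-complete v us p

startsWithAny : List (Word n) → Word n → Bool
startsWithAny []       v = false
startsWithAny (u ∷ us) v = if startsWith u v then true else startsWithAny us v

startsWithAny-sound : ∀ us (v : Word n) → startsWithAny us v ≡ true → ∃[ u ] ∃[ t ] (u ∈ us × v ≡ u ++ t)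
startsWithAny-sound (u ∷ us) v p with startsWith u v in eq
... | true  = let t , q = startsWith-sound u v eq in u , t , here refl , q
... | false = let u′ , t , u∈ , q = startsWithAny-sound us v p in u′ , t , there u∈ , q

allF : ∀ n → (Fin n → Bool) → Bool
allF zero    f = true
allF (suc n) f = if f zero then allF n (f ∘ suc) else false

allF-sound : ∀ n f → allF n f ≡ true → ∀ i → f i ≡ true
allF-sound (suc n) f p i with f zero in eq
allF-sound (suc n) f p zero    | true = eq
allF-sound (suc n) f p (suc i) | true = allF-sound n (f ∘ suc) p i

lcp : Word n → Word n → ℕ
lcp []      _       = 0
lcp (a ∷ u) []      = 0
lcp (a ∷ u) (b ∷ v) = if a == b then suc (lcp u v) else 0

lcp-sound : (u v : Word n) → ∃[ k ] ∃[ u′ ] ∃[ v′ ] (u ≡ k ++ u′ × v ≡ k ++ v′ × length k ≡ lcp u v)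
lcp-sound []      v       = [] , [] , v , refl , refl , refl
lcp-sound (a ∷ u) []      = [] , a ∷ u , [] , refl , refl , refl
lcp-sound (a ∷ u) (b ∷ v) with a == b in eq
... | false = [] , a ∷ u , b ∷ v , refl , refl , refl
... | true with ==-sound a b eq | lcp-sound u v
... | refl | k , u′ , v′ , refl , refl , q = a ∷ k , u′ , v′ , refl , refl , cong suc q

module _ (a b : ℕ) where

  -- The last argument is `y` without its first `p` letters, so `p + lcp y (c ∷ t)` is the length of
  -- the longest prefix of `y` with period `p`. Powers are sought at the front only: a search that
  -- tests after every new letter meets a power when its last letter arrives there.
  powersFrom : Word n → ℕ → Word n → Bool
  powersFrom y p []      = false
  powersFrom y p (c ∷ t) = if a * p ≤ᵇ b * (p + lcp y (c ∷ t)) then true else powersFrom y (suc p) t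

  hasPower : Word n → Bool
  hasPower []      = false
  hasPower (c ∷ y) = powersFrom (c ∷ y) 1 y

  record StartsWithPower (y : Word n) : Set where
    constructor power
    field
      u k t s : Word n
      nonempty : 0 < length u
      border   : u ++ k ≡ k ++ t
      split    : y ≡ (u ++ k) ++ s
      large    : a * length u ≤ b * (length u + length k)

  powersFrom-sound : ∀ u t {y : Word n} → 0 < length u → y ≡ u ++ t →
                     powersFrom y (length u) t ≡ true → StartsWithPower y
  powersFrom-sound u (c ∷ t) {y} 0<u refl p
    with a * length u ≤ᵇ b * (length u + lcp (u ++ c ∷ t) (c ∷ t)) in le
  ... | false = subst StartsWithPower assoc (powersFrom-sound (u ∷ʳ c) t 0<u∷ʳc refl
        (subst (λ m → powersFrom ((u ∷ʳ c) ++ t) m t ≡ true)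
            (sym (trans (length-++ u) (+-comm (length u) 1)))
          (subst (λ y → powersFrom y (suc (length u)) t ≡ true) (sym assoc) p)))
    where
    assoc : (u ∷ʳ c) ++ t ≡ u ++ c ∷ t
    assoc = ++-assoc u [ c ] t
    0<u∷ʳc : 0 < length (u ∷ʳ c)
    0<u∷ʳc = ≤-trans 0<u (subst (length u ≤_) (sym (length-++ u)) (m≤m+n _ 1))
  ... | true with lcp-sound (u ++ c ∷ t) (c ∷ t)
  ... | k , u′ , v′ , eq , eq′ , |k|
    with ++-split (u ++ k) k (trans (++-assoc u k v′) (trans (cong (u ++_) (sym eq′)) eq))
           (subst (length k ≤_) (sym (length-++ u)) (m≤n+m _ (length u)))
  ... | e , q , _ = power u k e v′ 0<u q (trans (cong (u ++_) eq′) (sym (++-assoc u k v′)))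
        (subst (λ m → a * length u ≤ b * (length u + m)) (sym |k|) (≤ᵇ-true _ le))

  hasPower-sound : (y : Word n) → hasPower y ≡ true → StartsWithPower y
  hasPower-sound (c ∷ y) p = powersFrom-sound [ c ] y z<s refl p

  hasPower-kills : {F : Pred (Word n) 0ℓ} → Language F → PowerFree a b F → ∀ y → hasPower y ≡ true → ¬ F y
  hasPower-kills lang free y p Fy with hasPower-sound y p
  ... | power u k t s 0<u eq refl le = free u k t 0<u eq (prefix lang (u ++ k) Fy) le

-- Exhaustive search through the one-letter extensions, to the left or to the
-- right, of a word. The leaf test is applied after each extension.

data Dir : Set where
  L R : Dir

flip : Dir → Dir
flip L = R
flip R = L

module _ {S : Set} {n : ℕ} (grow : Dir → Fin n → S → S) (leaf : Dir → S → Bool) (next : Dir → Dir) where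

  mutual
    explore : ℕ → Dir → S → Bool
    explore zero    d s = false
    explore (suc k) d s = allF n λ a → visit k d (grow d a s)

    visit : ℕ → Dir → S → Bool
    visit k d s = if leaf d s then true else explore k (next d) s

  -- `Sem` may depend on the remaining depth: in `scan` it guarantees that enough of the prescribed
  -- letters are left.
  module _ (Sem : ℕ → S → Set) {Goal : Set}
           (step  : ∀ k d s → Sem (suc k) s → ∃[ a ] Sem k (grow d a s))
           (sound : ∀ k d s → leaf d s ≡ true → Sem k s → Goal) where

    mutual
      explore-sound : ∀ k d s → explore k d s ≡ true → Sem k s → Goal
      explore-sound (suc k) d s p q with step k d s q
      ... | a , r = visit-sound k d (grow d a s) (allF-sound n _ p a) r

      visit-sound : ∀ k d s → visit k d s ≡ true → Sem k s → Goal
      visit-sound k d s p q with leaf d s in eq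
      ... | true  = sound k d s eq q
      ... | false = explore-sound k (next d) s p q

-- A word is stored together with its reversal, so that the end at which it has
-- grown last can be read from the head of a list.

growʷ : Dir → Fin n → Word n × Word n → Word n × Word n
growʷ L a (x , y) = a ∷ x , y ∷ʳ a
growʷ R a (x , y) = x ∷ʳ a , a ∷ y

head-end : Dir → Word n × Word n → Word n
head-end L (x , y) = x
head-end R (x , y) = y

oriented : Dir → Pred (Word n) 0ℓ → Pred (Word n) 0ℓ
oriented L F = F
oriented R F = F ∘ reverse

orient : Dir → Word n → Word n
orient L v = v
orient R v = reverse v

reverse-∷ʳ : ∀ (v : Word n) a → reverse (v ∷ʳ a) ≡ a ∷ reverse v
reverse-∷ʳ v a = reverse-++ v [ a ]

-- With `id` for `next` the word grows at one end only, with `flip` at both ends in turn; `kill`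
-- reads it from the end that has just grown.
search : (Dir → Word n → Bool) → (Dir → Dir) → ℕ → Dir → Word n → Bool
search kill next k d x = explore growʷ (λ d s → kill d (head-end d s)) next k d (x , reverse x)

search-sound : {F : Pred (Word n) 0ℓ} → Language F → {Goal : Set} (kill : Dir → Word n → Bool) →
               (∀ d v → kill d v ≡ true → oriented d F v → Goal) →
               ∀ next k d x → search kill next k d x ≡ true → F x → Goal
search-sound {F = F} lang kill sound next k d x p Fx =
  explore-sound growʷ _ next (λ _ (x , y) → y ≡ reverse x × F x)
    (λ { k L (x , _) (refl , Fx) → let a , q = extendˡ lang x Fx in a , sym (unfold-reverse a x) , q
       ; k R (x , _) (refl , Fx) → let a , q = extendʳ lang x Fx in a , sym (reverse-∷ʳ x a) , q })
    (λ { k L (x , _) q (refl , Fx) → sound L x q Fx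
       ; k R (x , _) q (refl , Fx) → sound R (reverse x) q (subst F (sym (reverse-involutive x)) Fx) })
    k d (x , reverse x) p (refl , Fx)

-- The variant in which the extension to the right is prescribed.
scan : (Word n → Bool) → ℕ → Word n → Bool
scan kill k x = explore (λ _ → growʷ R) (λ _ (x , y) → kill y) (const R) k R (x , reverse x)

scan-sound : (W : Word n) {Goal : Set} (kill : Word n → Bool) →
             (∀ v t → kill v ≡ true → W ≡ reverse v ++ t → Goal) →
             ∀ k x t → scan kill k x ≡ true → W ≡ x ++ t → k ≤ length t → Goal
scan-sound W kill sound k x t p W≡ k≤ =
  explore-sound (λ _ → growʷ R) _ (const R) (λ k (x , y) → ∃[ t ]
      (y ≡ reverse x × W ≡ x ++ t × k ≤ length t))
    (λ { k d (x , y) (a ∷ t , refl , eq , s≤s le) →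
           a , t , sym (reverse-∷ʳ x a) , trans eq (sym (++-assoc x [ a ] t)) , le })
    (λ { k d (x , _) q (t , refl , eq , _) →
           sound (reverse x) t q (trans eq (cong (_++ t) (sym (reverse-involutive x)))) })
    k R (x , reverse x) p (t , refl , W≡ , k≤)

oriented-language : ∀ d {F : Pred (Word n) 0ℓ} → Language F → Language (oriented d F)
oriented-language L lang = lang
oriented-language R lang = reverse-language lang

oriented-powerFree : ∀ d a b {F : Pred (Word n) 0ℓ} → PowerFree a b F → PowerFree a b (oriented d F)
oriented-powerFree L a b free = free
oriented-powerFree R a b {F} free = powerFree-reverse a b {F} free

orient-oriented : ∀ d {F : Pred (Word n) 0ℓ} u {t} → Language F → oriented d F (orient d u ++ t) → F u
orient-oriented L     u lang p = prefix lang u p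
orient-oriented R {F} u lang p = subst F (reverse-involutive u)
    (prefix (reverse-language lang) (reverse u) p)

-- The sixteen palindromes.

palindrome? : Word n → Bool
palindrome? v = reverse v ==ʷ v

insert : Word n → List (Word n) → List (Word n)
insert v ps = if v ∈ᵇ ps then ps else v ∷ ps

-- A new letter completes at most one new palindrome, the longest one that ends there.
addPalindrome : List ℕ → Word n → List (Word n) → List (Word n)
addPalindrome []       z ps = ps
addPalindrome (k ∷ ks) z ps = if palindrome? (take k z) then insert (take k z) ps else addPalindrome ks z ps

module _ {P : Pred (Word n) 0ℓ} where
  private
    Ok : List (Word n) → Set
    Ok ps = Unique ps × All (P ∩ Palindrome) ps

  insert-sound : ∀ v ps → P v → Palindrome v → Ok ps → Ok (insert v ps)
  insert-sound v ps Pv pal (uniq , all) with v ∈ᵇ ps in eq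
  ... | true  = uniq , all
  ... | false = (All.tabulate (λ { {u} u∈ refl → true≢false (trans (sym (∈ᵇ-complete v ps u∈)) eq) }) ∷
      uniq) , ((Pv , pal) ∷ all)
    where
    true≢false : true ≢ false
    true≢false ()

  addPalindrome-sound : ∀ ks z ps → (∀ k → Palindrome (take k z) → P (take k z)) →
                        Ok ps → Ok (addPalindrome ks z ps)
  addPalindrome-sound []       z ps Pz ok = ok
  addPalindrome-sound (k ∷ ks) z ps Pz ok with palindrome? (take k z) in eq
  ... | false = addPalindrome-sound ks z ps Pz ok
  ... | true  = insert-sound (take k z) ps (Pz k pal) pal ok
    where
    pal = ==ʷ-sound (reverse (take k z)) (take k z) eq

-- Odd lengths suffice, as a nonempty palindrome of even length has a square in its middle.
-- Palindromes longer than 13 may go uncounted, which can only prolong a search.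
palindromeLengths : List ℕ
palindromeLengths = 13 ∷ 11 ∷ 9 ∷ 7 ∷ 5 ∷ 3 ∷ 1 ∷ []

Counted : ℕ → Set
Counted n = (Word n × Word n) × List (Word n)

count : Dir → Word n × Word n → List (Word n) → Counted n
count d s ps = s , addPalindrome palindromeLengths (head-end d s) ps

growᶜ : Dir → Fin n → Counted n → Counted n
growᶜ d a (s , ps) = count d (growʷ d a s) ps

module Counting (a b N : ℕ) (targets : List (Word 3)) where

  leafᶜ : Word 3 → List (Word 3) → Bool
  leafᶜ y ps = startsWithAny targets y ∨ (hasPower a b y ∨ (N <ᵇ length ps))

  -- Palindromes inside the start word count only when they turn up again at the growing end. The
  -- count may thus be too low, which is harmless.
  finds : ℕ → Word 3 → Bool
  finds k x = explore growᶜ (λ _ ((x , y) , ps) → leafᶜ y ps) id k R ((x , reverse x) , [ [] ])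

  module _ {F : Pred (Word 3) 0ℓ} (lang : Language F) (free : PowerFree a b F)
           (few : AtMost N (F ∩ Palindrome)) where
    private
      Sem : ℕ → Counted 3 → Set
      Sem _ ((x , y) , ps) = (y ≡ reverse x × F x) × (Unique ps × All (F ∩ Palindrome) ps)

      Sem-count : ∀ d s ps → proj₂ s ≡ reverse (proj₁ s) → F (proj₁ s) →
                  Unique ps × All (F ∩ Palindrome) ps → ∀ k → Sem k (count d s ps)
      Sem-count L (x , y) ps refl Fx ok k =
        (refl , Fx) , addPalindrome-sound palindromeLengths x ps
            (λ k pal → prefix lang (take k x) (subst F (sym (take++drop≡id k x)) Fx)) ok
      Sem-count R (x , y) ps refl Fx ok k =
        (refl , Fx) , addPalindrome-sound palindromeLengths y ps
          (λ k pal → subst F pal (prefix (reverse-language lang) (take k y)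
            (subst (F ∘ reverse) (sym (take++drop≡id k y)) (subst F (sym (reverse-involutive x)) Fx)))) ok

      step : ∀ k d s → Sem (suc k) s → ∃[ a ] Sem k (growᶜ d a s)
      step k L ((x , y) , ps) ((refl , Fx) , ok) with extendˡ lang x Fx
      ... | a , Fax = a , Sem-count L (growʷ L a (x , y)) ps (sym (unfold-reverse a x)) Fax ok k
      step k R ((x , y) , ps) ((refl , Fx) , ok) with extendʳ lang x Fx
      ... | a , Fxa = a , Sem-count R (growʷ R a (x , y)) ps (sym (reverse-∷ʳ x a)) Fxa ok k

      sound : ∀ k (d : Dir) s → leafᶜ (proj₂ (proj₁ s)) (proj₂ s) ≡ true → Sem k s →
              ∃[ u ] (u ∈ targets × F (reverse u))
      sound k d ((x , y) , ps) p ((refl , Fx) , uniq , all) with ∨-true (startsWithAny targets y) p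
      ... | inj₁ q = let u , t , u∈ , eq = startsWithAny-sound targets y q in
        u , u∈ , prefix (reverse-language lang) u (subst (F ∘ reverse) eq Fy)
        where Fy = subst F (sym (reverse-involutive x)) Fx
      ... | inj₂ p with ∨-true (hasPower a b y) p
      ... | inj₁ q = ⊥-elim (hasPower-kills a b (reverse-language lang) (powerFree-reverse a b {F} free) y q
                       (subst F (sym (reverse-involutive x)) Fx))
      ... | inj₂ q = ⊥-elim (<⇒≱ (<ᵇ⇒< N _ (Equivalence.from T-≡ q)) (few ps uniq all))

    finds-sound : ∀ k x → finds k x ≡ true → F x → ∃[ u ] (u ∈ targets × F (reverse u))
    finds-sound k x p Fx = explore-sound growᶜ _ id Sem step sound k R ((x , reverse x) , [ [] ]) p
      ((refl , Fx) , ([] ∷ []) , (inhabited lang , refl) ∷ [])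

aba : Fin n → Fin n → Word n
aba a b = a ∷ b ∷ a ∷ []

cabac : Fin n → Fin n → Fin n → Word n
cabac a b c = c ∷ a ∷ b ∷ a ∷ c ∷ []

distinct : List (Word 3)
distinct = aba 0F 1F ∷ aba 0F 2F ∷ aba 1F 0F ∷ aba 1F 2F ∷ aba 2F 0F ∷ aba 2F 1F ∷ []

centred : List (Word 3)
centred = cabac 0F 1F 2F ∷ cabac 0F 2F 1F ∷ cabac 1F 0F 2F ∷ cabac 1F 2F 0F ∷ cabac 2F 0F 1F ∷ cabac 2F 1F
    0F ∷ []

palindromes₁₆ : List (Word 3)
palindromes₁₆ = [] ∷ [ 0F ] ∷ [ 1F ] ∷ [ 2F ] ∷ distinct ++ centred

find : ℕ → ℕ → ℕ → ℕ → Word 3 → Word 3 → Set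
find a b N k u v = Counting.finds a b N [ u ] k v ≡ true

reaches : ℕ → ℕ → Word n → Dir → Word n → Bool
reaches a b u d v = startsWith (orient d u) v ∨ hasPower a b v

reaches-sound : ∀ a b (u : Word n) {F : Pred (Word n) 0ℓ} → Language F → PowerFree a b F →
                ∀ d v → reaches a b u d v ≡ true → oriented d F v → F u
reaches-sound a b u {F} lang free d v p Fv with ∨-true (startsWith (orient d u) v) p
... | inj₁ q = let t , eq = startsWith-sound (orient d u) v q in
               orient-oriented d u lang (subst (oriented d F) eq Fv)
... | inj₂ q = ⊥-elim (hasPower-kills a b (oriented-language d lang) (oriented-powerFree d a b {F} free) v q
    Fv)

-- A word that avoids one of the `aba` runs into a large power or collects more than `N` palindromes
-- within `k` letters. Except for `either`, each search starts from an `aba` that is already known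
-- to occur.
module Sixteen (a b N k : ℕ)
  (either : Counting.finds a b N (aba 0F 1F ∷ aba 0F 2F ∷ []) k [] ≡ true)
  (find₀₁ : find a b N k (aba 0F 1F) (aba 0F 2F))
  (find₀₂ : find a b N k (aba 0F 2F) (aba 0F 1F))
  (find₁₀ : find a b N k (aba 1F 0F) (aba 0F 1F))
  (find₁₂ : find a b N k (aba 1F 2F) (aba 0F 2F))
  (find₂₀ : find a b N k (aba 2F 0F) (aba 0F 2F))
  (find₂₁ : find a b N k (aba 2F 1F) (aba 0F 1F))
  (around : All (λ u → search (reaches a b u) flip 2 R (take 3 (drop 1 u)) ≡ true) centred)
  {F : Pred (Word 3) 0ℓ} (lang : Language F) (free : PowerFree a b F)
  (few : AtMost N (F ∩ Palindrome)) where

  private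
    open Counting a b N
    seek : ∀ u {v} → find a b N k u v → F v → F (reverse u)
    seek u {v} p Fv with finds-sound [ u ] lang free few k v p Fv
    ... | _ , here refl , q = q

    both : F (aba 0F 1F) × F (aba 0F 2F)
    both with finds-sound (aba 0F 1F ∷ aba 0F 2F ∷ []) lang free few k [] either (inhabited lang)
    ... | _ , here refl         , q = q , seek (aba 0F 2F) find₀₂ q
    ... | _ , there (here refl) , q = seek (aba 0F 1F) find₀₁ q , q

    F-distinct : All F distinct
    F-distinct = let p , q = both in
      p ∷ q ∷ seek (aba 1F 0F) find₁₀ p ∷ seek (aba 1F 2F) find₁₂ q ∷ seek (aba 2F 0F) find₂₀ q ∷ seek
          (aba 2F 1F) find₂₁ p ∷ []

    widen : ∀ u {v} → search (reaches a b u) flip 2 R v ≡ true → F v → F u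
    widen u {v} = search-sound lang (reaches a b u) (reaches-sound a b u lang free) flip 2 R v

    -- A neighbour of `aba` equal to `a` gives a square `aa`, and one equal to `b` gives `abab` or
    -- `baba`; so both neighbours are `c`.
    F-centred : All F distinct → All (λ u → search (reaches a b u) flip 2 R (take 3 (drop 1 u)) ≡ true)
        centred → All F centred
    F-centred (p₁ ∷ p₂ ∷ p₃ ∷ p₄ ∷ p₅ ∷ p₆ ∷ []) (c₁ ∷ c₂ ∷ c₃ ∷ c₄ ∷ c₅ ∷ c₆ ∷ []) =
      widen _ c₁ p₁ ∷ widen _ c₂ p₂ ∷ widen _ c₃ p₃ ∷ widen _ c₄ p₄ ∷ widen _ c₅ p₅ ∷ widen _ c₆ p₆ ∷ []

  all₁₆ : All F palindromes₁₆
  all₁₆ with F-distinct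
  ... | ps@(p₁ ∷ p₂ ∷ p₃ ∷ _) = inhabited lang ∷ prefix lang [ 0F ] p₁ ∷ prefix lang [ 1F ] p₃ ∷ infixʷ lang
      [ 0F ] [ 2F ] p₂
        ∷ ++⁺ ps (F-centred ps around)

palindromes₁₆-unique : Unique palindromes₁₆
palindromes₁₆-unique = from-yes (unique? palindromes₁₆)
  where open import Data.List.Relation.Unary.Unique.DecPropositional (≡-dec (Fin._≟_ {3})) using (unique?)

palindromes₁₆-short : All (λ u → length u < 7) palindromes₁₆
palindromes₁₆-short = from-yes (All.all? (λ u → length u <? 7) palindromes₁₆)

palindromes₁₆-palindromes : All Palindrome palindromes₁₆
palindromes₁₆-palindromes = from-yes (All.all? (λ u → ≡-dec Fin._≟_ (reverse u) u) palindromes₁₆)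

module _ {F : Pred (Word 3) 0ℓ} (all : All F palindromes₁₆) where

  private
    pals : All (F ∩ Palindrome) palindromes₁₆
    pals = All.zip (all , palindromes₁₆-palindromes)

    fresh : ∀ {v} → length v ≡ 7 → All (v ≢_) palindromes₁₆
    fresh |v| = All.map (λ { u<7 refl → <-irrefl |v| u<7 }) palindromes₁₆-short

  -- The 16 known palindromes are shorter. Every longer palindrome of odd length has one of 7
  -- letters as its centre, so the later searches need to watch this length only.
  no-7-palindrome : AtMost 16 (F ∩ Palindrome) → ∀ v → length v ≡ 7 → Palindrome v → ¬ F v
  no-7-palindrome few v |v| pal Fv =
    <⇒≱ {16} ≤-refl (few (v ∷ palindromes₁₆) (fresh |v| ∷ palindromes₁₆-unique) ((Fv , pal) ∷ pals))

  one-7-palindrome : AtMost 17 (F ∩ Palindrome) → ∀ v → length v ≡ 7 → Palindrome v → F v →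
                     ∀ w → length w ≡ 7 → Palindrome w → F w → w ≡ v
  one-7-palindrome few v |v| pal Fv w |w| pal′ Fw with ≡-dec Fin._≟_ w v
  ... | yes w≡v = w≡v
  ... | no  w≢v = ⊥-elim (<⇒≱ {17} ≤-refl
          (few (w ∷ v ∷ palindromes₁₆) ((w≢v ∷ fresh |w|) ∷ fresh |v| ∷ palindromes₁₆-unique)
            ((Fw , pal′) ∷ (Fv , pal) ∷ pals)))

all₁₆-of-16 : {F : Pred (Word 3) 0ℓ} → Language F → PowerFree 52 27 F → AtMost 16 (F ∩ Palindrome) → All F
    palindromes₁₆
-- `64`, and `140` below, are depths of search; any number that lets all branches end will do.
all₁₆-of-16 = Sixteen.all₁₆ 52 27 16 64 refl refl refl refl refl refl refl
    (refl ∷ refl ∷ refl ∷ refl ∷ refl ∷ refl ∷ [])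

all₁₆-of-17 : {F : Pred (Word 3) 0ℓ} → Language F → PowerFree 25 13 F → AtMost 17 (F ∩ Palindrome) → All F
    palindromes₁₆
all₁₆-of-17 = Sixteen.all₁₆ 25 13 17 140 refl refl refl refl refl refl refl
    (refl ∷ refl ∷ refl ∷ refl ∷ refl ∷ refl ∷ [])

-- Exclusion of the palindromes of 7 letters.

∧-true : ∀ b {c} → b ∧ c ≡ true → b ≡ true × c ≡ true
∧-true true p = refl , p

not-true : ∀ b → not b ≡ true → b ≡ false
not-true false _ = refl

true≢false : true ≢ false
true≢false ()

Avoids : List (Word n) → Pred (Word n) 0ℓ → Set
Avoids us F = ∀ {u} → u ∈ us → ¬ F u

everyᵇ : {A : Set} → (A → Bool) → List A → Bool
everyᵇ f []       = true
everyᵇ f (x ∷ xs) = if f x then everyᵇ f xs else false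

everyᵇ-sound : {A : Set} (f : A → Bool) → ∀ xs → everyᵇ f xs ≡ true → ∀ {x} → x ∈ xs → f x ≡ true
everyᵇ-sound f (x ∷ xs) p x∈ with f x in eq
everyᵇ-sound f (x ∷ xs) p (here refl) | true = eq
everyᵇ-sound f (x ∷ xs) p (there x∈)  | true = everyᵇ-sound f xs p x∈

startsWith-++ : ∀ (u t : Word n) → startsWith u (u ++ t) ≡ true
startsWith-++ []      t = refl
startsWith-++ (a ∷ u) t rewrite ==-refl a = startsWith-++ u t

seven : Fin n → Fin n → Fin n → Fin n → Word n
seven a b c d = a ∷ b ∷ c ∷ d ∷ c ∷ b ∷ a ∷ []

startsWithSeven : Word n → Bool
startsWithSeven (a ∷ b ∷ c ∷ d ∷ c′ ∷ b′ ∷ a′ ∷ _) = (a == a′) ∧ ((b == b′) ∧ (c == c′))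
startsWithSeven _ = false

startsWithSeven-sound : (v : Word n) → startsWithSeven v ≡ true →
                        ∃[ a ] ∃[ b ] ∃[ c ] ∃[ d ] ∃[ t ] v ≡ seven a b c d ++ t
startsWithSeven-sound (a ∷ b ∷ c ∷ d ∷ c′ ∷ b′ ∷ a′ ∷ t) p with ∧-true (a == a′) p
... | p , q with ∧-true (b == b′) q
... | q , r with ==-sound a a′ p | ==-sound b b′ q | ==-sound c c′ r
... | refl | refl | refl = a , b , c , d , t , refl

Only7 : List (Word n) → Pred (Word n) 0ℓ → Set
Only7 es F = ∀ a b c d → F (seven a b c d) → seven a b c d ∈ es

module Kill (a b : ℕ) (es us : List (Word 3)) where

  kills : Word 3 → Bool
  kills v = hasPower a b v ∨ ((startsWithSeven v ∧ not (startsWithAny es v)) ∨ startsWithAny us v)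

  module _ {F : Pred (Word 3) 0ℓ} (lang : Language F) (free : PowerFree a b F)
           (only : Only7 es F) (avoids : Avoids us F) where

    kills-sound : ∀ v → kills v ≡ true → ¬ F v
    kills-sound v p Fv with ∨-true (hasPower a b v) p
    ... | inj₁ q = hasPower-kills a b lang free v q Fv
    ... | inj₂ p with ∨-true (startsWithSeven v ∧ not (startsWithAny es v)) p
    ... | inj₂ q = let u , t , u∈ , eq = startsWithAny-sound us v q in
                   avoids u∈ (prefix lang u (subst F eq Fv))
    ... | inj₁ q with ∧-true (startsWithSeven v) q
    ... | q , r with startsWithSeven-sound v q
    ... | x , y , z , w , t , refl =
      true≢false (trans (sym (starts es (only x y z w (prefix lang (seven x y z w) Fv)))) (not-true _ r))
      where
      starts : ∀ es → seven x y z w ∈ es → startsWithAny es (seven x y z w ++ t) ≡ true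
      starts (e ∷ es) (here refl) rewrite startsWith-++ (seven x y z w) t = refl
      starts (e ∷ es) (there e∈) with startsWith e (seven x y z w ++ t)
      ... | true  = refl
      ... | false = starts es e∈

Avoids-reverse : ∀ {us} {F : Pred (Word n) 0ℓ} → Avoids us F → Avoids (map reverse us) (F ∘ reverse)
Avoids-reverse {F = F} avoids u∈ with ∈-map⁻ reverse u∈
... | w , w∈ , refl = λ p → avoids w∈ (subst F (reverse-involutive w) p)

-- `reverse (seven a b c d)` computes to `seven a b c d`, so the hypothesis serves both directions
-- unchanged.
Only7-oriented : ∀ d {es} {F : Pred (Word n) 0ℓ} → Only7 es F → Only7 es (oriented d F)
Only7-oriented L only = only
Only7-oriented R only = only

kills-oriented : ∀ a b es (us : Dir → List (Word 3)) {F : Pred (Word 3) 0ℓ} → Language F → PowerFree a b F →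
                 Only7 es F → (∀ d → Avoids (us d) (oriented d F)) →
                 ∀ d v → Kill.kills a b es (us d) v ≡ true → ¬ oriented d F v
kills-oriented a b es us {F} lang free only av d =
  Kill.kills-sound a b es (us d) (oriented-language d lang) (oriented-powerFree d a b {F} free)
    (Only7-oriented d {es} {F} only) (av d)

shiftClosed : (Word n → Bool) → List (Word n) → List (Word n) → Bool
shiftClosed {n} kill W ws = everyᵇ (λ w → allF n λ c → (drop 1 w ∷ʳ c ∈ᵇ W) ∨ kill (reverse (w ∷ʳ c))) ws

module _ (kill : Word n → Bool) (W : List (Word n)) (closed : shiftClosed kill W W ≡ true)
         {F : Pred (Word n) 0ℓ} (lang : Language F) (sound : ∀ v → kill v ≡ true → ¬ F (reverse v)) where

  -- Moving a window one letter to the right keeps it in `W` or is killed. Hence a factor that has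
  -- entered `W` cannot leave it; `e` is the distance still to go.
  shiftClosed-sound : ∀ e w {w′ t t′} → w ∈ W → 0 < length w → length w ≡ length w′ → F (w ++ t) →
                      w ++ t ≡ e ++ w′ ++ t′ → w′ ∈ W
  shiftClosed-sound []      w w∈ 0<w |w| Fwt eq = subst (_∈ W) (proj₁ (++-cancel-length w _ eq |w|)) w∈
  shiftClosed-sound (x ∷ e) (y ∷ w) {w′} {[]} {t′} w∈ 0<w |w| Fwt eq =
    ⊥-elim (<-irrefl (trans (sym |w|) (cong length (trans (sym (++-identityʳ (y ∷ w))) eq)))
      (s≤s (subst (length w′ ≤_) (sym (trans (length-++ e) (cong (λ z → length e + z) (length-++ w′))))
        (≤-trans (m≤m+n _ (length t′)) (m≤n+m _ (length e))))))
  shiftClosed-sound (x ∷ e) (y ∷ w) {w′} {c ∷ t} {t′} w∈ 0<w |w| Fwt eq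
    with ∨-true (w ∷ʳ c ∈ᵇ W) (allF-sound n _ (everyᵇ-sound _ W closed w∈) c)
  ... | inj₂ killed = ⊥-elim (sound _ killed (subst F (sym (reverse-involutive _))
          (prefix lang (y ∷ w ∷ʳ c) (subst F (sym (++-assoc (y ∷ w) [ c ] t)) Fwt))))
  ... | inj₁ w∷ʳc∈ = shiftClosed-sound e (w ∷ʳ c) (∈ᵇ-sound _ W w∷ʳc∈)
          (subst (0 <_) (sym |wc|) z<s) (trans |wc| |w|)
          (subst F (sym (++-assoc w [ c ] t)) (suffix lang [ y ] Fwt))
          (trans (++-assoc w [ c ] t) (proj₂ (∷-injective eq)))
    where
    |wc| : length (w ∷ʳ c) ≡ suc (length w)
    |wc| = trans (length-++ w) (+-comm (length w) 1)

windowsFrom : ℕ → ℕ → Word n → List (Word n) → List (Word n)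
windowsFrom k zero    v ws = ws
windowsFrom k (suc m) v ws = insert (take k v) (windowsFrom k m (drop 1 v) ws)

windows : ℕ → Word n → List (Word n) → List (Word n)
windows k v = windowsFrom k (suc (length v) ∸ k) v

-- These contain all factors of length 2 of η^ω(0), see `pairs-only`.
pairs : List (Word 4)
pairs = (0F ∷ 1F ∷ []) ∷ (0F ∷ 2F ∷ []) ∷ (0F ∷ 3F ∷ []) ∷ (1F ∷ 0F ∷ []) ∷ (1F ∷ 3F ∷ []) ∷
        (2F ∷ 0F ∷ []) ∷ (3F ∷ 0F ∷ []) ∷ (3F ∷ 2F ∷ []) ∷ []

collect : List (Word 4) → List (Word 3)
collect []       = []
collect (v ∷ vs) = windows 11 ((γ *) v) (collect vs)

-- Images under γ have at least 15 letters, so a window of 11 letters of γ(η^ω(0)) lies in the image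
-- of a pair.
L₁₁ R₁₁ : List (Word 3)
L₁₁ = collect pairs
R₁₁ = map reverse L₁₁

Irreducible : Pred (Word n) 0ℓ → Set
Irreducible F = ∀ x y → F x → F y → ∃[ t ] F (x ++ t ++ y)

somewhere : ∀ {n} → (Word n → Bool) → Word n → Bool
somewhere b []      = false
somewhere b (a ∷ v) = b (a ∷ v) ∨ somewhere b v

somewhere-sound : ∀ {n} (b : Word n → Bool) {F : Pred (Word n) 0ℓ} → Language F → (∀ v → b v ≡ true → ¬ F v)
    →
                  ∀ v → somewhere b v ≡ true → ¬ F v
somewhere-sound b lang sound (a ∷ v) p Fv with ∨-true (b (a ∷ v)) p
... | inj₁ q = sound (a ∷ v) q Fv
... | inj₂ q = somewhere-sound b lang sound v q (suffix lang [ a ] Fv)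

module Absorption (k m : ℕ) (v : Word 3) where

  open Kill 25 13 [ v ] []

  -- W is entered after every occurrence of v, is never left, and does not see v.
  enters : List (Word 3) → Dir → Word 3 → Bool
  enters W L y = kills y
  enters W R y = kills y ∨ (11 ≤ᵇ length y) ∧ (reverse (take 11 y) ∈ᵇ W)

  -- The square-free palindromes of 7 letters have the form abacaba or abcacba. Every letter after
  -- abacaba completes a square, so depth 1 is enough to dispose of it; only abcacba is left for
  -- `absorbs`.
  dead : Bool
  dead = somewhere (hasPower 25 13) v ∨ search (λ _ → kills) id k R v

  absorbs : List (Word 3) → Bool
  absorbs W = search (enters W) id m R v ∧
              (shiftClosed kills W W ∧ everyᵇ (λ w → not (drop 4 w ==ʷ v)) W)

  module _ {F : Pred (Word 3) 0ℓ} (lang : Language F) (free : PowerFree 25 13 F) (only : Only7 [ v ] F)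
      where

    private
      killed : ∀ d u → kills u ≡ true → ¬ oriented d F u
      killed = kills-oriented 25 13 [ v ] (const []) lang free only (λ _ ())

    dead-sound : dead ≡ true → ¬ F v
    dead-sound p Fv with ∨-true (somewhere (hasPower 25 13) v) p
    ... | inj₁ q = somewhere-sound (hasPower 25 13) lang (hasPower-kills 25 13 lang free) v q Fv
    ... | inj₂ q = search-sound lang (λ _ → kills) killed id k R v q Fv

    enters-sound : ∀ W d y → enters W d y ≡ true → oriented d F y → ∃[ w ]
        (w ∈ W × 0 < length w × length w ≡ 11 × F w)
    enters-sound W L y p Fy = ⊥-elim (killed L y p Fy)
    enters-sound W R y p Fy with ∨-true (kills y) p
    ... | inj₁ q = ⊥-elim (killed R y q Fy)
    ... | inj₂ q with ∧-true (11 ≤ᵇ length y) q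
    ... | le , w∈ = _ , ∈ᵇ-sound _ W w∈ , subst (0 <_) (sym |w|) z<s , |w| ,
                    prefix (reverse-language lang) (take 11 y)
                        (subst (F ∘ reverse) (sym (take++drop≡id 11 y)) Fy)
      where
      |w| : length (reverse (take 11 y)) ≡ 11
      |w| = trans (length-reverse (take 11 y)) (trans (length-take 11 y) (m≤n⇒m⊓n≡m (≤ᵇ-true 11 le)))

    absorbs-sound : ∀ W → absorbs W ≡ true → length v ≡ 7 → Irreducible F → ¬ F v
    absorbs-sound W p |v| irr Fv with ∧-true (search (enters W) id m R v) p
    ... | p₁ , p with ∧-true (shiftClosed kills W W) p
    ... | p₂ , p₃ with search-sound lang (enters W) (enters-sound W) id m R v p₁ Fv
    -- Four letters before `v` fill a window of 11, which by irreducibility recurs after `w` and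
    -- hence lies in `W`; but no window in `W` ends in `v`.
    ... | w , w∈ , 0<w , |w| , Fw with extendˡ* lang 4 v Fv
    ... | e@(_ ∷ _ ∷ _ ∷ _ ∷ []) , refl , Fev with irr w (e ++ v) Fw Fev
    ... | t , Fz = true≢false (trans (sym (==ʷ-refl v)) (not-true _ (everyᵇ-sound _ W p₃
      (shiftClosed-sound kills W p₂ lang (killed R) (w ++ t) w {e ++ v} {t ++ e ++ v} {[]} w∈ 0<w
          (trans |w| (sym (cong (λ z → 4 + z) |v|))) Fz
        (trans (sym (++-assoc w t (e ++ v))) (cong ((w ++ t) ++_) (sym (++-identityʳ (e ++ v)))))))))

rename : Fin 3 → Fin 3 → Fin 3 → Fin 3 → Fin 3
rename a b c 0F = a
rename a b c 1F = b
rename a b c 2F = c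

-- After abcacba the word continues like a reversed γ(η^ω(0)) with its letters renamed. If a, b, c
-- are not distinct the renaming is no bijection, but then `dead` applies.
renamings : Fin 3 → Fin 3 → Fin 3 → List (Word 3)
renamings a b c = map (map (rename c a b)) R₁₁

module _ (k m : ℕ) (W : Fin 3 → Fin 3 → Fin 3 → List (Word 3)) (a b c d : Fin 3) where

  open Absorption k m (seven a b c d)

  excluded : Bool
  excluded = dead ∨ absorbs (W a b c)

  excluded-sound : excluded ≡ true → {F : Pred (Word 3) 0ℓ} → Language F → PowerFree 25 13 F →
                   Only7 [ seven a b c d ] F → Irreducible F → ¬ F (seven a b c d)
  excluded-sound p lang free only irr with ∨-true dead p
  ... | inj₁ q = dead-sound lang free only q
  ... | inj₂ q = absorbs-sound lang free only (W a b c) q refl irr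

module _ (k m : ℕ) (W : Fin 3 → Fin 3 → Fin 3 → List (Word 3)) where

  excluded₃ : Fin 3 → Fin 3 → Fin 3 → Bool
  excluded₃ a b c = allF 3 (excluded k m W a b c)

  excluded₂ : Fin 3 → Fin 3 → Bool
  excluded₂ a b = allF 3 (excluded₃ a b)

  excluded₁ : Fin 3 → Bool
  excluded₁ a = allF 3 (excluded₂ a)

  module _ (p : allF 3 excluded₁ ≡ true) {F : Pred (Word 3) 0ℓ} (lang : Language F)
      (free : PowerFree 25 13 F)
           (irr : Irreducible F) (few : AtMost 17 (F ∩ Palindrome)) (all : All F palindromes₁₆) where

    -- If this palindrome occurs, it is the only one of 7 letters, so the searches may discard all
    -- the others.
    no-seven : ∀ a b c d → ¬ F (seven a b c d)
    no-seven a b c d Fv = excluded-sound k m W a b c d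
      (allF-sound 3 (excluded k m W a b c) (allF-sound 3 (excluded₃ a b)
          (allF-sound 3 (excluded₂ a) (allF-sound 3 excluded₁ p a) b) c) d)
      lang free
      (λ a′ b′ c′ d′ Fw → here (one-7-palindrome all few (seven a b c d) refl refl Fv (seven a′ b′ c′ d′)
          refl refl Fw))
      irr Fv

-- The two kinds of windows do not mix.

-- What is left of irreducibility for a bi-infinite word: two factors lie in a common one, but their
-- order cannot be chosen.
Directed : Pred (Word n) 0ℓ → Set
Directed F = ∀ x y → F x → F y → ∃[ s ] ∃[ t ] ∃[ s′ ] ∃[ t′ ]
    (F (s ++ x ++ t) × s ++ x ++ t ≡ s′ ++ y ++ t′)

module Orientation (Ls Rs : List (Word 3)) (k : ℕ) where

  open Kill 52 27 [] []

  covers : Word 3 → Bool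
  covers y = kills y ∨ (reverse y ∈ᵇ Ls ++ Rs)

  module _ (closedᴸ : shiftClosed kills Ls Ls ≡ true) (closedᴿ : shiftClosed kills Rs Rs ≡ true)
           (disjoint : everyᵇ (λ w → not (w ∈ᵇ Rs)) Ls ≡ true)
           (sized : everyᵇ (λ w → length w ≡ᵇ 11) (Ls ++ Rs) ≡ true)
           (cover : scan covers k [] ≡ true)
           {F : Pred (Word 3) 0ℓ} (lang : Language F) (free : PowerFree 52 27 F) (only : Only7 [] F)
           (directed : Directed F) where

    private
      killed : ∀ d v → kills v ≡ true → ¬ oriented d F v
      killed = kills-oriented 52 27 [] (const []) lang free only (λ _ ())

      size : ∀ {w} → w ∈ Ls ++ Rs → length w ≡ 11
      size w∈ = ≡ᵇ⇒≡ _ 11 (Equivalence.from T-≡ (everyᵇ-sound _ (Ls ++ Rs) sized w∈))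

      sizeᴸ : ∀ {w} → w ∈ Ls → length w ≡ 11
      sizeᴸ = size ∘ ∈-++⁺ˡ

      sizeᴿ : ∀ {w} → w ∈ Rs → length w ≡ 11
      sizeᴿ = size ∘ ∈-++⁺ʳ Ls

      apart : ∀ {w} → w ∈ Ls → w ∈ Rs → ⊥
      apart l r = true≢false (trans (sym (∈ᵇ-complete _ Rs r)) (not-true _ (everyᵇ-sound _ Ls disjoint l)))

      forward : ∀ V → shiftClosed kills V V ≡ true → ∀ s {w t} s′ {w′ t′} → w ∈ V → length w ≡ 11 → length
          w′ ≡ 11 →
                F (s ++ w ++ t) → s ++ w ++ t ≡ s′ ++ w′ ++ t′ → length s ≤ length s′ → w′ ∈ V
      forward V closed s {w} s′ w∈ |w| |w′| Fz eq le with ++-split s′ s (sym eq) le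
      ... | e , _ , eq′ = shiftClosed-sound kills V closed lang (killed R) e w w∈
          (subst (0 <_) (sym |w|) z<s)
                            (trans |w| (sym |w′|)) (suffix lang s Fz) eq′

      -- Whichever of the two comes first in a common factor forces its own kind on the other, and
      -- the kinds are disjoint.
      clash : ∀ {l r} → l ∈ Ls → r ∈ Rs → F l → F r → ⊥
      clash {l} {r} l∈ r∈ Fl Fr with directed l r Fl Fr
      ... | s , t , s′ , t′ , Fz , eq with ≤-total (length s) (length s′)
      ... | inj₁ le = apart (forward Ls closedᴸ s s′ l∈ (sizeᴸ l∈) (sizeᴿ r∈) Fz eq le) r∈
      ... | inj₂ le = apart l∈ (forward Rs closedᴿ s′ s r∈ (sizeᴿ r∈) (sizeᴸ l∈) (subst F eq Fz) (sym eq)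
          le)

    orientation : Avoids Rs F ⊎ Avoids Ls F
    orientation with extendʳ* lang k [] (inhabited lang)
    ... | x , |x| , Fx with scan-sound x {Goal = ∃[ w ] (w ∈ Ls ++ Rs × F w)} covers
                       (λ v t p eq → [ (λ q → ⊥-elim
                           (killed R v q (prefix lang (reverse v) (subst F eq Fx))))
                                                   , (λ q → reverse v , ∈ᵇ-sound _ (Ls ++ Rs) q , prefix
                                                       lang (reverse v) (subst F eq Fx)) ]′
                                       (∨-true (kills v) p))
                       k [] x cover refl (≤-reflexive (sym |x|))
    ... | w , w∈ , Fw with ∈-++⁻ Ls w∈
    ... | inj₁ l∈ = inj₁ λ r∈ Fr → clash l∈ r∈ Fw Fr
    ... | inj₂ r∈ = inj₂ λ l∈ Fl → clash l∈ r∈ Fl Fw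

-- Enlarging a list of forbidden words, each by a search that uses its predecessors.

module Pruning (base : Word n → Bool) (k : ℕ) where

  bad : List (Word n) → List (Word n) → Dir → Word n → Bool
  bad us us′ L v = base v ∨ startsWithAny us v
  bad us us′ R v = base v ∨ startsWithAny us′ v

  prune : List (Word n) → List (Word n) → List (Word n) → Bool
  prune us us′ []       = true
  prune us us′ (v ∷ vs) = search (bad us us′) flip k R v ∧ prune (v ∷ us) (reverse v ∷ us′) vs

  module _ {F : Pred (Word n) 0ℓ} (lang : Language F) (sound : ∀ d v → base v ≡ true → ¬ oriented d F v)
      where

    startsWithAny-kills : ∀ {F : Pred (Word n) 0ℓ} us → Language F → Avoids us F → ∀ v → startsWithAny us v
        ≡ true → ¬ F v
    startsWithAny-kills {F} us lang avoids v p Fv with startsWithAny-sound us v p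
    ... | u , t , u∈ , refl = avoids u∈ (prefix lang u Fv)

    bad-sound : ∀ us us′ → Avoids us F → Avoids us′ (F ∘ reverse) → ∀ d v → bad us us′ d v ≡ true → ¬
        oriented d F v
    bad-sound us us′ av av′ L v p Fv with ∨-true (base v) p
    ... | inj₁ q = sound L v q Fv
    ... | inj₂ q = startsWithAny-kills us lang av v q Fv
    bad-sound us us′ av av′ R v p Fv with ∨-true (base v) p
    ... | inj₁ q = sound R v q Fv
    ... | inj₂ q = startsWithAny-kills us′ (reverse-language lang) av′ v q Fv

    avoids-∷ : ∀ {F : Pred (Word n) 0ℓ} {v us} → ¬ F v → Avoids us F → Avoids (v ∷ us) F
    avoids-∷ ¬Fv av (here refl) = ¬Fv
    avoids-∷ ¬Fv av (there u∈)  = av u∈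

    prune-sound : ∀ us us′ vs → prune us us′ vs ≡ true → Avoids us F → Avoids us′ (F ∘ reverse) → Avoids vs
        F
    prune-sound us us′ (v ∷ vs) p av av′ u∈ with ∧-true (search (bad us us′) flip k R v) p
    ... | p₁ , p₂ with search-sound lang (bad us us′) (bad-sound us us′ av av′) flip k R v p₁
    prune-sound us us′ (v ∷ vs) p av av′ (here refl) | p₁ , p₂ | ¬Fv = ¬Fv
    prune-sound us us′ (v ∷ vs) p av av′ (there u∈)  | p₁ , p₂ | ¬Fv =
      prune-sound (v ∷ us) (reverse v ∷ us′) vs p₂ (avoids-∷ ¬Fv av)
        (avoids-∷ (¬Fv ∘ subst F (reverse-involutive v)) av′) u∈

-- The minimal forbidden words, of lengths 16, 17 and 21, of γ(η^ω(0)) among the words that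
-- have no 7-letter palindrome and no power of exponent at least 52/27.
forbidden : List (Word 3)
forbidden =
  (0F ∷ 1F ∷ 2F ∷ 0F ∷ 1F ∷ 0F ∷ 2F ∷ 0F ∷ 1F ∷ 2F ∷ 1F ∷ 0F ∷ 1F ∷ 2F ∷ 0F ∷ 1F ∷ []) ∷
  (1F ∷ 2F ∷ 0F ∷ 1F ∷ 2F ∷ 1F ∷ 0F ∷ 1F ∷ 2F ∷ 0F ∷ 2F ∷ 1F ∷ 2F ∷ 0F ∷ 1F ∷ 2F ∷ []) ∷
  (2F ∷ 0F ∷ 1F ∷ 2F ∷ 0F ∷ 2F ∷ 1F ∷ 2F ∷ 0F ∷ 1F ∷ 0F ∷ 2F ∷ 0F ∷ 1F ∷ 2F ∷ 0F ∷ []) ∷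
  (0F ∷ 2F ∷ 0F ∷ 1F ∷ 2F ∷ 1F ∷ 0F ∷ 1F ∷ 2F ∷ 0F ∷ 1F ∷ 0F ∷ 2F ∷ 0F ∷ 1F ∷ 2F ∷ 1F ∷ []) ∷
  (1F ∷ 0F ∷ 1F ∷ 2F ∷ 0F ∷ 2F ∷ 1F ∷ 2F ∷ 0F ∷ 1F ∷ 2F ∷ 1F ∷ 0F ∷ 1F ∷ 2F ∷ 0F ∷ 2F ∷ []) ∷
  (2F ∷ 1F ∷ 2F ∷ 0F ∷ 1F ∷ 0F ∷ 2F ∷ 0F ∷ 1F ∷ 2F ∷ 0F ∷ 2F ∷ 1F ∷ 2F ∷ 0F ∷ 1F ∷ 0F ∷ []) ∷
  (1F ∷ 2F ∷ 0F ∷ 1F ∷ 2F ∷ 1F ∷ 0F ∷ 1F ∷ 2F ∷ 0F ∷ 2F ∷ 1F ∷ 2F ∷ 0F ∷ 1F ∷ 0F ∷ 2F ∷ 0F ∷ 1F ∷ 2F ∷ 0F ∷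
      []) ∷
  (2F ∷ 0F ∷ 1F ∷ 2F ∷ 0F ∷ 2F ∷ 1F ∷ 2F ∷ 0F ∷ 1F ∷ 0F ∷ 2F ∷ 0F ∷ 1F ∷ 2F ∷ 1F ∷ 0F ∷ 1F ∷ 2F ∷ 0F ∷ 1F ∷
      []) ∷
  (2F ∷ 1F ∷ 2F ∷ 0F ∷ 1F ∷ 0F ∷ 2F ∷ 0F ∷ 1F ∷ 2F ∷ 1F ∷ 0F ∷ 1F ∷ 2F ∷ 0F ∷ 2F ∷ 1F ∷ 2F ∷ 0F ∷ 1F ∷ 0F ∷
      []) ∷
  (1F ∷ 0F ∷ 1F ∷ 2F ∷ 0F ∷ 2F ∷ 1F ∷ 2F ∷ 0F ∷ 1F ∷ 0F ∷ 2F ∷ 0F ∷ 1F ∷ 2F ∷ 1F ∷ 0F ∷ 1F ∷ 2F ∷ 0F ∷ 2F ∷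
      []) ∷
  (0F ∷ 2F ∷ 0F ∷ 1F ∷ 2F ∷ 1F ∷ 0F ∷ 1F ∷ 2F ∷ 0F ∷ 2F ∷ 1F ∷ 2F ∷ 0F ∷ 1F ∷ 0F ∷ 2F ∷ 0F ∷ 1F ∷ 2F ∷ 1F ∷
      []) ∷
  (0F ∷ 1F ∷ 2F ∷ 0F ∷ 1F ∷ 0F ∷ 2F ∷ 0F ∷ 1F ∷ 2F ∷ 1F ∷ 0F ∷ 1F ∷ 2F ∷ 0F ∷ 2F ∷ 1F ∷ 2F ∷ 0F ∷ 1F ∷ 2F ∷
      []) ∷ []

-- Desubstitution with marker words.

anyF : ∀ n → (Fin n → Bool) → Bool
anyF zero    f = false
anyF (suc n) f = f zero ∨ anyF n (f ∘ suc)

anyF-sound : ∀ n f → anyF n f ≡ true → ∃[ i ] f i ≡ true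
anyF-sound (suc n) f p with ∨-true (f zero) p
... | inj₁ q = zero , q
... | inj₂ q = let i , r = anyF-sound n (f ∘ suc) q in suc i , r

startsWithAny-++ : ∀ {n} us (v : Word n) {t} → startsWithAny us v ≡ true → startsWithAny us (v ++ t) ≡ true
startsWithAny-++ (u ∷ us) v {t} p with startsWith u v in eq
... | true with startsWith-sound u v eq
... | s , refl rewrite ++-assoc u s t | startsWith-++ u (s ++ t) = refl
startsWithAny-++ (u ∷ us) v {t} p | false with startsWith u (v ++ t)
... | true  = refl
... | false = startsWithAny-++ us v p

startsWithAny-∈ : ∀ {n} {us} {u : Word n} t → u ∈ us → startsWithAny us (u ++ t) ≡ true
startsWithAny-∈ {u = u} t (here refl) rewrite startsWith-++ u t = refl
startsWithAny-∈ {us = w ∷ us} {u} t (there u∈) with startsWith w (u ++ t)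
... | true  = refl
... | false = startsWithAny-∈ t u∈

-- Every word of M marks the border between two images under σ.
module Desubstitution {m n : ℕ} (σ : Morphism (Fin m) (Fin n)) (M : List (Word n))
                      (base : Dir → Word n → Bool) (kʳ kˡ kᵒ : ℕ) where

  image : Fin m → Word n
  image a = List⁺.toList (σ a)

  Marked : Word n → Set
  Marked y = startsWithAny M y ≡ true

  decodes : Word n → Bool
  decodes x = anyF m λ a → startsWith (image a) x ∧ startsWithAny M (drop (length (image a)) x)

  -- From a mark an image can be read off to the right, up to another mark, and to the left, where
  -- it begins with a mark again; some mark turns up in every long enough factor. So a factor can be
  -- cut into images in both directions.
  checkʳ checkˡ checkᵒ : Bool
  checkʳ = everyᵇ (λ u → scan (λ z → base R z ∨ decodes (reverse z)) kʳ u) M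
  checkˡ = everyᵇ (λ u → scan (λ y → base L y ∨ (anyF m λ a → y ==ʷ image a ++ u) ∧ startsWithAny M y) kˡ
      (reverse u)) M
  checkᵒ = scan (λ z → base R z ∨ startsWithAny (map reverse M) z) kᵒ []

  Cuts : Word m → Word n → Set
  Cuts []      r = Marked r
  Cuts (a ∷ v) r = Marked ((σ *) (a ∷ v) ++ r) × Cuts v r

  Cuts-marked : ∀ v {r} → Cuts v r → Marked ((σ *) v ++ r)
  Cuts-marked []      c = c
  Cuts-marked (a ∷ v) c = proj₁ c

  *-++ : ∀ v w r → (σ *) (v ++ w) ++ r ≡ (σ *) v ++ (σ *) w ++ r
  *-++ v w r = trans (cong (_++ r) (concatMap-++ image v w)) (++-assoc ((σ *) v) _ r)

  Cuts-++⁻ : ∀ v w {r} → Cuts (v ++ w) r → Cuts v ((σ *) w ++ r) × Cuts w r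
  Cuts-++⁻ []      w c       = Cuts-marked w c , c
  Cuts-++⁻ (a ∷ v) w {r} (c , cs) with Cuts-++⁻ v w cs
  ... | d , e = (subst Marked (*-++ (a ∷ v) w r) c , d) , e

  Cuts-++⁺ : ∀ v w {r} → Cuts v ((σ *) w ++ r) → Cuts w r → Cuts (v ++ w) r
  Cuts-++⁺ []      w c        d = d
  Cuts-++⁺ (a ∷ v) w {r} (c , cs) d = subst Marked (sym (*-++ (a ∷ v) w r)) c , Cuts-++⁺ v w cs d

  Cuts-extend : ∀ v {r} e → Cuts v r → Cuts v (r ++ e)
  Cuts-extend []      e c        = startsWithAny-++ M _ c
  Cuts-extend (a ∷ v) {r} e (c , cs) =
    subst Marked (++-assoc ((σ *) (a ∷ v)) r e) (startsWithAny-++ M _ c) , Cuts-extend v e cs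

  -- All borders of the image have to be marked, as the extension of `v` starts from the marks. The
  -- mark at the last border lies beyond the image, so a rest `r` is carried along.
  Preimage : Pred (Word n) 0ℓ → Pred (Word m) 0ℓ
  Preimage F v = ∃[ r ] (F ((σ *) v ++ r) × Cuts v r)

  module _ {F : Pred (Word n) 0ℓ} (lang : Language F) (sound : ∀ d v → base d v ≡ true → ¬ oriented d F v)
           (okʳ : checkʳ ≡ true) (okˡ : checkˡ ≡ true) (okᵒ : checkᵒ ≡ true) where

    private
      soundᴿ : ∀ {W} → F W → ∀ z t → base R z ≡ true → W ≡ reverse z ++ t → ⊥
      soundᴿ FW z t p eq = sound R z p (prefix lang (reverse z) (subst F eq FW))

      soundᴸ : ∀ {W} → F (reverse W) → ∀ z t → base L z ≡ true → W ≡ reverse z ++ t → ⊥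
      soundᴸ {W} FW z t p eq = sound L z p (suffix lang (reverse t) (subst F
        (trans (cong reverse eq) (trans (reverse-++ (reverse z) t)
            (cong (reverse t ++_) (reverse-involutive z)))) FW))

    stepʳ : ∀ y e → F (y ++ e) → Marked y → kʳ ≤ length e → ∃[ a ] ∃[ y′ ]
        (y ++ e ≡ image a ++ y′ × Marked y′)
    stepʳ y e Fye marked le with startsWithAny-sound M y marked
    ... | u , t , u∈ , refl =
      scan-sound ((u ++ t) ++ e) (λ z → base R z ∨ decodes (reverse z)) found kʳ u (t ++ e)
        (everyᵇ-sound _ M okʳ u∈) (++-assoc u t e)
        (≤-trans le (subst (length e ≤_) (sym (length-++ t)) (m≤n+m _ (length t))))
      where
      found : ∀ z s → base R z ∨ decodes (reverse z) ≡ true → (u ++ t) ++ e ≡ reverse z ++ s → _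
      found z s p eq with ∨-true (base R z) p
      ... | inj₁ q = ⊥-elim (soundᴿ Fye z s q eq)
      ... | inj₂ q with anyF-sound m _ q
      ... | a , q with ∧-true (startsWith (image a) (reverse z)) q
      ... | q₁ , q₂ with startsWith-sound (image a) (reverse z) q₁
      ... | x , z≡ = a , x ++ s , trans eq (trans (cong (_++ s) z≡) (++-assoc (image a) x s)) ,
                     startsWithAny-++ M x (subst Marked
                         (trans (cong (drop (length (image a))) z≡) (drop-length (image a) x)) q₂)
        where
        drop-length : ∀ (x y : Word n) → drop (length x) (x ++ y) ≡ y
        drop-length []      y = refl
        drop-length (_ ∷ x) y = drop-length x y

    stepˡ : ∀ z y → F (z ++ y) → Marked y → kˡ ≤ length z → ∃[ a ]
        (F (image a ++ y) × Marked (image a ++ y))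
    stepˡ z y Fzy marked le with startsWithAny-sound M y marked
    ... | u , t , u∈ , refl =
      scan-sound (reverse u ++ reverse z) (λ y → base L y ∨ (anyF m λ a → y ==ʷ image a ++ u) ∧
          startsWithAny M y)
        found kˡ (reverse u) (reverse z) (everyᵇ-sound _ M okˡ u∈) refl
        (subst (kˡ ≤_) (sym (length-reverse z)) le)
      where
      W≡ : reverse (reverse u ++ reverse z) ≡ z ++ u
      W≡ = trans (cong reverse (sym (reverse-++ z u))) (reverse-involutive (z ++ u))
      Fzu : F (z ++ u)
      Fzu = prefix lang (z ++ u) (subst F (sym (++-assoc z u t)) Fzy)
      found : ∀ x s → base L x ∨ (anyF m λ a → x ==ʷ image a ++ u) ∧ startsWithAny M x ≡ true →
              reverse u ++ reverse z ≡ reverse x ++ s → _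
      found x s p eq with ∨-true (base L x) p
      ... | inj₁ q = ⊥-elim (soundᴸ (subst F (sym W≡) Fzu) x s q eq)
      ... | inj₂ q with ∧-true (anyF m λ a → x ==ʷ image a ++ u) q
      ... | q₁ , q₂ with anyF-sound m _ q₁
      ... | a , q₁ with ==ʷ-sound x (image a ++ u) q₁
      ... | refl = a , suffix lang (reverse s) (subst F eq′ Fzy) ,
                   subst Marked (++-assoc (image a) u t) (startsWithAny-++ M x q₂)
        where
        eq′ : z ++ u ++ t ≡ reverse s ++ image a ++ u ++ t
        eq′ = trans (sym (++-assoc z u t)) (trans (cong (_++ t) (trans (sym W≡) (trans (cong reverse eq)
                (trans (reverse-++ (reverse x) s) (cong (reverse s ++_) (reverse-involutive x))))))
                (trans (++-assoc (reverse s) x t) (cong (reverse s ++_) (++-assoc (image a) u t))))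

    occurs : ∀ z → F z → kᵒ ≤ length z → ∃[ x ] ∃[ y ] (z ≡ x ++ y × Marked y)
    occurs z Fz le = scan-sound z (λ z → base R z ∨ startsWithAny (map reverse M) z) found kᵒ [] z okᵒ refl
        le
      where
      found : ∀ x s → base R x ∨ startsWithAny (map reverse M) x ≡ true → z ≡ reverse x ++ s → _
      found x s p eq with ∨-true (base R x) p
      ... | inj₁ q = ⊥-elim (soundᴿ Fz x s q eq)
      ... | inj₂ q with startsWithAny-sound (map reverse M) x q
      ... | u′ , t , u′∈ , refl with ∈-map⁻ reverse u′∈
      ... | u , u∈ , refl = reverse t , u ++ s , trans eq (trans (cong (_++ s)
                              (trans (reverse-++ (reverse u) t)
                                  (cong (reverse t ++_) (reverse-involutive u))))
                              (++-assoc (reverse t) u s)) , startsWithAny-∈ s u∈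

    advance : ∀ v r → F ((σ *) v ++ r) → Cuts v r →
              ∃[ a ] ∃[ r′ ] ∃[ e ] ((σ *) (v ∷ʳ a) ++ r′ ≡ ((σ *) v ++ r) ++ e × F ((σ *) (v ∷ʳ a) ++ r′) ×
                  Cuts (v ∷ʳ a) r′)
    advance v r Fvr cuts with extendʳ* lang kʳ ((σ *) v ++ r) Fvr
    ... | e , |e| , Fe with stepʳ r e (suffix lang ((σ *) v) (subst F (++-assoc ((σ *) v) r e) Fe))
                              (proj₂ (Cuts-++⁻ v [] (subst (λ v → Cuts v r) (sym (++-identityʳ v)) cuts)))
                                  (≤-reflexive (sym |e|))
    ... | a , r′ , eq , marked = a , r′ , e , sym eq′ , subst F eq′ Fe ,
          Cuts-++⁺ v [ a ] (subst (Cuts v) eq″ (Cuts-extend v e cuts))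
            (subst Marked eq″ (startsWithAny-++ M r
                (proj₂ (Cuts-++⁻ v [] (subst (λ v → Cuts v r) (sym (++-identityʳ v)) cuts)))) , marked)
      where
      eq″ : r ++ e ≡ (σ *) [ a ] ++ r′
      eq″ = trans eq (cong (_++ r′) (sym (++-identityʳ (image a))))
      eq′ : ((σ *) v ++ r) ++ e ≡ (σ *) (v ∷ʳ a) ++ r′
      eq′ = trans (++-assoc ((σ *) v) r e) (trans (cong ((σ *) v ++_) eq″) (sym (*-++ v [ a ] r′)))

    preimage-language : Language (Preimage F)
    preimage-language = record
      { inhabited = inhabited′
      ; prefix    = λ v {w} (r , Fr , cuts) → (σ *) w ++ r , subst F (*-++ v w r) Fr , proj₁
          (Cuts-++⁻ v w cuts)
      ; suffix    = λ v {w} (r , Fr , cuts) → r , suffix lang ((σ *) v) (subst F (*-++ v w r) Fr) , proj₂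
          (Cuts-++⁻ v w cuts)
      ; extendˡ   = left
      ; extendʳ   = λ v (r , Fr , cuts) → let a , r′ , _ , _ , Fr′ , cuts′ = advance v r Fr cuts in a , r′ ,
          Fr′ , cuts′
      }
      where
      inhabited′ : Preimage F []
      inhabited′ with extendʳ* lang kᵒ [] (inhabited lang)
      ... | z , |z| , Fz with occurs z Fz (≤-reflexive (sym |z|))
      ... | x , y , refl , marked = y , suffix lang x Fz , marked
      left : ∀ v → Preimage F v → ∃[ a ] Preimage F (a ∷ v)
      left v (r , Fr , cuts) with extendˡ* lang kˡ ((σ *) v ++ r) Fr
      ... | z , |z| , Fz with stepˡ z ((σ *) v ++ r) Fz (Cuts-marked v cuts) (≤-reflexive (sym |z|))
      ... | a , Fa , marked = a , r , subst F (sym (++-assoc (image a) ((σ *) v) r)) Fa ,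
                              subst Marked (sym (++-assoc (image a) ((σ *) v) r)) marked , cuts

    preimage-image : ∀ v → Preimage F v → F ((σ *) v)
    preimage-image v (r , Fr , _) = prefix lang ((σ *) v) Fr

    length-* : ∀ v → length v ≤ length ((σ *) v)
    length-* []      = z≤n
    length-* (a ∷ v) = s≤s (≤-trans (length-* v) (subst (length ((σ *) v) ≤_)
        (sym (length-++ (List⁺.tail (σ a)))) (m≤n+m _ _)))

    cofinal : ∀ f → F f → ∃[ v ] ∃[ s ] ∃[ t ] (Preimage F v × (σ *) v ≡ s ++ f ++ t)
    cofinal f Ff with extendˡ* lang kᵒ f Ff
    ... | z , |z| , Fz with occurs z (prefix lang z Fz) (≤-reflexive (sym |z|))
    -- As images of letters are nonempty, this many letters have an image that covers `y ++ f`.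
    ... | x , y , refl , marked with iterate (length (y ++ f))
      where
      iterate : ∀ k → ∃[ v ] ∃[ r ] ∃[ e ] (length v ≡ k × (σ *) v ++ r ≡ (y ++ f) ++ e × F ((σ *) v ++ r) ×
          Cuts v r)
      iterate zero    = [] , y ++ f , [] , refl , sym (++-identityʳ (y ++ f)) ,
                        suffix lang x (subst F (++-assoc x y f) Fz) , startsWithAny-++ M y marked
      iterate (suc k) with iterate k
      ... | v , r , e , |v| , eq , Fr , cuts with advance v r Fr cuts
      ... | a , r′ , e′ , eq′ , Fr′ , cuts′ =
        v ∷ʳ a , r′ , e ++ e′ , trans (length-++ v) (trans (+-comm (length v) 1) (cong suc |v|)) ,
        trans eq′ (trans (cong (_++ e′) eq) (++-assoc (y ++ f) e e′)) , Fr′ , cuts′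
    ... | v , r , e , |v| , eq , Fr , cuts with ++-split ((σ *) v) (y ++ f) eq
        (subst (_≤ length ((σ *) v)) |v| (length-* v))
    ... | t , eq′ , _ = v , y , t , (r , Fr , cuts) , trans eq′ (++-assoc y f t)

-- Weights, and powers in all iterated images.

weight : (Fin n → ℕ) → Word n → ℕ
weight w []      = 0
weight w (a ∷ v) = w a + weight w v

weight-++ : ∀ (w : Fin n → ℕ) u v → weight w (u ++ v) ≡ weight w u + weight w v
weight-++ w []      v = refl
weight-++ w (a ∷ u) v = trans (cong (λ z → w a + z) (weight-++ w u v)) (sym (+-assoc (w a) _ _))

weight-length : ∀ (v : Word n) → weight (const 1) v ≡ length v
weight-length []      = refl
weight-length (a ∷ v) = cong suc (weight-length v)

-- A left eigenvector of the incidence matrix of η, for the eigenvalue 6, and a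
-- vector completing it to an invariant plane that contains the lengths of the γ a.
θ κ : Fin 4 → ℕ
θ 0F = 3
θ 1F = 2
θ 2F = 2
θ 3F = 5
κ 0F = 0
κ 1F = 1
κ 2F = 1
κ 3F = 1

weight-* : ∀ {m} (σ : Morphism (Fin m) (Fin n)) (w : Fin n → ℕ) (w′ : Fin m → ℕ) →
           (∀ a → weight w (List⁺.toList (σ a)) ≡ w′ a) → ∀ v → weight w ((σ *) v) ≡ weight w′ v
weight-* σ w w′ eq []      = refl
weight-* σ w w′ eq (a ∷ v) = trans (weight-++ w (List⁺.toList (σ a)) ((σ *) v))
    (cong₂ _+_ (eq a) (weight-* σ w w′ eq v))

weight-linear : ∀ (w w′ : Fin n → ℕ) i j v → weight (λ a → i * w a + j * w′ a) v ≡ i * weight w v + j *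
    weight w′ v
weight-linear w w′ i j []      = solve i j
  where
  solve : ∀ i j → 0 ≡ i * 0 + j * 0
  solve = solve-∀
weight-linear w w′ i j (a ∷ v) = trans (cong (λ z → i * w a + j * w′ a + z) (weight-linear w w′ i j v))
    (solve i j (w a) (w′ a) _ _)
  where
  solve : ∀ i j x y X Y → (i * x + j * y) + (i * X + j * Y) ≡ i * (x + X) + j * (y + Y)
  solve = solve-∀

θ-η : ∀ v → weight θ ((η *) v) ≡ 6 * weight θ v + 0 * weight κ v
θ-η v = trans (weight-* η θ (λ a → 6 * θ a + 0 * κ a) (λ { 0F → refl ; 1F → refl ; 2F → refl ; 3F → refl })
    v) (weight-linear θ κ 6 0 v)

κ-η : ∀ v → weight κ ((η *) v) ≡ 1 * weight θ v + 1 * weight κ v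
κ-η v = trans (weight-* η κ (λ a → 1 * θ a + 1 * κ a) (λ { 0F → refl ; 1F → refl ; 2F → refl ; 3F → refl })
    v) (weight-linear θ κ 1 1 v)

length-γ : ∀ v → length ((γ *) v) ≡ 6 * weight θ v + 3 * weight κ v
length-γ v = trans (sym (weight-length ((γ *) v)))
  (trans (weight-* γ (const 1) (λ a → 6 * θ a + 3 * κ a)
      (λ { 0F → refl ; 1F → refl ; 2F → refl ; 3F → refl }) v) (weight-linear θ κ 6 3 v))

-- η is applied innermost, so that at level n + 1 the image of `v` is by definition the image of
-- η(v) at level n.
γη^ : ℕ → Word 4 → Word 3
γη^ zero    v = (γ *) v
γη^ (suc n) v = γη^ n ((η *) v)

γη^-++ : ∀ n u v → γη^ n (u ++ v) ≡ γη^ n u ++ γη^ n v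
γη^-++ zero    u v = concatMap-++ (List⁺.toList ∘ γ) u v
γη^-++ (suc n) u v = trans (cong (γη^ n) (concatMap-++ (List⁺.toList ∘ η) u v))
    (γη^-++ n ((η *) u) ((η *) v))

Heavy : ℕ → ℕ → Set
Heavy x y = 52 * x ≤ 27 * (x + y)

heavy-linear : ∀ i j x y x′ y′ → Heavy x y → Heavy x′ y′ → Heavy (i * x + j * x′) (i * y + j * y′)
heavy-linear i j x y x′ y′ p q = subst₂ _≤_ (solve₁ i j x x′) (solve₂ i j x x′ y y′)
    (+-mono-≤ (*-monoʳ-≤ i p) (*-monoʳ-≤ j q))
  where
  solve₁ : ∀ i j x x′ → i * (52 * x) + j * (52 * x′) ≡ 52 * (i * x + j * x′)
  solve₁ = solve-∀
  solve₂ : ∀ i j x x′ y y′ → i * (27 * (x + y)) + j * (27 * (x′ + y′)) ≡ 27 *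
      ((i * x + j * x′) + (i * y + j * y′))
  solve₂ = solve-∀

*-border : ∀ {m} (σ : Morphism (Fin m) (Fin n)) u k t → u ++ k ≡ k ++ t → (σ *) u ++ (σ *) k ≡ (σ *) k ++
    (σ *) t
*-border σ u k t eq = trans (sym (concatMap-++ (List⁺.toList ∘ σ) u k))
  (trans (cong (σ *) eq) (concatMap-++ (List⁺.toList ∘ σ) k t))

*-nonempty : ∀ {m} (σ : Morphism (Fin m) (Fin n)) u → 0 < length u → 0 < length ((σ *) u)
*-nonempty σ (a ∷ u) _ = z<s

-- A power of exponent at least 52/27 with respect to both weights keeps this property under η.
heavy-power : {F : Pred (Word 3) 0ℓ} → PowerFree 52 27 F → ∀ n u k t → 0 < length u → u ++ k ≡ k ++ t →
              Heavy (weight θ u) (weight θ k) → Heavy (weight κ u) (weight κ k) → ¬ F (γη^ n (u ++ k))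
heavy-power {F} free zero u k t 0<u eq hθ hκ Fv =
  free ((γ *) u) ((γ *) k) ((γ *) t) (*-nonempty γ u 0<u) (*-border γ u k t eq) (subst F (γη^-++ 0 u k) Fv)
    (subst₂ Heavy (sym (length-γ u)) (sym (length-γ k))
        (heavy-linear 6 3 (weight θ u) (weight θ k) (weight κ u) (weight κ k) hθ hκ))
heavy-power {F} free (suc n) u k t 0<u eq hθ hκ Fv =
  heavy-power {F} free n ((η *) u) ((η *) k) ((η *) t) (*-nonempty η u 0<u) (*-border η u k t eq)
    (subst₂ Heavy (sym (θ-η u)) (sym (θ-η k)) (heavy-linear 6 0 (weight θ u) (weight θ k) (weight κ u)
        (weight κ k) hθ hκ))
    (subst₂ Heavy (sym (κ-η u)) (sym (κ-η k)) (heavy-linear 1 1 (weight θ u) (weight θ k) (weight κ u)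
        (weight κ k) hθ hκ))
    (subst (F ∘ γη^ n) (concatMap-++ (List⁺.toList ∘ η) u k) Fv)

-- Certified powers: the period p of the suffix at position i.

commonPrefix : Word n → Word n → Word n
commonPrefix (a ∷ u) (b ∷ v) = if a == b then a ∷ commonPrefix u v else []
commonPrefix _       _       = []

commonPrefix-sound : (u v : Word n) → ∃[ u′ ] ∃[ v′ ]
    (u ≡ commonPrefix u v ++ u′ × v ≡ commonPrefix u v ++ v′)
commonPrefix-sound []      v       = [] , v , refl , refl
commonPrefix-sound (a ∷ u) []      = a ∷ u , [] , refl , refl
commonPrefix-sound (a ∷ u) (b ∷ v) with a == b in eq
... | false = a ∷ u , b ∷ v , refl , refl
... | true with ==-sound a b eq | commonPrefix-sound u v
... | refl | u′ , v′ , p , q = u′ , v′ , cong (a ∷_) p , cong (a ∷_) q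

module _ (ws : List (Fin n → ℕ)) where

  heavy? : Word n → Word n → Bool
  heavy? u k = (1 ≤ᵇ length u) ∧ everyᵇ (λ w → 52 * weight w u ≤ᵇ 27 * (weight w u + weight w k)) ws

  certified : ℕ → Word n → Bool
  certified p y = heavy? (take p y) (commonPrefix y (drop p y))

  record HeavyPower (x : Word n) : Set where
    constructor heavyPower
    field
      s u k t s′ : Word n
      split      : x ≡ s ++ (u ++ k) ++ s′
      nonempty   : 0 < length u
      border     : u ++ k ≡ k ++ t
      heavy      : ∀ {w} → w ∈ ws → Heavy (weight w u) (weight w k)

  certified-sound : ∀ i p x → certified p (drop i x) ≡ true → HeavyPower x
  certified-sound i p x ok = go (commonPrefix-sound y t) ok
    where
    y = drop i x
    u = take p y
    t = drop p y
    k = commonPrefix y t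
    go : ∃[ y′ ] ∃[ t′ ] (y ≡ k ++ y′ × t ≡ k ++ t′) → heavy? u k ≡ true → HeavyPower x
    go (y′ , t′ , y≡ , t≡) ok with ∧-true (1 ≤ᵇ length u) ok
    ... | ok₁ , ok₂ with ++-split (u ++ k) k (trans y≡′ y≡)
        (subst (length k ≤_) (sym (length-++ u)) (m≤n+m _ (length u)))
      where
      y≡′ : (u ++ k) ++ t′ ≡ y
      y≡′ = trans (++-assoc u k t′) (trans (cong (u ++_) (sym t≡)) (take++drop≡id p y))
    ... | e , border , _ = heavyPower (take i x) u k e t′
          (trans (sym (take++drop≡id i x)) (cong (take i x ++_) (trans (sym (take++drop≡id p y))
            (trans (cong (u ++_) t≡) (sym (++-assoc u k t′))))))
          (≤ᵇ-true 1 ok₁) border (λ w∈ → ≤ᵇ-true _ (everyᵇ-sound _ ws ok₂ w∈))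

lengths : List (Fin 3 → ℕ)
lengths = const 1 ∷ []

heavyPower-kills : {F : Pred (Word 3) 0ℓ} → Language F → PowerFree 52 27 F → ∀ {x} → HeavyPower lengths x →
    ¬ F x
heavyPower-kills {F} lang free (heavyPower s u k t s′ refl 0<u eq heavy) Fx =
  free u k t 0<u eq (infixʷ lang s (u ++ k) Fx) (subst₂ Heavy (weight-length u) (weight-length k)
      (heavy (here refl)))

-- The word contains no square, but its images do contain powers of exponent at least 52/27.
-- Given are the positions and periods of such powers in the images under γ, γη, γη² and η³;
-- the last one is heavy, hence survives all further images.
record Certificate : Set where
  constructor certificate
  field
    word : Word 4
    i₀ p₀ i₁ p₁ i₂ p₂ i₃ p₃ : ℕ

  valid : Bool
  valid = certified lengths p₀ (drop i₀ (γη^ 0 word)) ∧ (certified lengths p₁ (drop i₁ (γη^ 1 word)) ∧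
          (certified lengths p₂ (drop i₂ (γη^ 2 word)) ∧ certified (θ ∷ κ ∷ []) p₃
              (drop i₃ ((η *) ((η *) ((η *) word))))))

  valid-sound : valid ≡ true → {F : Pred (Word 3) 0ℓ} → Language F → PowerFree 52 27 F → ∀ n → ¬ F
      (γη^ n word)
  valid-sound ok lang free n with ∧-true (certified lengths p₀ (drop i₀ (γη^ 0 word))) ok
  ... | ok₀ , ok with ∧-true (certified lengths p₁ (drop i₁ (γη^ 1 word))) ok
  ... | ok₁ , ok with ∧-true (certified lengths p₂ (drop i₂ (γη^ 2 word))) ok
  valid-sound _ lang free 0 | ok₀ , _ | _ | _ = heavyPower-kills lang free
      (certified-sound lengths i₀ p₀ _ ok₀)
  valid-sound _ lang free 1 | _ | ok₁ , _ | _ = heavyPower-kills lang free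
      (certified-sound lengths i₁ p₁ _ ok₁)
  valid-sound _ lang free 2 | _ | _ | ok₂ , _ = heavyPower-kills lang free
      (certified-sound lengths i₂ p₂ _ ok₂)
  valid-sound _ {F} lang free (suc (suc (suc n))) | _ | _ | _ , ok₃ with certified-sound (θ ∷ κ ∷ []) i₃ p₃
      _ ok₃
  ... | heavyPower s u k t s′ split 0<u eq heavy = λ Fx → heavy-power {F} free n u k t 0<u eq
      (heavy (here refl)) (heavy (there (here refl)))
        (prefix lang _ (suffix lang (γη^ n s) (subst F
            (trans (cong (γη^ n) split) (trans (γη^-++ n s _) (cong (γη^ n s ++_) (γη^-++ n (u ++ k) s′))))
            Fx)))

-- Almost squares. The letters at which the repetition breaks off have images that share prefixes or
-- suffixes, and these lengthen it. The fourth to sixth reach exactly (81 + 75)/81 = 52/27 under γ;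
-- in the fifth, 75 = 6 + 66 + 3 comes from the common suffix of γ(0) and γ(1), the image of 320,
-- and the common prefix of γ(1) and γ(3).
certificates : List Certificate
certificates =
  certificate (0F ∷ 1F ∷ 0F ∷ 2F ∷ 0F ∷ 3F ∷ 2F ∷ 0F ∷ 1F ∷ 0F ∷ 2F ∷ 0F ∷ 3F ∷ 0F ∷ []) 0 132 0 792 0 4752
      0 1440 ∷
  certificate (3F ∷ 2F ∷ 0F ∷ 1F ∷ 0F ∷ 2F ∷ 0F ∷ 1F ∷ 3F ∷ []) 21 66 120 396 714 2376 217 720 ∷
  certificate (0F ∷ 3F ∷ 0F ∷ 1F ∷ 0F ∷ 2F ∷ 0F ∷ 1F ∷ 3F ∷ 0F ∷ 1F ∷ 0F ∷ 2F ∷ 0F ∷ []) 12 132 78 792 474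
      4752 145 1440 ∷
  certificate (0F ∷ 2F ∷ 0F ∷ 1F ∷ 3F ∷ 2F ∷ 0F ∷ 1F ∷ 0F ∷ []) 6 81 39 477 237 2853 73 864 ∷
  certificate (0F ∷ 3F ∷ 2F ∷ 0F ∷ 1F ∷ 3F ∷ 2F ∷ 0F ∷ 3F ∷ []) 12 81 78 477 474 2853 145 864 ∷
  certificate (0F ∷ 1F ∷ 3F ∷ 2F ∷ 0F ∷ 1F ∷ 3F ∷ 0F ∷ []) 0 81 0 477 0 2853 0 864 ∷
  certificate (0F ∷ 2F ∷ 0F ∷ 3F ∷ 0F ∷ 1F ∷ 3F ∷ 2F ∷ 0F ∷ 3F ∷ 0F ∷ 1F ∷ 0F ∷ []) 6 132 39 792 237 4752 73
      1440 ∷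
  certificate (2F ∷ 0F ∷ 3F ∷ 0F ∷ 1F ∷ 0F ∷ 2F ∷ 0F ∷ 3F ∷ 0F ∷ 1F ∷ 3F ∷ []) 0 117 0 711 0 4275 0 1296 ∷
  []

-- The minimal forbidden words of η^ω(0) of lengths 2 and 3.
excludedFactors : List (Word 4)
excludedFactors =
  (1F ∷ 1F ∷ []) ∷
  (1F ∷ 2F ∷ []) ∷
  (2F ∷ 1F ∷ []) ∷
  (2F ∷ 2F ∷ []) ∷
  (2F ∷ 3F ∷ []) ∷
  (0F ∷ 0F ∷ []) ∷
  (3F ∷ 1F ∷ []) ∷
  (3F ∷ 3F ∷ []) ∷
  (3F ∷ 0F ∷ 2F ∷ []) ∷
  (3F ∷ 0F ∷ 3F ∷ []) ∷
  (1F ∷ 0F ∷ 1F ∷ []) ∷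
  (1F ∷ 0F ∷ 3F ∷ []) ∷
  (2F ∷ 0F ∷ 2F ∷ []) ∷
  []

-- Further minimal forbidden words of η^ω(0), needed to invert η.
consequences : List (Word 4)
consequences =
  (0F ∷ 3F ∷ 2F ∷ 0F ∷ 1F ∷ 0F ∷ []) ∷
  (0F ∷ 2F ∷ 0F ∷ 1F ∷ 0F ∷ []) ∷
  (0F ∷ 2F ∷ 0F ∷ 1F ∷ 3F ∷ 0F ∷ []) ∷
  (2F ∷ 0F ∷ 1F ∷ 3F ∷ 2F ∷ 0F ∷ 1F ∷ []) ∷
  (3F ∷ 0F ∷ 1F ∷ 3F ∷ 0F ∷ []) ∷
  (3F ∷ 2F ∷ 0F ∷ 1F ∷ 3F ∷ 2F ∷ []) ∷
  (1F ∷ 3F ∷ 2F ∷ 0F ∷ 1F ∷ 3F ∷ []) ∷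
  (3F ∷ 0F ∷ 1F ∷ 3F ∷ 2F ∷ 0F ∷ 3F ∷ []) ∷
  []

-- Iterated desubstitution for (b) and (c).

somewhere-split : ∀ {n} (u v : Word n) → somewhere (startsWith u) v ≡ true → ∃[ s ] ∃[ t ] v ≡ s ++ u ++ t
somewhere-split u (a ∷ v) p with ∨-true (startsWith u (a ∷ v)) p
... | inj₁ q = let t , eq = startsWith-sound u (a ∷ v) q in [] , t , eq
... | inj₂ q = let s , t , eq = somewhere-split u v q in a ∷ s , t , cong (a ∷_) eq

module _ {m n} (σ : Morphism (Fin m) (Fin n)) (b : Word n → Bool) where

  -- A search hands over `v` as read from its growing end; `orient` restores the order before σ is
  -- applied.
  imageKill : Dir → Word m → Bool
  imageKill d v = somewhere b ((σ *) (orient d v))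

  imagesDie : ℕ → List (Word m) → Bool
  imagesDie k = everyᵇ (search imageKill flip k R)

  imagesDie-sound : ∀ k vs → imagesDie k vs ≡ true → {F : Pred (Word n) 0ℓ} {G : Pred (Word m) 0ℓ} →
                    Language F → Language G → (∀ v → b v ≡ true → ¬ F v) → (∀ v → G v → F ((σ *) v)) →
                        Avoids vs G
  imagesDie-sound k vs p {F} {G} langF langG sound im {v} v∈ =
    search-sound langG imageKill (λ { L v q Gv → somewhere-sound b langF sound _ q (im v Gv)
                                    ; R v q Gv → somewhere-sound b langF sound _ q (im (reverse v) Gv) })
      flip k R v (everyᵇ-sound _ vs p v∈)

module _ {A B : Set} {h : List A → List B} (h-++ : ∀ u v → h (u ++ v) ≡ h u ++ h v) where

  h-[] : h [] ≡ []
  h-[] = proj₂ (++-cancel-length (h []) (h []) {[]} (trans (sym (h-++ [] [])) (sym (++-identityʳ (h []))))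
      refl)

  -- No image of a letter is shorter than `f`, so an occurrence of `f` cannot reach across a whole
  -- image into both of its neighbours.
  within-pair : ∀ (f : List B) → (∀ a → length f ≤ length (h [ a ])) → ∀ v s t → h v ≡ s ++ f ++ t →
                ∃[ x ] ∃[ w ] ∃[ y ] ∃[ s′ ] ∃[ t′ ]
                    (v ≡ x ++ w ++ y × length w ≤ 2 × s ≡ h x ++ s′ × h w ≡ s′ ++ f ++ t′)
  within-pair f long []      s t eq = [] , [] , [] , s , t , refl , z≤n , cong (_++ s) (sym h-[]) , eq
  within-pair f long (a ∷ v) s t eq with ≤-total (length (h [ a ])) (length s)
  ... | inj₁ le with ++-split s (h [ a ]) (trans (sym eq) (h-++ [ a ] v)) le
  ... | s₁ , refl , eq₁ with within-pair f long v s₁ t eq₁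
  ... | x , w , y , s′ , t′ , refl , |w| , eq₃ , eq₂ = a ∷ x , w , y , s′ , t′ , refl , |w| ,
        trans (cong (h [ a ] ++_) eq₃) (trans (sym (++-assoc (h [ a ]) (h x) s′))
            (cong (_++ s′) (sym (h-++ [ a ] x)))) , eq₂
  within-pair f long (a ∷ [])    s t eq | inj₂ le = [] , a ∷ [] , [] , s , t , refl , s≤s z≤n , cong (_++ s)
      (sym h-[]) , eq
  within-pair f long (a ∷ b ∷ v) s t eq | inj₂ le
    with ++-split (h (a ∷ b ∷ [])) (s ++ f) (trans (sym (h-++ (a ∷ b ∷ []) v))
        (trans eq (sym (++-assoc s f t))))
           (subst₂ _≤_ (sym (length-++ s)) (sym (trans (cong length (h-++ [ a ] [ b ]))
               (length-++ (h [ a ])))) (+-mono-≤ le (long b)))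
  ... | e , eq₁ , _ = [] , a ∷ b ∷ [] , v , s , e , refl , s≤s (s≤s z≤n) , cong (_++ s) (sym h-[]) , trans
      eq₁ (++-assoc s f e)

γη^-grows : ∀ n a → n < length (γη^ n [ a ])
γη^-grows n a = go n [ a ] z<s
  where
  doubles : ∀ v → length v + length v ≤ length ((η *) v)
  doubles []      = z≤n
  doubles (a ∷ v) = subst₂ _≤_ (cong suc (sym (+-suc (length v) (length v))))
      (sym (length-++ (List⁺.toList (η a)))) (+-mono-≤ (two a) (doubles v))
    where
    two : ∀ a → 2 ≤ List⁺.length (η a)
    two 0F = s≤s (s≤s z≤n)
    two 1F = s≤s (s≤s z≤n)
    two 2F = s≤s (s≤s z≤n)
    two 3F = s≤s (s≤s z≤n)
  grows : ∀ v → length v ≤ length ((γ *) v)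
  grows []      = z≤n
  grows (a ∷ v) = subst (suc (length v) ≤_) (sym (length-++ (List⁺.toList (γ a))))
      (+-mono-≤ {1} (s≤s z≤n) (grows v))
  go : ∀ n v → 0 < length v → n < length (γη^ n v)
  go zero    v 0<v = ≤-trans 0<v (grows v)
  go (suc n) v 0<v = go′ n 1 ((η *) v) (≤-trans (+-mono-≤ 0<v 0<v) (doubles v))
    where
    -- η doubles lengths at least; of this only one more letter per application is retained.
    go′ : ∀ n m v → m < length v → m + n < length (γη^ n v)
    go′ zero    m v lt = ≤-trans (subst (_< length v) (sym (+-identityʳ m)) lt) (grows v)
    go′ (suc n) m v lt = subst (_< length (γη^ n ((η *) v))) (sym (+-suc m n))
      (go′ n (suc m) ((η *) v) (≤-trans (+-mono-≤ {1} (≤-trans (s≤s z≤n) lt) lt) (doubles v)))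

module _ (ex : List (Word 4)) where

  meets-0 : Dir → Word 4 → Bool
  meets-0 L v = false
  meets-0 R v = startsWith [ 0F ] v ∨ startsWithAny (map reverse ex) v

  -- η³(0) already contains every pair that the excluded factors permit, as `pairs-ok` checks.
  allowed : Fin 4 → Fin 4 → Bool
  allowed a b = somewhere (startsWith (a ∷ b ∷ [])) ((η *) ((η *) ((η *) [ 0F ]))) ∨ startsWithAny ex
      (a ∷ b ∷ [])

Limit : Pred (Word 3) 0ℓ
Limit f = ∃[ n ] ∃[ s ] ∃[ t ] γη^ n [ 0F ] ≡ s ++ f ++ t

module Tower {F : Pred (Word 3) 0ℓ} (lang : Language F) (free : PowerFree 52 27 F) where

  -- No power-freeness of `G` is recorded. What may occur in `G` is controlled only through
  -- `images`, that is, through powers in F at the bottom.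
  record Tier (n : ℕ) : Set₁ where
    field
      G        : Pred (Word 4) 0ℓ
      language : Language G
      images   : ∀ v → G v → F (γη^ n v)
      exhausts : ∀ f → F f → ∃[ v ] ∃[ s ] ∃[ t ] (G v × γη^ n v ≡ s ++ f ++ t)

  open Tier

  module _ (ex : List (Word 4)) where

    module Base (base : Dir → Word 3 → Bool) (sound : ∀ d v → base d v ≡ true → ¬ oriented d F v)
                (M : List (Word 3)) (k l : ℕ) where

      open Desubstitution γ M base k k k public

      module _ (okʳ : checkʳ ≡ true) (okˡ : checkˡ ≡ true) (okᵒ : checkᵒ ≡ true)
               (die : imagesDie γ (base L) l ex ≡ true) where

        level₀ : Tier 0
        level₀ = record
          { G        = Preimage F
          ; language = preimage-language lang sound okʳ okˡ okᵒ
          ; images   = preimage-image lang sound okʳ okˡ okᵒ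
          ; exhausts = cofinal lang sound okʳ okˡ okᵒ
          }

        avoids₀ : Avoids ex (G level₀)
        avoids₀ = imagesDie-sound γ (base L) l ex die lang (language level₀) (sound L) (images level₀)

    module Step (certs : List Certificate) (cons : List (Word 4)) (M : List (Word 4)) (j k l : ℕ) where

      words known : List (Word 4)
      words = map Certificate.word certs ++ ex
      known = cons ++ words

      open Pruning {4} (hasPower 2 1) j

      base : Dir → Word 4 → Bool
      base = bad known (map reverse known)

      open Desubstitution η M base k k k public

      module _ (valid : everyᵇ Certificate.valid certs ≡ true)
               (pruned : prune words (map reverse words) cons ≡ true)
               (okʳ : checkʳ ≡ true) (okˡ : checkˡ ≡ true) (okᵒ : checkᵒ ≡ true)
               (die : imagesDie η (base L) l ex ≡ true) where

        -- A square has exponent at least 2 for every weight, so it is heavy and its images violate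
        -- the freeness of F at every level.
        squareFree : ∀ {n} (ℓ : Tier n) → PowerFree 2 1 (G ℓ)
        squareFree {n} ℓ u k t 0<u eq Guk le with ++-split k u (sym eq) (shorter (length u) (length k) le)
          where
          shorter : ∀ x y → 2 * x ≤ 1 * (x + y) → x ≤ y
          shorter x y p = +-cancelˡ-≤ x x y (subst₂ _≤_ (cong (λ z → x + z) (+-identityʳ x))
              (+-identityʳ (x + y)) p)
        ... | k′ , refl , _ = heavy-power {F} free n u (u ++ k′) t 0<u eq (heavy θ) (heavy κ)
            (images ℓ _ Guk)
          where
          heavy : ∀ w → Heavy (weight w u) (weight w (u ++ k′))
          heavy w = subst (Heavy (weight w u)) (sym (weight-++ w u k′)) (bound (weight w u) (weight w k′))
            where
            bound : ∀ x y → Heavy x (x + y)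
            bound x y = subst (52 * x ≤_) (solve x y) (m≤m+n (52 * x) (2 * x + 27 * y))
              where
              solve : ∀ x y → 52 * x + (2 * x + 27 * y) ≡ 27 * (x + (x + y))
              solve = solve-∀

        squares-die : ∀ {n} (ℓ : Tier n) d v → hasPower 2 1 v ≡ true → ¬ oriented d (G ℓ) v
        squares-die ℓ d v = hasPower-kills 2 1 (oriented-language d (language ℓ))
            (oriented-powerFree d 2 1 {G ℓ} (squareFree ℓ)) v

        avoids-++ : ∀ {P : Pred (Word 4) 0ℓ} us vs → Avoids us P → Avoids vs P → Avoids (us ++ vs) P
        avoids-++ us vs p q u∈ = [ p , q ]′ (∈-++⁻ us u∈)

        avoids-known : ∀ {n} (ℓ : Tier n) → Avoids ex (G ℓ) → Avoids known (G ℓ)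
        avoids-known {n} ℓ av = avoids-++ cons words
            (prune-sound (language ℓ) (squares-die ℓ) words (map reverse words) cons pruned av-words
                (Avoids-reverse {F = G ℓ} av-words))
            av-words
          where
          av-certs : Avoids (map Certificate.word certs) (G ℓ)
          av-certs u∈ Gu with ∈-map⁻ Certificate.word u∈
          ... | c , c∈ , refl = Certificate.valid-sound c (everyᵇ-sound Certificate.valid certs valid c∈)
              lang free n (images ℓ _ Gu)
          av-words : Avoids words (G ℓ)
          av-words = avoids-++ (map Certificate.word certs) ex av-certs av

        module _ {n} (ℓ : Tier n) (av : Avoids ex (G ℓ)) where

          base-sound : ∀ d v → base d v ≡ true → ¬ oriented d (G ℓ) v
          base-sound = bad-sound (language ℓ) (squares-die ℓ) known (map reverse known) (avoids-known ℓ av)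
                         (Avoids-reverse {F = G ℓ} (avoids-known ℓ av))

          next-level : Tier (suc n)
          next-level = record
            { G        = Preimage (G ℓ)
            ; language = preimage-language (language ℓ) base-sound okʳ okˡ okᵒ
            ; images   = λ v Gv → images ℓ _ (preimage-image (language ℓ) base-sound okʳ okˡ okᵒ v Gv)
            ; exhausts = cofinal′
            }
            where
            cofinal′ : ∀ f → F f → ∃[ v ] ∃[ s ] ∃[ t ] (Preimage (G ℓ) v × γη^ (suc n) v ≡ s ++ f ++ t)
            cofinal′ f Ff with exhausts ℓ f Ff
            ... | v , s , t , Gv , eq with cofinal (language ℓ) base-sound okʳ okˡ okᵒ v Gv
            ... | v′ , s′ , t′ , Gv′ , eq′ = v′ , γη^ n s′ ++ s , t ++ γη^ n t′ , Gv′ , (begin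
              γη^ n ((η *) v′)                            ≡⟨ cong (γη^ n) eq′ ⟩
              γη^ n (s′ ++ v ++ t′)                       ≡⟨ γη^-++ n s′ (v ++ t′) ⟩
              γη^ n s′ ++ γη^ n (v ++ t′)                 ≡⟨ cong (γη^ n s′ ++_) (γη^-++ n v t′) ⟩
              γη^ n s′ ++ γη^ n v ++ γη^ n t′             ≡⟨ cong (λ x → γη^ n s′ ++ x ++ γη^ n t′) eq ⟩
              γη^ n s′ ++ (s ++ f ++ t) ++ γη^ n t′       ≡⟨ cong (γη^ n s′ ++_)
                  (trans (++-assoc s (f ++ t) _) (cong (s ++_) (++-assoc f t _))) ⟩
              γη^ n s′ ++ s ++ f ++ t ++ γη^ n t′         ≡⟨ sym (++-assoc (γη^ n s′) s _) ⟩
              (γη^ n s′ ++ s) ++ f ++ t ++ γη^ n t′       ∎)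
              where open ≡-Reasoning

          next-avoids : Avoids ex (G next-level)
          next-avoids = imagesDie-sound η (base L) l ex die (language ℓ) (language next-level)
              (base-sound L)
                          (preimage-image (language ℓ) base-sound okʳ okˡ okᵒ)

        -- Avoidance of `ex` is carried through the induction: at level n it makes the
        -- desubstitution work, and it recurs at level n + 1 because the η-images of words in `ex`,
        -- suitably extended, meet something forbidden at level n.
        levels : (ℓ₀ : Tier 0) → Avoids ex (G ℓ₀) → ∀ n → Σ (Tier n) λ ℓ → Avoids ex (G ℓ)
        levels ℓ₀ av zero    = ℓ₀ , av
        levels ℓ₀ av (suc n) = let ℓ , av′ = levels ℓ₀ av n in next-level ℓ av′ , next-avoids ℓ av′

    module Conclusion (levels : ∀ n → Σ (Tier n) λ ℓ → Avoids ex (G ℓ)) (j : ℕ)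
                      (some-0 : search (meets-0 ex) id j R [] ≡ true)
                      (pairs-occur : (allF 4 λ a → allF 4 λ b → allowed ex a b) ≡ true) where

        contains-0 : ∀ n → G (proj₁ (levels n)) [ 0F ]
        contains-0 n = let ℓ , av = levels n in
          search-sound (language ℓ) (meets-0 ex)
            (λ { R v p Gv → [ (λ q → let t , eq = startsWith-sound [ 0F ] v q in
                                      prefix (reverse-language (language ℓ)) [ 0F ] {t}
                                          (subst (G ℓ ∘ reverse) eq Gv))
                            , (λ q → let u , t , u∈ , eq = startsWithAny-sound (map reverse ex) v q in
                                      ⊥-elim (Avoids-reverse {F = G ℓ} av u∈
                                          (prefix (reverse-language (language ℓ)) u {t}
                                          (subst (G ℓ ∘ reverse) eq Gv))))
                            ]′ (∨-true (startsWith [ 0F ] v) p) })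
            id j R [] some-0 (inhabited (language ℓ))

        limit⊆ : ∀ {f} → Limit f → F f
        limit⊆ {f} (n , s , t , eq) = infixʷ lang s f
            (subst F eq (images (proj₁ (levels n)) [ 0F ] (contains-0 n)))

        pair⊆ : ∀ n (ℓ : Tier n) → Avoids ex (G ℓ) → ∀ w → length w ≡ 2 → G ℓ w → ∀ {f s t} → γη^ n w ≡ s ++
            f ++ t → Limit f
        pair⊆ n ℓ av w@(a ∷ b ∷ []) refl Gw {f} {s} {t} eq
          with ∨-true (somewhere (startsWith w) ((η *) ((η *) ((η *) [ 0F ]))))
              (allF-sound 4 (allowed ex a) (allF-sound 4 (λ a → allF 4 (allowed ex a)) pairs-occur a) b)
        ... | inj₂ q = let u , t , u∈ , eq = startsWithAny-sound ex w q in ⊥-elim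
            (av u∈ (prefix (language ℓ) u (subst (G ℓ) eq Gw)))
        ... | inj₁ q with somewhere-split w ((η *) ((η *) ((η *) [ 0F ]))) q
        ... | s′ , t′ , eq′ = suc (suc (suc n)) , γη^ n s′ ++ s , t ++ γη^ n t′ , (begin
              γη^ n ((η *) ((η *) ((η *) [ 0F ])))         ≡⟨ cong (γη^ n) eq′ ⟩
              γη^ n (s′ ++ w ++ t′)                       ≡⟨ γη^-++ n s′ (w ++ t′) ⟩
              γη^ n s′ ++ γη^ n (w ++ t′)                 ≡⟨ cong (γη^ n s′ ++_) (γη^-++ n w t′) ⟩
              γη^ n s′ ++ γη^ n w ++ γη^ n t′             ≡⟨ cong (λ x → γη^ n s′ ++ x ++ γη^ n t′) eq ⟩
              γη^ n s′ ++ (s ++ f ++ t) ++ γη^ n t′       ≡⟨ cong (γη^ n s′ ++_)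
                  (trans (++-assoc s (f ++ t) _) (cong (s ++_) (++-assoc f t _))) ⟩
              γη^ n s′ ++ s ++ f ++ t ++ γη^ n t′         ≡⟨ sym (++-assoc (γη^ n s′) s _) ⟩
              (γη^ n s′ ++ s) ++ f ++ t ++ γη^ n t′       ∎)
              where open ≡-Reasoning

        pad : ∀ {P : Pred (Word 4) 0ℓ} → Language P → ∀ w → length w ≤ 2 → P w → ∃[ e ]
            (length (w ++ e) ≡ 2 × P (w ++ e))
        pad lang w |w| Pw with extendʳ* lang (2 ∸ length w) w Pw
        ... | e , |e| , Pwe = e , trans (length-++ w)
            (trans (cong (λ z → length w + z) |e|) (m+[n∸m]≡n |w|)) , Pwe

        -- At level n = |f| the image of each letter is longer than `f`, so `f` lies in the image of
        -- a pair; the pair occurs in η³(0), hence `f` in γηⁿ⁺³(0).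
        ⊆limit : ∀ {f} → F f → Limit f
        ⊆limit {f} Ff with levels (length f)
        ... | ℓ , av with exhausts ℓ f Ff
        ... | v , s , t , Gv , eq with within-pair {h = γη^ (length f)} (γη^-++ (length f)) f
            (λ a → <⇒≤ (γη^-grows (length f) a)) v s t eq
        ... | x , w , y , s′ , t′ , refl , |w| , _ , eq′ with pad (language ℓ) w |w|
            (infixʷ (language ℓ) x w Gv)
        ... | e , |we| , Gwe = pair⊆ (length f) ℓ av (w ++ e) |we| Gwe {f} {s′} {t′ ++ γη^ (length f) e}
              (trans (γη^-++ (length f) w e) (trans (cong (_++ γη^ (length f) e) eq′)
                (trans (++-assoc s′ (f ++ t′) _) (cong (s′ ++_) (++-assoc f t′ _)))))

-- The factors of γ(η^ω(0)).

emit-occurs : ∀ (σ : Morphism A B) b bs (w : ω-Word A) m →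
              let v = b ∷ bs ++ (σ *) (applyUpTo w m) in applyUpTo (emit (b ∷ bs) σ w) (length v) ≡ v
emit-occurs σ b []       w zero    = refl
emit-occurs σ b []       w (suc m) = cong (b ∷_) (emit-occurs σ (List⁺.head (σ (w 0)))
    (List⁺.tail (σ (w 0))) (w ∘ suc) m)
emit-occurs σ b (c ∷ bs) w m       = cong (b ∷_) (emit-occurs σ c bs w m)

image-occurs : ∀ (σ : Morphism A B) (w : ω-Word A) x → OccursAt w x 0 → OccursAt (σ ⟨ w ⟩) ((σ *) x) 0
image-occurs σ w []      _  = refl
image-occurs σ w (a ∷ x) eq =
  subst (λ y → applyUpTo (σ ⟨ w ⟩) (length ((σ *) y)) ≡ (σ *) y) eq
      (emit-occurs σ (List⁺.head (σ (w 0))) (List⁺.tail (σ (w 0))) (w ∘ suc) (length x))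

fold-shift : ∀ (f : A → A) x n → fold (f x) f n ≡ f (fold x f n)
fold-shift f x zero    = refl
fold-shift f x (suc n) = cong f (fold-shift f x n)

γη^-fold : ∀ n v → γη^ n v ≡ (γ *) (fold v (η *) n)
γη^-fold zero    v = refl
γη^-fold (suc n) v = trans (γη^-fold n ((η *) v)) (cong (γ *) (fold-shift (η *) v n))

occurs-γη^ : ∀ n → OccursAt γη^ω⟨0⟩ (γη^ n [ 0F ]) 0
occurs-γη^ n = subst (λ v → OccursAt γη^ω⟨0⟩ v 0) (sym (γη^-fold n [ 0F ]))
                 (image-occurs γ η^ω⟨0⟩ (η^ n ⟨0⟩) (η^ω-limit n))

applyUpTo-++ : ∀ (w : ω-Word A) v {t} → applyUpTo w (length (v ++ t)) ≡ v ++ t → applyUpTo w (length v) ≡ v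
applyUpTo-++ w []      eq = refl
applyUpTo-++ w (a ∷ v) eq = cong₂ _∷_ (∷-injectiveˡ eq) (applyUpTo-++ (w ∘ suc) v (∷-injectiveʳ eq))

occurs-suffix : ∀ (w : ω-Word A) i s {v} → OccursAt w (s ++ v) i → OccursAt w v (i + length s)
occurs-suffix w i []      {v} eq = subst (OccursAt w v) (sym (+-identityʳ i)) eq
occurs-suffix w i (a ∷ s) {v} eq = subst (OccursAt w v) (sym (+-suc i (length s)))
  (occurs-suffix w (suc i) s (trans (applyUpTo-cong (λ k → cong w (sym (+-suc i k))) _) (∷-injectiveʳ eq)))

stretch : ∀ (w : ω-Word A) i j v {n} → OccursAt w v (i + j) → j + length v ≤ n →
          ∃[ s ] ∃[ t ] (applyUpTo (λ k → w (i + k)) n ≡ s ++ v ++ t × length s ≡ j)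
stretch w i j v {n} eq le = applyUpTo wᵢ j , rest , (begin
  applyUpTo wᵢ n                                     ≡⟨ cong (applyUpTo wᵢ) (sym n≡) ⟩
  applyUpTo wᵢ (j + (length v + r))                  ≡⟨ applyUpTo-+ wᵢ j (length v + r) ⟩
  applyUpTo wᵢ j ++ applyUpTo wⱼ (length v + r)      ≡⟨ cong (applyUpTo wᵢ j ++_)
      (applyUpTo-+ wⱼ (length v) r) ⟩
  applyUpTo wᵢ j ++ applyUpTo wⱼ (length v) ++ rest  ≡⟨ cong (λ x → applyUpTo wᵢ j ++ x ++ rest)
                                                          (trans (applyUpTo-cong
                                                              (λ k → cong w (sym (+-assoc i j k)))
                                                              (length v)) eq) ⟩
  applyUpTo wᵢ j ++ v ++ rest                        ∎) , length-applyUpTo wᵢ j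
  where
  open ≡-Reasoning
  wᵢ = λ k → w (i + k)
  wⱼ = λ k → wᵢ (j + k)
  r = n ∸ (j + length v)
  rest = applyUpTo (λ k → wⱼ (length v + k)) r
  n≡ : j + (length v + r) ≡ n
  n≡ = trans (sym (+-assoc j (length v) r)) (m+[n∸m]≡n le)

Limit≐Factors : Limit ≐ Factors γη^ω⟨0⟩
Limit≐Factors = to , from
  where
  to : ∀ {v} → Limit v → Factors γη^ω⟨0⟩ v
  to {v} (n , s , t , eq) = length s , applyUpTo-++ _ v
      (occurs-suffix γη^ω⟨0⟩ 0 s (subst (λ x → OccursAt γη^ω⟨0⟩ x 0) eq (occurs-γη^ n)))
  from : ∀ {v} → Factors γη^ω⟨0⟩ v → Limit v
  from {v} (i , eq) with stretch γη^ω⟨0⟩ 0 i v {length (γη^ (i + length v) [ 0F ])} eq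
      (<⇒≤ (γη^-grows (i + length v) 0F))
  ... | s , t , eq′ , _ = i + length v , s , t , trans (sym (occurs-γη^ (i + length v))) eq′

applyUpTo-length : ∀ (f : ℕ → A) n → applyUpTo f (length (applyUpTo f n)) ≡ applyUpTo f n
applyUpTo-length f n = cong (applyUpTo f) (length-applyUpTo f n)

-- The language of a recurrent word.

module _ {A : Set} (w : ω-Word A) where

  factors-prefix : ∀ v {t} → Factors w (v ++ t) → Factors w v
  factors-prefix v (i , eq) = i , applyUpTo-++ (λ k → w (i + k)) v eq

  factors-suffix : ∀ s {v} → Factors w (s ++ v) → Factors w v
  factors-suffix s (i , eq) = i + length s , occurs-suffix w i s eq

  stretch-factor : ∀ i n → Factors w (applyUpTo (λ k → w (i + k)) n)
  stretch-factor i n = i , applyUpTo-length _ n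

  module _ (rec : Recurrent w) where

    recurrent-language : Language (Factors w)
    recurrent-language = record
      { inhabited = 0 , refl
      ; prefix    = factors-prefix
      ; suffix    = factors-suffix
      ; extendˡ   = left
      ; extendʳ   = λ v (i , eq) → w (i + length v) , i , trans
          (cong (applyUpTo _) (trans (length-++ v) (+-comm (length v) 1)))
                      (trans (sym (applyUpTo-∷ʳ _ (length v))) (cong (λ u → u ∷ʳ w (i + length v)) eq))
      }
      where
      left : ∀ v → Factors w v → ∃[ a ] Factors w (a ∷ v)
      -- An occurrence at a positive position has a letter before it; only recurrence provides one.
      left v Fv with rec v Fv 1
      ... | suc i , _ , eq = w i , i , cong₂ _∷_ (cong w (+-identityʳ i))
                               (trans (applyUpTo-cong (λ k → cong w (+-suc i k)) (length v)) eq)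

    recurrent-irreducible : ∀ x y → Factors w x → Factors w y → ∃[ t ] Factors w (x ++ t ++ y)
    recurrent-irreducible x y (i , eqx) Fy with rec y Fy (i + length x)
    ... | j , j≥ , eqy with stretch w i (length x + d) y {(length x + d) + length y}
        (subst (OccursAt w y) (sym i+≡) eqy) ≤-refl
      where
      d = j ∸ (i + length x)
      i+≡ : i + (length x + d) ≡ j
      i+≡ = trans (sym (+-assoc i (length x) d)) (m+[n∸m]≡n j≥)
    ... | s , t , eq , |s| with stretch w i 0 x {length x + (j ∸ (i + length x)) + length y}
        (subst (OccursAt w x) (sym (+-identityʳ i)) eqx)
                                  (subst (length x ≤_) (sym (+-assoc (length x) _ _)) (m≤m+n _ _))
    ... | [] , t′ , eq′ , _ with ++-split s x (trans (sym eq) eq′)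
        (subst (length x ≤_) (sym |s|) (m≤m+n _ _))
    ... | e , refl , _ = e , factors-prefix (x ++ e ++ y) {t} (subst (Factors w)
          (trans eq (trans (++-assoc x e (y ++ t))
              (trans (cong (x ++_) (sym (++-assoc e y t))) (sym (++-assoc x (e ++ y) t)))))
          (stretch-factor i _))

irreducible⇒directed : ∀ {n} {F : Pred (Word n) 0ℓ} → Irreducible F → Directed F
irreducible⇒directed {F = F} irr x y Fx Fy with irr x y Fx Fy
... | t , Fz = [] , t ++ y , x ++ t , [] , Fz ,
               trans (sym (++-assoc x t y)) (cong ((x ++ t) ++_) (sym (++-identityʳ y)))

-- The language of a bi-infinite word.

module _ {A : Set} (w : ℤ-Word A) where

  from : ℤ → ω-Word A
  from i k = w (i ℤ.+ + k)

  from-+ : ∀ i d k → from (i ℤ.+ + d) k ≡ from i (d + k)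
  from-+ i d k = cong w (ℤ.+-assoc i (+ d) (+ k))

  shift : ∀ i d v → OccursAtℤ w v (i ℤ.+ + d) → OccursAt (from i) v d
  shift i d v eq = trans (applyUpTo-cong (λ k → sym (from-+ i d k)) (length v)) eq

  unshift : ∀ i d v → OccursAt (from i) v d → OccursAtℤ w v (i ℤ.+ + d)
  unshift i d v eq = trans (applyUpTo-cong (from-+ i d) (length v)) eq

  factorsℤ : ∀ i {v} → Factors (from i) v → Factorsℤ w v
  factorsℤ i {v} (d , eq) = i ℤ.+ + d , unshift i d v eq

  factorsℤ-language : Language (Factorsℤ w)
  factorsℤ-language = record
    { inhabited = + 0 , refl
    ; prefix    = λ v (i , eq) → i , applyUpTo-++ (from i) v eq
    ; suffix    = λ s {v} (i , eq) → factorsℤ i (length s , occurs-suffix (from i) 0 s eq)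
    ; extendˡ   = λ v (i , eq) → w (ℤ.pred i) , ℤ.pred i , cong₂ _∷_ (cong w (ℤ.+-identityʳ (ℤ.pred i)))
                    (trans (applyUpTo-cong (λ k → cong w (pred-suc i k)) (length v)) eq)
    ; extendʳ   = λ v (i , eq) → from i (length v) , i , trans
        (cong (applyUpTo _) (trans (length-++ v) (+-comm (length v) 1)))
                    (trans (sym (applyUpTo-∷ʳ _ (length v))) (cong (λ u → u ∷ʳ from i (length v)) eq))
    }
    where
    pred-suc : ∀ i k → ℤ.pred i ℤ.+ + suc k ≡ i ℤ.+ + k
    pred-suc i k = trans (cong (ℤ._+ + suc k) (ℤ.+-comm (ℤ.- (+ 1)) i))
                     (trans (ℤ.+-assoc i (ℤ.- (+ 1)) (+ suc k)) refl)

  private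
    ordered : ∀ x y i d → OccursAtℤ w x i → OccursAtℤ w y (i ℤ.+ + d) →
              ∃[ s ] ∃[ t ] ∃[ s′ ] ∃[ t′ ] (Factorsℤ w (s ++ x ++ t) × s ++ x ++ t ≡ s′ ++ y ++ t′)
    ordered x y i d eqx eqy with stretch (from i) 0 0 x {length x + (d + length y)} eqx (m≤m+n _ _)
                               | stretch (from i) 0 d y {length x + (d + length y)} (shift i d y eqy)
                                   (m≤n+m _ (length x))
    ... | s , t , eq , _ | s′ , t′ , eq′ , _ = s , t , s′ , t′ ,
          subst (Factorsℤ w) eq (i , applyUpTo-length (from i) _) , trans (sym eq) eq′

    difference : ∀ i j → i ℤ.≤ j → ∃[ d ] j ≡ i ℤ.+ + d
    difference i j i≤j = ℤ.∣ j ℤ.- i ∣ , sym (trans (cong (λ d → i ℤ.+ d) (ℤ.0≤i⇒+∣i∣≡i (ℤ.i≤j⇒0≤j-i i≤j)))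
      (trans (ℤ.+-comm i (j ℤ.- i)) (trans (ℤ.+-assoc j (ℤ.- i) i)
        (trans (cong (λ d → j ℤ.+ d) (ℤ.+-inverseˡ i)) (ℤ.+-identityʳ j)))))

  factorsℤ-directed : ∀ x y → Factorsℤ w x → Factorsℤ w y →
                      ∃[ s ] ∃[ t ] ∃[ s′ ] ∃[ t′ ] (Factorsℤ w (s ++ x ++ t) × s ++ x ++ t ≡ s′ ++ y ++ t′)
  factorsℤ-directed x y (i , eqx) (j , eqy) with ℤ.≤-total i j
  ... | inj₁ i≤j with difference i j i≤j
  ... | d , refl = ordered x y i d eqx eqy
  factorsℤ-directed x y (i , eqx) (j , eqy) | inj₂ j≤i with difference j i j≤i
  ... | d , refl with ordered y x j d eqy eqx
  ... | s , t , s′ , t′ , Fz , eq = s′ , t′ , s , t , subst (Factorsℤ w) eq Fz , sym eq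

-- The computations for (b) and (c), and their conclusion.

-- Words that begin, inside an image under γ (and under η for M₁), only where the image of a
-- letter begins.
M₀ : List (Word 3)
M₀ =
  (0F ∷ 1F ∷ 2F ∷ 0F ∷ 2F ∷ 1F ∷ 2F ∷ 0F ∷ 1F ∷ 2F ∷ []) ∷
  (0F ∷ 1F ∷ 2F ∷ 1F ∷ 0F ∷ 1F ∷ 2F ∷ 0F ∷ 2F ∷ 1F ∷ 2F ∷ 0F ∷ 1F ∷ 0F ∷ 2F ∷ 0F ∷ 1F ∷ 2F ∷ 0F ∷ []) ∷
  (0F ∷ 1F ∷ 2F ∷ 0F ∷ 2F ∷ 1F ∷ 2F ∷ 0F ∷ 1F ∷ 0F ∷ 2F ∷ 0F ∷ 1F ∷ 2F ∷ 1F ∷ 0F ∷ 1F ∷ 2F ∷ 0F ∷ 2F ∷ []) ∷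
  []

M₁ : List (Word 4)
M₁ = (0F ∷ 1F ∷ 0F ∷ 2F ∷ []) ∷ (0F ∷ 1F ∷ 3F ∷ 2F ∷ 0F ∷ 1F ∷ []) ∷ (2F ∷ 0F ∷ 1F ∷ 3F ∷ 0F ∷ []) ∷ []

-- The data of the searches, and what is to be checked about them. They are abstract so
-- that they are evaluated here only.
abstract

  Ls Rs F₃ : List (Word 3)
  Ls = L₁₁
  Rs = R₁₁
  F₃ = forbidden

  Rs-reversed : Rs ≡ map reverse Ls
  Rs-reversed = refl

  renamed : Fin 3 → Fin 3 → Fin 3 → List (Word 3)
  renamed = renamings

  X₄ C₄ : List (Word 4)
  X₄ = excludedFactors
  C₄ = consequences

  certs : List Certificate
  certs = certificates

  m₃ : List (Word 3)
  m₃ = M₀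

  marks : List (Word 4)
  marks = M₁

  k₁ k₄ k₆ k₁₁ k₁₄ k₁₆ k₂₀ k₄₅ k₅₅ : ℕ
  k₁ = 1
  k₄ = 4
  k₆ = 6
  k₁₁ = 11
  k₁₄ = 14
  k₁₆ = 16
  k₂₀ = 20
  k₄₅ = 45
  k₅₅ = 55

open Kill 52 27 [] [] using (kills)

avoided : List (Word 3)
avoided = F₃ ++ Rs

base₀ : Dir → Word 3 → Bool
base₀ = Pruning.bad kills k₄₅ avoided (map reverse avoided)

known : List (Word 4)
known = C₄ ++ map Certificate.word certs ++ X₄

base₁ : Dir → Word 4 → Bool
base₁ = Pruning.bad (hasPower 2 1) k₁₆ known (map reverse known)

module D₀ = Desubstitution γ m₃ base₀ k₅₅ k₅₅ k₅₅
module D₁ = Desubstitution η marks base₁ k₂₀ k₂₀ k₂₀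

abstract

  excluded-ok : allF 3 (excluded₁ k₁ k₁₄ renamed) ≡ true
  excluded-ok = refl

  closedᴸ-ok : shiftClosed kills Ls Ls ≡ true
  closedᴸ-ok = refl

  closedᴿ-ok : shiftClosed kills Rs Rs ≡ true
  closedᴿ-ok = refl

  disjoint-ok : everyᵇ (λ w → not (w ∈ᵇ Rs)) Ls ≡ true
  disjoint-ok = refl

  sized-ok : everyᵇ (λ w → length w ≡ᵇ 11) (Ls ++ Rs) ≡ true
  sized-ok = refl

  cover-ok : scan (Orientation.covers Ls Rs k₁₁) k₁₁ [] ≡ true
  cover-ok = refl

  pruned₃-ok : Pruning.prune kills k₄₅ Rs (map reverse Rs) F₃ ≡ true
  pruned₃-ok = refl

  right₀-ok : D₀.checkʳ ≡ true
  right₀-ok = refl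

  left₀-ok : D₀.checkˡ ≡ true
  left₀-ok = refl

  occurs₀-ok : D₀.checkᵒ ≡ true
  occurs₀-ok = refl

  images₀-ok : imagesDie γ (base₀ L) k₄ X₄ ≡ true
  images₀-ok = refl

  valid-ok : everyᵇ Certificate.valid certs ≡ true
  valid-ok = refl

  pruned₄-ok : Pruning.prune (hasPower 2 1) k₁₆ (map Certificate.word certs ++ X₄)
                 (map reverse (map Certificate.word certs ++ X₄)) C₄ ≡ true
  pruned₄-ok = refl

  right₁-ok : D₁.checkʳ ≡ true
  right₁-ok = refl

  left₁-ok : D₁.checkˡ ≡ true
  left₁-ok = refl

  occurs₁-ok : D₁.checkᵒ ≡ true
  occurs₁-ok = refl

  images₁-ok : imagesDie η (base₁ L) k₄ X₄ ≡ true
  images₁-ok = refl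

  zero-ok : search (meets-0 X₄) id k₆ R [] ≡ true
  zero-ok = refl

  pairs-ok : (allF 4 λ a → allF 4 λ b → allowed X₄ a b) ≡ true
  pairs-ok = refl

base₀-sound : {F : Pred (Word 3) 0ℓ} → Language F → PowerFree 52 27 F → Only7 [] F → Avoids Rs F →
              ∀ d v → base₀ d v ≡ true → ¬ oriented d F v
base₀-sound {F} lang free only av =
  Pruning.bad-sound kills k₄₅ lang killed avoided (map reverse avoided) av′ (Avoids-reverse {F = F} av′)
  where
  killed : ∀ d v → kills v ≡ true → ¬ oriented d F v
  killed = kills-oriented 52 27 [] (const []) lang free only (λ _ ())
  av′ : Avoids avoided F
  av′ u∈ = [ Pruning.prune-sound kills k₄₅ lang killed Rs (map reverse Rs) F₃ pruned₃-ok av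
      (Avoids-reverse {F = F} av) , av ]′ (∈-++⁻ F₃ u∈)

determined : {F : Pred (Word 3) 0ℓ} → Language F → PowerFree 52 27 F → Only7 [] F → Avoids Rs F → F ≐ Limit
determined {F} lang free only av = ⊆limit , limit⊆
  where
  sound = base₀-sound lang free only av
  open Tower lang free
  open Conclusion X₄ (Step.levels X₄ certs C₄ marks k₁₆ k₂₀ k₄ valid-ok pruned₄-ok right₁-ok left₁-ok
      occurs₁-ok images₁-ok
      (Base.level₀ X₄ base₀ sound m₃ k₅₅ k₄ right₀-ok left₀-ok occurs₀-ok images₀-ok)
      (Base.avoids₀ X₄ base₀ sound m₃ k₅₅ k₄ right₀-ok left₀-ok occurs₀-ok images₀-ok)) k₆ zero-ok pairs-ok

determined-up-to-reversal : {F : Pred (Word 3) 0ℓ} → Language F → PowerFree 52 27 F → Only7 [] F → Directed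
    F →
                            (F ≐ Factors γη^ω⟨0⟩) ⊎ (F ≐ Factors γη^ω⟨0⟩ ᴿ)
determined-up-to-reversal {F} lang free only directed
  with Orientation.orientation Ls Rs k₁₁ closedᴸ-ok closedᴿ-ok disjoint-ok sized-ok cover-ok lang free only
      directed
... | inj₁ av with determined lang free only av
... | to , from = inj₁ ((λ p → proj₁ Limit≐Factors (to p)) , (λ p → from (proj₂ Limit≐Factors p)))
determined-up-to-reversal {F} lang free only directed | inj₂ av
  with determined (reverse-language lang) (powerFree-reverse 52 27 {F} free) only
         (subst (λ us → Avoids us (F ∘ reverse)) (sym Rs-reversed) (Avoids-reverse {us = Ls} {F = F} av))
... | to , from = inj₂ ((λ {v} p → reverse v , proj₁ Limit≐Factors
    (to (subst F (sym (reverse-involutive v)) p)) , sym (reverse-involutive v))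
                       , λ { (u , p , refl) → from (proj₂ Limit≐Factors p) })

PowerFree-mono : ∀ {n} {F : Pred (Word n) 0ℓ} → PowerFree 25 13 F → PowerFree 52 27 F
PowerFree-mono free u k t 0<u eq Fv le = free u k t 0<u eq Fv (bound (length u) (length u + length k) le)
  where
  -- 25/13 = 675/351 and 52/27 = 676/351
  bound : ∀ x y → 52 * x ≤ 27 * y → 25 * x ≤ 13 * y
  bound x y le = *-cancelˡ-≤ 27 (≤-trans (subst₂ _≤_ (solve₁ x) (solve₂ x) (m≤m+n (675 * x) x))
                   (subst₂ _≤_ (solve₃ x) (solve₄ y) (*-monoʳ-≤ 13 le)))
    where
    solve₁ : ∀ x → 675 * x ≡ 27 * (25 * x)
    solve₁ = solve-∀
    solve₂ : ∀ x → 675 * x + x ≡ 676 * x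
    solve₂ = solve-∀
    solve₃ : ∀ x → 13 * (52 * x) ≡ 676 * x
    solve₃ = solve-∀
    solve₄ : ∀ y → 13 * (27 * y) ≡ 27 * (13 * y)
    solve₄ = solve-∀

bi-infinite : ∀ (w : ℤ-Word (Fin 3)) → Free (+ 52 / 27) (Factorsℤ w) → AtMost 16 (Factorsℤ w ∩ Palindrome) →
              (Factorsℤ w ≐ Factors γη^ω⟨0⟩) ⊎ (Factorsℤ w ≐ Factors γη^ω⟨0⟩ ᴿ)
bi-infinite w free few = determined-up-to-reversal lang pf
    (λ a b c d Fv → ⊥-elim (no-7-palindrome (all₁₆-of-16 lang pf few) few (seven a b c d) refl refl Fv))
    (factorsℤ-directed w)
  where
  lang = factorsℤ-language w
  pf = Free⇒PowerFree 52 26 {Factorsℤ w} (≤ᵇ-true 28 refl) free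

recurrent : ∀ (w : ω-Word (Fin 3)) → Recurrent w → Free (+ 25 / 13) (Factors w) → AtMost 17
    (Factors w ∩ Palindrome) →
            (Factors w ≐ Factors γη^ω⟨0⟩) ⊎ (Factors w ≐ Factors γη^ω⟨0⟩ ᴿ)
recurrent w rec free few = determined-up-to-reversal lang (PowerFree-mono {F = Factors w} pf)
    (λ a b c d Fv → ⊥-elim (no-seven k₁ k₁₄ renamed excluded-ok lang pf irr few (all₁₆-of-17 lang pf few) a
        b c d Fv))
    (irreducible⇒directed {F = Factors w} irr)
  where
  lang = recurrent-language w rec
  irr = recurrent-irreducible w rec
  pf = Free⇒PowerFree 25 12 {Factors w} (≤ᵇ-true 14 refl) free

-- Part (a): reduction of local properties to the images of pairs.

-- Factors of ηⁿ(0).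

Infix : {A : Set} → List A → List A → Set
Infix f w = ∃[ s ] ∃[ t ] w ≡ s ++ f ++ t

infix-trans : {A : Set} {f g w : List A} → Infix f g → Infix g w → Infix f w
infix-trans {f = f} (s , t , refl) (s′ , t′ , refl) = s′ ++ s , t ++ t′ ,
  trans (cong (s′ ++_) (trans (++-assoc s (f ++ t) t′) (cong (s ++_) (++-assoc f t t′))))
      (sym (++-assoc s′ s _))

infix-empty : {A : Set} (s f : List A) {t : List A} → [] ≡ s ++ f ++ t → f ≡ []
infix-empty []      []      eq = refl
infix-empty []      (_ ∷ _) ()
infix-empty (_ ∷ _) f       ()

infix-image : {A B : Set} (h : List A → List B) → (∀ u v → h (u ++ v) ≡ h u ++ h v) → ∀ {f w} → Infix f w →
    Infix (h f) (h w)
infix-image h h-++ {f} (s , t , refl) = h s , h t , trans (h-++ s (f ++ t)) (cong (h s ++_) (h-++ f t))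

tails : Word n → List (Word n)
tails []      = []
tails (a ∷ v) = (a ∷ v) ∷ tails v

tails-infix : ∀ {s f t w : Word n} → w ≡ s ++ f ++ t → 0 < length f → f ++ t ∈ tails w
tails-infix {s = []}    {a ∷ f} refl _ = here refl
tails-infix {s = x ∷ s} {f}     refl l = there (tails-infix {s = s} {f} refl l)

singletons-and-pairs : List (Word 4)
singletons-and-pairs = [ 0F ] ∷ [ 1F ] ∷ [ 2F ] ∷ [ 3F ] ∷ pairs

twoLetterFactorsOf : Word 4 → Bool
twoLetterFactorsOf v = everyᵇ (λ y → (length (take 2 y) ≤ᵇ 1) ∨ (take 2 y ∈ᵇ pairs)) (tails ((η *) v))

pairs-closed : everyᵇ twoLetterFactorsOf singletons-and-pairs ≡ true
pairs-closed = refl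

η-++ : ∀ u v → (η *) (u ++ v) ≡ (η *) u ++ (η *) v
η-++ = concatMap-++ (List⁺.toList ∘ η)

η-long : ∀ a → 2 ≤ length ((η *) [ a ])
η-long 0F = s≤s (s≤s z≤n)
η-long 1F = s≤s (s≤s z≤n)
η-long 2F = s≤s (s≤s z≤n)
η-long 3F = s≤s (s≤s z≤n)

-- Images under η have at least two letters, so a pair at level n + 1 comes from at most two letters
-- at level n, and `pairs` is closed under this passage.
pairs-only : ∀ n a b → Infix (a ∷ b ∷ []) (η^ n ⟨0⟩) → a ∷ b ∷ [] ∈ pairs
pairs-only zero a b ([] , t , ())
pairs-only zero a b (_ ∷ [] , t , ())
pairs-only zero a b (_ ∷ _ ∷ s , t , ())
pairs-only (suc n) a b (s , t , eq) with within-pair {h = η *} η-++ (a ∷ b ∷ []) η-long (η^ n ⟨0⟩) s t eq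
... | x , w , y , s′ , t′ , eq₁ , |w| , _ , eq₂
  with ∨-true (length (a ∷ b ∷ []) ≤ᵇ 1) (everyᵇ-sound _ (tails ((η *) w))
      (everyᵇ-sound twoLetterFactorsOf singletons-and-pairs pairs-closed (small w |w| eq₁ eq₂))
      (tails-infix {s = s′} {a ∷ b ∷ []} eq₂ z<s))
  where
  small : ∀ w → length w ≤ 2 → η^ n ⟨0⟩ ≡ x ++ w ++ y → (η *) w ≡ s′ ++ (a ∷ b ∷ []) ++ t′ → w ∈
      singletons-and-pairs
  small []               _ _ eq = ⊥-elim (case-∷ (infix-empty s′ (a ∷ b ∷ []) eq))
    where
    case-∷ : a ∷ b ∷ [] ≢ []
    case-∷ ()
  small (0F ∷ [])     _ _  _ = here refl
  small (1F ∷ [])     _ _  _ = there (here refl)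
  small (2F ∷ [])     _ _  _ = there (there (here refl))
  small (3F ∷ [])     _ _  _ = there (there (there (here refl)))
  small (c ∷ d ∷ [])  _ eq _ = there (there (there (there (pairs-only n c d (x , y , eq)))))
  small (_ ∷ _ ∷ _ ∷ _) (s≤s (s≤s ())) _ _
... | inj₂ q = ∈ᵇ-sound _ pairs q

module Local {B : Set} (h : Word 4 → List B) (h-++ : ∀ u v → h (u ++ v) ≡ h u ++ h v) where

  -- Any successor would do; it places a factor of the image of a single letter in the image of a
  -- pair.
  pairUp : Fin 4 → Fin 4
  pairUp 0F = 1F
  pairUp _  = 0F

  pairUp-pairs : ∀ a → a ∷ pairUp a ∷ [] ∈ pairs
  pairUp-pairs 0F = here refl
  pairUp-pairs 1F = there (there (there (here refl)))
  pairUp-pairs 2F = there (there (there (there (there (here refl)))))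
  pairUp-pairs 3F = there (there (there (there (there (there (here refl))))))

  local : ∀ n f → 0 < length f → (∀ a → length f ≤ length (h [ a ])) → Infix f (h (η^ n ⟨0⟩)) → ∃[ p ]
      (p ∈ pairs × Infix f (h p))
  local n f 0<f long (s , t , eq) with within-pair {h = h} h-++ f long (η^ n ⟨0⟩) s t eq
  ... | x , [] , y , s′ , t′ , eq₁ , |w| , _ , eq₂ = ⊥-elim
      (<⇒≢ 0<f (cong length (sym (infix-empty s′ f (trans (sym (h-[] {h = h} h-++)) eq₂)))))
  ... | x , a ∷ [] , y , s′ , t′ , eq₁ , |w| , _ , eq₂ = a ∷ pairUp a ∷ [] , pairUp-pairs a ,
        infix-trans (s′ , t′ , eq₂) ([] , h [ pairUp a ] , h-++ [ a ] [ pairUp a ])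
  ... | x , a ∷ b ∷ [] , y , s′ , t′ , eq₁ , |w| , _ , eq₂ = a ∷ b ∷ [] , pairs-only n a b (x , y , eq₁) ,
      s′ , t′ , eq₂
  ... | x , _ ∷ _ ∷ _ ∷ _ , y , s′ , t′ , eq₁ , s≤s (s≤s ()) , _ , eq₂

Limit-γ : ∀ {f} → Limit f → ∃[ n ] Infix f ((γ *) (η^ n ⟨0⟩))
Limit-γ (n , s , t , eq) = n , s , t , trans (sym (γη^-fold n [ 0F ])) eq

γ-++ : ∀ u v → (γ *) (u ++ v) ≡ (γ *) u ++ (γ *) v
γ-++ = concatMap-++ (List⁺.toList ∘ γ)

-- A nonempty factor no longer than any `h [ a ]` begins some tail of some `h p`, so tests that look
-- at the front of the tails cover all such factors.
everyTail : (h : Word 4 → Word n) → (Word n → Bool) → Bool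
everyTail h test = everyᵇ (λ p → everyᵇ test (tails (h p))) pairs

everyTail-sound : (h : Word 4 → Word n) (h-++ : ∀ u v → h (u ++ v) ≡ h u ++ h v) → ∀ test → everyTail h test
    ≡ true →
                  ∀ m f → 0 < length f → (∀ a → length f ≤ length (h [ a ])) → Infix f (h (η^ m ⟨0⟩)) → ∃[ t
                      ] test (f ++ t) ≡ true
everyTail-sound h h-++ test ok m f 0<f long inf with Local.local h h-++ m f 0<f long inf
... | p , p∈ , s , t , eq = t , everyᵇ-sound test (tails (h p))
    (everyᵇ-sound (λ p → everyᵇ test (tails (h p))) pairs ok p∈) (tails-infix {s = s} {f} eq 0<f)

-- The palindromes of γ(η^ω(0)).

wrap : Fin 3 → Word 3 → Word 3
wrap a u = a ∷ u ∷ʳ a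

-- A palindrome without its outer letters is a palindrome, so it suffices that no palindrome
-- outside the list arises from one in the list by adding two letters.
notWrap : Word 3 → Word 3 → Fin 3 → Bool
notWrap y u a = (wrap a u ∈ᵇ palindromes₁₆) ∨ not (startsWith (wrap a u) y)

notWrapped : Word 3 → Bool
notWrapped y = everyᵇ (λ u → allF 3 (notWrap y u)) palindromes₁₆

early : Word 3 → Bool
early u = somewhere (startsWith u) (γη^ 2 [ 0F ])

abstract
  notWrapped-ok : everyTail (γ *) notWrapped ≡ true
  notWrapped-ok = refl

  occurring-ok : everyᵇ early palindromes₁₆ ≡ true
  occurring-ok = refl

γ-long : ∀ a → 15 ≤ length ((γ *) [ a ])
γ-long 0F = ≤ᵇ-true 15 refl
γ-long 1F = ≤ᵇ-true 15 refl
γ-long 2F = ≤ᵇ-true 15 refl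
γ-long 3F = ≤ᵇ-true 15 refl

Limit-infix : ∀ {f g} → Infix f g → Limit g → Limit f
Limit-infix inf (n , s , t , eq) = let s′ , t′ , eq′ = infix-trans inf (s , t , eq) in n , s′ , t′ , eq′

palindrome-peel : ∀ (v : Word 3) → 2 ≤ length v → Palindrome v → ∃[ a ] ∃[ u ] (v ≡ wrap a u × Palindrome u)
palindrome-peel (a ∷ b ∷ v) (s≤s (s≤s _)) pal with unsnoc b v
  where
  unsnoc : ∀ b v → ∃[ u ] ∃[ c ] b ∷ v ≡ u ∷ʳ c
  unsnoc b []      = [] , b , refl
  unsnoc b (d ∷ v) = let u , c , eq = unsnoc d v in b ∷ u , c , cong (b ∷_) eq
... | u , c , eq with ∷-injective (trans (sym (trans (unfold-reverse a (u ∷ʳ c))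
    (cong (_∷ʳ a) (reverse-++ u [ c ]))))
                        (subst (λ v → Palindrome (a ∷ v)) eq pal))
... | refl , eq′ = a , u , cong (a ∷_) eq , ∷ʳ-injectiveˡ (reverse u) u eq′

palindromes-only : ∀ m v → length v ≤ m → Limit v → Palindrome v → v ∈ palindromes₁₆
palindromes-only m []       _ lim pal = here refl
palindromes-only m (0F ∷ []) _ lim pal = there (here refl)
palindromes-only m (1F ∷ []) _ lim pal = there (there (here refl))
palindromes-only m (2F ∷ []) _ lim pal = there (there (there (here refl)))
palindromes-only (suc m) v@(_ ∷ _ ∷ _) (s≤s le) lim pal with palindrome-peel v (s≤s (s≤s z≤n)) pal
... | a , u , eq , pal′ = wrapped (palindromes-only m u (≤-trans |u| le)
    (Limit-infix ([ a ] , [ a ] , eq) lim) pal′)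
  where
  |u| : length u ≤ length (drop 1 v)
  |u| = subst (length u ≤_) (trans (sym (length-++ u)) (cong pred (cong length (sym eq)))) (m≤m+n _ 1)
  wrapped : u ∈ palindromes₁₆ → v ∈ palindromes₁₆
  wrapped u∈ with Limit-γ lim
  ... | n , inf with everyTail-sound (γ *) γ-++ notWrapped notWrapped-ok n v z<s
      (λ b → ≤-trans short (γ-long b)) inf
    where
    short : length v ≤ 15
    short = subst (_≤ 15) (sym (trans (cong length eq)
        (cong suc (trans (length-++ u) (+-comm (length u) 1)))))
      (s≤s (s≤s (≤-trans (<⇒≤ (All.lookup palindromes₁₆-short u∈)) (≤ᵇ-true 7 refl))))
  ... | t , ok with ∨-true (wrap a u ∈ᵇ palindromes₁₆)
      (allF-sound 3 (notWrap (v ++ t) u) (everyᵇ-sound (λ u → allF 3 (notWrap (v ++ t) u)) palindromes₁₆ ok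
      u∈) a)
  ... | inj₁ q = subst (_∈ palindromes₁₆) (sym eq) (∈ᵇ-sound (wrap a u) palindromes₁₆ q)
  ... | inj₂ q = ⊥-elim (true≢false (trans (sym (startsWith-++ v t))
      (subst (λ x → startsWith x (v ++ t) ≡ false) (sym eq) (not-true _ q))))

unique-length : {A : Set} (xs ys : List A) → Unique xs → (∀ {x} → x ∈ xs → x ∈ ys) → length xs ≤ length ys
unique-length []       ys uniq       sub = z≤n
unique-length (x ∷ xs) ys (x∉ ∷ uniq) sub with ∈-∃++ (sub (here refl))
... | ys₁ , ys₂ , refl = subst (suc (length xs) ≤_)
    (sym (trans (length-++ ys₁) (trans (+-suc (length ys₁) (length ys₂)) (cong suc (sym (length-++ ys₁))))))
  (s≤s (unique-length xs (ys₁ ++ ys₂) uniq λ {y} y∈ → delete (λ { refl → All.lookup x∉ y∈ refl }) ys₁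
      (sub (there y∈))))
  where
  delete : ∀ {y} → y ≢ x → ∀ ys₁ → y ∈ ys₁ ++ x ∷ ys₂ → y ∈ ys₁ ++ ys₂
  delete y≢x []       (here y≡x) = ⊥-elim (y≢x y≡x)
  delete y≢x []       (there y∈) = y∈
  delete y≢x (z ∷ zs) (here y≡z) = here y≡z
  delete y≢x (z ∷ zs) (there y∈) = there (delete y≢x zs y∈)

sixteen-palindromes : Exactly 16 (Factors γη^ω⟨0⟩ ∩ Palindrome)
sixteen-palindromes =
  (palindromes₁₆ , palindromes₁₆-unique , All.zip (All.tabulate occurring , palindromes₁₆-palindromes) ,
      refl) ,
  λ xs uniq all → unique-length xs palindromes₁₆ uniq λ {x} x∈ → let fac , pal = All.lookup all x∈ in
    palindromes-only (length x) x ≤-refl (proj₂ Limit≐Factors fac) pal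
  where
  occurring : ∀ {u} → u ∈ palindromes₁₆ → Factors γη^ω⟨0⟩ u
  occurring {u} u∈ = proj₁ Limit≐Factors (2 , somewhere-split u (γη^ 2 [ 0F ])
      (everyᵇ-sound early palindromes₁₆ occurring-ok u∈))

-- Descent of a repetition to the preimage.

weight-reverse : ∀ (w : Fin n → ℕ) v → weight w (reverse v) ≡ weight w v
weight-reverse w []      = refl
weight-reverse w (a ∷ v) = trans (cong (weight w) (unfold-reverse a v))
    (trans (weight-++ w (reverse v) [ a ])
  (trans (+-comm (weight w (reverse v)) _) (cong₂ _+_ (+-identityʳ (w a)) (weight-reverse w v))))

weight-prefix : ∀ (w : Fin n → ℕ) u {t v} → v ≡ u ++ t → weight w u ≤ weight w v
weight-prefix w u {t} refl = subst (weight w u ≤_) (sym (weight-++ w u t)) (m≤m+n _ _)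

diverge : Word n → Word n → Bool
diverge []      _       = false
diverge (a ∷ u) []      = false
diverge (a ∷ u) (b ∷ v) = if a == b then diverge u v else true

-- Words that differ at some position stay apart whatever follows, so their extensions agree no
-- further than they do.
diverge-prefix : ∀ (p q z : Word n) {x y r s} → diverge p q ≡ true → p ++ x ≡ z ++ r → q ++ y ≡ z ++ s →
                 ∃[ e ] commonPrefix p q ≡ z ++ e
diverge-prefix p       q       []      d eq eq′ = commonPrefix p q , refl
diverge-prefix (a ∷ p) (b ∷ q) (c ∷ z) d eq eq′ with ∷-injective eq | ∷-injective eq′
... | refl , eq | refl , eq′ rewrite ==-refl a with diverge-prefix p q z d eq eq′
... | e , eq″ = e , cong (a ∷_) eq″

module Blocks {m : ℕ} (f : Fin m → Word n) where

  f* : Word m → Word n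
  f* = concatMap f

  f*-++ : ∀ u v → f* (u ++ v) ≡ f* u ++ f* v
  f*-++ = concatMap-++ f

  divergent : Bool
  divergent = allF m λ a → allF m λ b → (a == b) ∨ diverge (f a) (f b)

  -- The possible overhang of an agreement between images beyond the last letter on which the
  -- preimages agree.
  Fork : Word n → Set
  Fork e = e ≡ [] ⊎ (∃[ a ] ∃[ b ] ((a == b) ≡ false × e ≡ commonPrefix (f a) (f b)))

  module _ (div : divergent ≡ true) where

    diverges : ∀ a b → (a == b) ≡ false → diverge (f a) (f b) ≡ true
    diverges a b a≢b with ∨-true (a == b) (allF-sound m (λ b → (a == b) ∨ diverge (f a) (f b))
        (allF-sound m (λ a → allF m λ b → (a == b) ∨ diverge (f a) (f b)) div a) b)
    ... | inj₁ p = ⊥-elim (true≢false (trans (sym p) a≢b))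
    ... | inj₂ p = p

    -- Equal letters are stripped off as long as `z` covers their images. If different letters come
    -- up, their images diverge, and `z` ends within the common prefix of the two.
    common : ∀ x y z {r s} → f* x ≡ z ++ r → f* y ≡ z ++ s →
             ∃[ k ] ∃[ x′ ] ∃[ y′ ] ∃[ e ] ∃[ r′ ]
                 (x ≡ k ++ x′ × y ≡ k ++ y′ × Fork e × f* k ++ e ≡ z ++ r′)
    common []      y z eq eq′ with infix-empty [] z eq
    ... | refl = [] , [] , y , [] , [] , refl , refl , inj₁ refl , refl
    common (a ∷ x) [] z eq eq′ with infix-empty [] z eq′
    ... | refl = [] , a ∷ x , [] , [] , [] , refl , refl , inj₁ refl , refl
    common (a ∷ x) (b ∷ y) z eq eq′ with a == b in a==b
    ... | false with diverge-prefix (f a) (f b) z (diverges a b a==b) eq eq′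
    ... | e , eq″ = [] , a ∷ x , b ∷ y , commonPrefix (f a) (f b) , e , refl , refl , inj₂
        (a , b , a==b , refl) , eq″
    common (a ∷ x) (b ∷ y) z eq eq′ | true with ==-sound a b a==b | ≤-total (length z) (length (f a))
    ... | refl | inj₁ le with ++-split (f a) z eq le
    ... | e , eq″ , _ = [ a ] , x , y , [] , e , refl , refl , inj₁ refl ,
                        trans (++-identityʳ _) (trans (++-identityʳ (f a)) eq″)
    common (a ∷ x) (b ∷ y) z eq eq′ | true | refl | inj₂ le with ++-split z (f a) (sym eq) le
    ... | z′ , refl , eq₁ with ++-split (f a ++ z′) (f a) (sym eq′) le
    ... | z″ , eq₂ , eq₃ with ++-cancel-length (f a) (f a) eq₂ refl
    ... | _ , refl with common x y z′ eq₁ eq₃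
    ... | k , x′ , y′ , e , r′ , refl , refl , fork , eq₄ =
      a ∷ k , x′ , y′ , e , r′ , refl , refl , fork ,
      trans (++-assoc (f a) (f* k) e) (trans (cong (f a ++_) eq₄) (sym (++-assoc (f a) z′ r′)))

reverse-* : ∀ {m} (f : Fin m → Word n) v → reverse (concatMap f v) ≡ concatMap (reverse ∘ f) (reverse v)
reverse-* f []      = refl
reverse-* f (a ∷ v) = trans (reverse-++ (f a) (concatMap f v))
    (trans (cong (_++ reverse (f a)) (reverse-* f v))
  (sym (trans (cong (concatMap (reverse ∘ f)) (unfold-reverse a v))
    (trans (concatMap-++ (reverse ∘ f) (reverse v) [ a ])
        (cong (concatMap (reverse ∘ f) (reverse v) ++_) (++-identityʳ _))))))

module Descent {m : ℕ} (f : Fin m → Word n) (M : List (Word n)) where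

  open Blocks f public
  module Reversed = Blocks (reverse ∘ f)

  Synchronized : Word m → Set
  Synchronized w = ∀ s u t → u ∈ M → f* w ≡ s ++ u ++ t → ∃[ w₁ ] ∃[ w₂ ] (w ≡ w₁ ++ w₂ × f* w₁ ≡ s)

  -- A repetition in `w` whose image is the given one up to the forks at both ends. `f* U` is a
  -- conjugate of `u` in general, so only the equality of weights is recorded.
  record Preperiod (w : Word m) (u k : Word n) : Set where
    field
      U K T    : Word m
      eˡ eʳ    : Word n
      nonempty : 0 < length U
      border   : U ++ K ≡ K ++ T
      within   : Infix (U ++ K) w
      forkˡ    : Reversed.Fork eˡ
      forkʳ    : Fork eʳ
      period   : ∀ w → weight w u ≡ weight w (f* U)
      excess   : ∀ w → weight w k ≤ weight w eˡ + weight w (f* K) + weight w eʳ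

  cancel-weight : ∀ (k u v : Word n) → u ++ k ≡ k ++ v → ∀ w → weight w u ≡ weight w v
  cancel-weight k u v eq w = +-cancelˡ-≡ (weight w k) _ _ (trans (+-comm (weight w k) _)
    (trans (sym (weight-++ w u k)) (trans (cong (weight w) eq) (weight-++ w k v))))

  nonempty-length : ∀ v → 0 < length (f* v) → 0 < length v
  nonempty-length (a ∷ v) _ = z<s

  module _ (div : divergent ≡ true) (divᴿ : Reversed.divergent ≡ true) where

    -- A mark in the excess `k` occurs twice, at distance |u|, and both times at a border of images.
    -- From these two borders the agreement is followed in `w`, by `common` to the right and by its
    -- reversed form to the left.
    descend : ∀ w → Synchronized w → ∀ s u k t t₀ k₀ x k₁ → 0 < length u → u ++ k ≡ k ++ t → k ≡ k₀ ++ x ++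
        k₁ → x ∈ M →
              f* w ≡ s ++ (u ++ k) ++ t₀ → Preperiod w u k
    descend w sync s u k t t₀ k₀ x k₁ 0<u bord k≡ x∈ eq = go (sync (s ++ k₀) x (k₁ ++ t ++ t₀) x∈ first)
        (sync (s ++ u ++ k₀) x (k₁ ++ t₀) x∈ second)
      where
      first : f* w ≡ (s ++ k₀) ++ x ++ k₁ ++ t ++ t₀
      first = begin
        f* w                                 ≡⟨ eq ⟩
        s ++ (u ++ k) ++ t₀                  ≡⟨ cong (λ v → s ++ v ++ t₀) bord ⟩
        s ++ (k ++ t) ++ t₀                  ≡⟨ cong (λ v → s ++ (v ++ t) ++ t₀) k≡ ⟩
        s ++ ((k₀ ++ x ++ k₁) ++ t) ++ t₀    ≡⟨ cong (s ++_) (++-assoc (k₀ ++ x ++ k₁) t t₀) ⟩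
        s ++ (k₀ ++ x ++ k₁) ++ t ++ t₀      ≡⟨ cong (s ++_)
            (trans (++-assoc k₀ (x ++ k₁) (t ++ t₀)) (cong (k₀ ++_) (++-assoc x k₁ (t ++ t₀)))) ⟩
        s ++ k₀ ++ x ++ k₁ ++ t ++ t₀        ≡⟨ sym (++-assoc s k₀ _) ⟩
        (s ++ k₀) ++ x ++ k₁ ++ t ++ t₀      ∎
        where open ≡-Reasoning
      second : f* w ≡ (s ++ u ++ k₀) ++ x ++ k₁ ++ t₀
      second = begin
        f* w                                 ≡⟨ eq ⟩
        s ++ (u ++ k) ++ t₀                  ≡⟨ cong (λ v → s ++ (u ++ v) ++ t₀) k≡ ⟩
        s ++ (u ++ k₀ ++ x ++ k₁) ++ t₀      ≡⟨ cong (s ++_) (++-assoc u (k₀ ++ x ++ k₁) t₀) ⟩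
        s ++ u ++ (k₀ ++ x ++ k₁) ++ t₀      ≡⟨ cong (λ v → s ++ u ++ v)
            (trans (++-assoc k₀ (x ++ k₁) t₀) (cong (k₀ ++_) (++-assoc x k₁ t₀))) ⟩
        s ++ u ++ k₀ ++ x ++ k₁ ++ t₀        ≡⟨ cong (s ++_) (sym (++-assoc u k₀ _)) ⟩
        s ++ (u ++ k₀) ++ x ++ k₁ ++ t₀      ≡⟨ sym (++-assoc s (u ++ k₀) _) ⟩
        (s ++ u ++ k₀) ++ x ++ k₁ ++ t₀      ∎
        where open ≡-Reasoning

      Cut : Word n → Set
      Cut s = ∃[ w₁ ] ∃[ w₂ ] (w ≡ w₁ ++ w₂ × f* w₁ ≡ s)

      rest : ∀ w₁ w₂ {s y} → w ≡ w₁ ++ w₂ → f* w₁ ≡ s → f* w ≡ s ++ y → f* w₂ ≡ y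
      rest w₁ w₂ {s} w≡ s≡ eq = proj₂ (++-cancel-length (f* w₁) s
          (trans (sym (f*-++ w₁ w₂)) (trans (cong f* (sym w≡)) eq)) (cong length s≡))

      go : Cut (s ++ k₀) → Cut (s ++ u ++ k₀) → Preperiod w u k
      go (w₁ , w₂ , w≡ , s≡) (w₁′ , w₂′ , w≡′ , s≡′) with ≤-total (length w₁) (length w₁′)
      -- The border of the second mark cannot come first, as `u` is nonempty.
      ... | inj₂ le with ++-split w₁ w₁′ (trans (sym w≡) w≡′) le
      ... | e , refl , _ = ⊥-elim (<-irrefl refl (<-≤-trans longer shorter))
        where
        shorter : length (s ++ u ++ k₀) ≤ length (s ++ k₀)
        shorter = subst₂ _≤_ (cong length s≡′) (cong length s≡)
            (subst (λ v → length (f* w₁′) ≤ length v) (sym (f*-++ w₁′ e))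
            (subst (length (f* w₁′) ≤_) (sym (length-++ (f* w₁′))) (m≤m+n _ _)))
        longer : length (s ++ k₀) < length (s ++ u ++ k₀)
        longer = subst₂ _<_ (sym (length-++ s)) (sym
            (trans (length-++ s) (cong (λ z → length s + z) (length-++ u))))
                   (+-monoʳ-< (length s) (+-mono-≤ 0<u (≤-refl {length k₀})))
      go (w₁ , w₂ , w≡ , s≡) (w₁′ , w₂′ , w≡′ , s≡′) | inj₁ le with ++-split w₁′ w₁ (trans (sym w≡′) w≡) le
      ... | U′ , refl , w₂≡
        with common div w₂ w₂′ (x ++ k₁) {t ++ t₀} {t₀}
            (trans (rest w₁ w₂ w≡ s≡ first) (sym (++-assoc x k₁ (t ++ t₀))))
            (trans (rest (w₁ ++ U′) w₂′ w≡′ s≡′ second) (sym (++-assoc x k₁ t₀)))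
           | Reversed.common divᴿ (reverse w₁) (reverse (w₁ ++ U′)) (reverse k₀) {reverse s}
               {reverse (s ++ u)}
               (trans (sym (reverse-* f w₁)) (trans (cong reverse s≡) (reverse-++ s k₀)))
               (trans (sym (reverse-* f (w₁ ++ U′)))
                   (trans (cong reverse (trans s≡′ (sym (++-assoc s u k₀)))) (reverse-++ (s ++ u) k₀)))
      ... | Kʳ , x′ , y′ , eʳ , rʳ , w₂≡′ , w₂′≡ , forkʳ , eqʳ | Kˡ , x″ , y″ , eˡ , rˡ , w₁≡ , w₁′≡ , forkˡ
          , eqˡ = result
        where
        open ≡-Reasoning
        flipped : ∀ {v k z : Word m} → reverse v ≡ k ++ z → v ≡ reverse z ++ reverse k
        flipped {v} {k} {z} eq = trans (sym (reverse-involutive v))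
            (trans (cong reverse eq) (reverse-++ k z))
        K″ = reverse Kˡ
        w₁-split : w₁ ≡ reverse x″ ++ K″
        w₁-split = flipped {w₁} {Kˡ} w₁≡
        w₁′-split : w₁ ++ U′ ≡ reverse y″ ++ K″
        w₁′-split = flipped {w₁ ++ U′} {Kˡ} w₁′≡
        both : reverse y″ ++ K″ ≡ reverse x″ ++ K″ ++ U′
        both = trans (sym w₁′-split) (trans (cong (_++ U′) w₁-split) (++-assoc (reverse x″) K″ U′))
        lengths-≤ : length (reverse x″) ≤ length (reverse y″)
        lengths-≤ = +-cancelˡ-≤ (length K″) _ _ (subst₂ _≤_ (+-comm (length (reverse x″)) (length K″))
          (trans (sym (trans (cong length both) refl))
              (trans (length-++ (reverse y″)) (+-comm (length (reverse y″)) (length K″))))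
          (subst (length (reverse x″) + length K″ ≤_)
              (sym (trans (length-++ (reverse x″)) (cong (λ z → length (reverse x″) + z) (length-++ K″))))
            (+-monoʳ-≤ (length (reverse x″)) (m≤m+n (length K″) (length U′)))))
        -- `U′` lies between the two borders; moved to the left past `K″` it becomes the conjugate
        -- `U` with which the repetition starts.
        shifted : ∃[ U ] (reverse y″ ≡ reverse x″ ++ U × K″ ++ U′ ≡ U ++ K″)
        shifted = ++-split (reverse y″) (reverse x″) both lengths-≤
        U = proj₁ shifted
        conj : K″ ++ U′ ≡ U ++ K″
        conj = proj₂ (proj₂ shifted)
        repeated : U′ ++ Kʳ ++ y′ ≡ Kʳ ++ x′
        repeated = trans (cong (U′ ++_) (sym w₂′≡)) (trans (sym w₂≡) w₂≡′)
        split : ∃[ T ] (U′ ++ Kʳ ≡ Kʳ ++ T × x′ ≡ T ++ y′)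
        split = ++-split (U′ ++ Kʳ) Kʳ (trans (++-assoc U′ Kʳ y′) repeated)
            (subst (length Kʳ ≤_) (sym (length-++ U′)) (m≤n+m _ _))
        K = K″ ++ Kʳ
        T = proj₁ split
        weight-U : ∀ w → weight w (f* U) ≡ weight w (f* U′)
        weight-U w = cancel-weight (f* K″) (f* U) (f* U′)
            (trans (sym (f*-++ U K″)) (trans (cong f* (sym conj)) (f*-++ K″ U′))) w
        period : ∀ w → weight w u ≡ weight w (f* U)
        period w = trans (cancel-weight k₀ u (f* U′) (proj₂ (++-cancel-length s s (begin
            s ++ u ++ k₀             ≡⟨ sym s≡′ ⟩
            f* (w₁ ++ U′)            ≡⟨ f*-++ w₁ U′ ⟩
            f* w₁ ++ f* U′           ≡⟨ cong (_++ f* U′) s≡ ⟩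
            (s ++ k₀) ++ f* U′       ≡⟨ ++-assoc s k₀ (f* U′) ⟩
            s ++ k₀ ++ f* U′         ∎) refl)) w) (sym (weight-U w))
        border : U ++ K ≡ K ++ T
        border = begin
          U ++ K″ ++ Kʳ          ≡⟨ sym (++-assoc U K″ Kʳ) ⟩
          (U ++ K″) ++ Kʳ        ≡⟨ cong (_++ Kʳ) (sym conj) ⟩
          (K″ ++ U′) ++ Kʳ       ≡⟨ ++-assoc K″ U′ Kʳ ⟩
          K″ ++ U′ ++ Kʳ         ≡⟨ cong (K″ ++_) (proj₁ (proj₂ split)) ⟩
          K″ ++ Kʳ ++ T          ≡⟨ sym (++-assoc K″ Kʳ T) ⟩
          K ++ T                 ∎
        located : w ≡ reverse x″ ++ (U ++ K) ++ y′
        located = begin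
          w                                          ≡⟨ w≡′ ⟩
          (w₁ ++ U′) ++ w₂′                          ≡⟨ cong₂ _++_
              (trans (cong (_++ U′) w₁-split) (++-assoc (reverse x″) K″ U′)) w₂′≡ ⟩
          (reverse x″ ++ K″ ++ U′) ++ Kʳ ++ y′       ≡⟨ cong (λ v → (reverse x″ ++ v) ++ Kʳ ++ y′) conj ⟩
          (reverse x″ ++ U ++ K″) ++ Kʳ ++ y′        ≡⟨ ++-assoc (reverse x″) (U ++ K″) (Kʳ ++ y′) ⟩
          reverse x″ ++ (U ++ K″) ++ Kʳ ++ y′        ≡⟨ cong (reverse x″ ++_)
              (sym (++-assoc (U ++ K″) Kʳ y′)) ⟩
          reverse x″ ++ ((U ++ K″) ++ Kʳ) ++ y′      ≡⟨ cong (λ v → reverse x″ ++ v ++ y′)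
              (++-assoc U K″ Kʳ) ⟩
          reverse x″ ++ (U ++ K) ++ y′               ∎
        excess : ∀ w → weight w k ≤ weight w eˡ + weight w (f* K) + weight w eʳ
        excess w = subst₂ _≤_
          (trans (cong (_+ weight w (x ++ k₁)) (weight-reverse w k₀))
              (trans (sym (weight-++ w k₀ (x ++ k₁))) (cong (weight w) (sym k≡))))
          (trans (cong₂ _+_ (trans (weight-++ w (concatMap (reverse ∘ f) Kˡ) eˡ)
              (cong (_+ weight w eˡ) left-weight)) (weight-++ w (f* Kʳ) eʳ))
            (trans (rearrange (weight w (f* K″)) (weight w eˡ) (weight w (f* Kʳ)) (weight w eʳ))
              (cong (λ y → weight w eˡ + y + weight w eʳ)
                  (sym (trans (cong (weight w) (f*-++ K″ Kʳ)) (weight-++ w (f* K″) (f* Kʳ)))))))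
          (+-mono-≤ (weight-prefix w (reverse k₀) eqˡ) (weight-prefix w (x ++ k₁) eqʳ))
          where
          rearrange : ∀ a b c d → (a + b) + (c + d) ≡ b + (a + c) + d
          rearrange = solve-∀
          left-weight : weight w (concatMap (reverse ∘ f) Kˡ) ≡ weight w (f* K″)
          left-weight = trans (cong (λ v → weight w (concatMap (reverse ∘ f) v))
              (sym (reverse-involutive Kˡ)))
            (trans (cong (weight w) (sym (reverse-* f K″))) (weight-reverse w (f* K″)))
        length-U : 0 < length U
        length-U = nonempty-length U (subst (0 <_)
            (trans (sym (weight-length u)) (trans (period (const 1)) (weight-length (f* U)))) 0<u)
        result : Preperiod w u k
        result = record
          { U = U ; K = K ; T = T ; eˡ = eˡ ; eʳ = eʳ ; nonempty = length-U ; border = border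
          ; within = reverse x″ , y′ , located ; forkˡ = forkˡ ; forkʳ = forkʳ ; period = period ; excess =
              excess }

≤ᵇ-complete : ∀ {m n} → m ≤ n → (m ≤ᵇ n) ≡ true
≤ᵇ-complete le = Equivalence.to T-≡ (≤⇒≤ᵇ le)

take-prefix : ∀ m (u : Word n) {t} → length u ≤ m → ∃[ e ] take m (u ++ t) ≡ u ++ e
take-prefix m       []      {t} _        = take m t , refl
take-prefix (suc m) (a ∷ u) (s≤s le) = let e , eq = take-prefix m u le in e , cong (a ∷_) eq

take-exact : ∀ (u : Word n) t → take (length u) (u ++ t) ≡ u
take-exact []      t = refl
take-exact (a ∷ u) t = cong (a ∷_) (take-exact u t)

commonPrefix-++ : ∀ (k u v : Word n) → commonPrefix (k ++ u) (k ++ v) ≡ k ++ commonPrefix u v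
commonPrefix-++ []      u v = refl
commonPrefix-++ (a ∷ k) u v rewrite ==-refl a = cong (a ∷_) (commonPrefix-++ k u v)

-- Synchronization of the images of the words ηⁿ(0).

η^-suc-infix : ∀ n → Infix (η^ n ⟨0⟩) (η^ (suc n) ⟨0⟩)
η^-suc-infix zero    = [] , (1F ∷ 0F ∷ 2F ∷ 0F ∷ 3F ∷ []) , refl
η^-suc-infix (suc n) = infix-image (η *) η-++ (η^-suc-infix n)

η^-infix : ∀ k n → Infix (η^ n ⟨0⟩) (η^ (k + n) ⟨0⟩)
η^-infix zero    n = [] , [] , sym (++-identityʳ _)
η^-infix (suc k) n = infix-trans (η^-infix k n) (η^-suc-infix (k + n))

module Sync (f : Fin 4 → Word n) (M : List (Word n)) (ℓ N : ℕ) where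

  open Descent f M

  -- The tails of `drop 1 (f a)` are the nonempty proper suffixes of an image: the places where no
  -- mark may begin.
  cutOnly : Word 4 → Bool
  cutOnly []      = true
  cutOnly (a ∷ c) = everyᵇ (λ o → not (startsWithAny M (o ++ f* c))) (tails (drop 1 (f a))) ∧ cutOnly c

  cutOnly-sound : ∀ c s u t → cutOnly c ≡ true → u ∈ M → 0 < length u → f* c ≡ s ++ u ++ t → ∃[ c₁ ] ∃[ c₂ ]
      (c ≡ c₁ ++ c₂ × f* c₁ ≡ s)
  cutOnly-sound c       []      u t ok u∈ 0<u eq = [] , c , refl , refl
  cutOnly-sound []      (x ∷ s) u t ok u∈ 0<u ()
  cutOnly-sound (a ∷ c) (x ∷ s) u t ok u∈ 0<u eq
    with ∧-true (everyᵇ (λ o → not (startsWithAny M (o ++ f* c))) (tails (drop 1 (f a)))) ok | ≤-total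
        (length (f a)) (length (x ∷ s))
  ... | ok₁ , ok₂ | inj₁ le with ++-split (x ∷ s) (f a) (sym eq) le
  ... | s′ , s≡ , eq′ with cutOnly-sound c s′ u t ok₂ u∈ 0<u eq′
  ... | c₁ , c₂ , refl , eq″ = a ∷ c₁ , c₂ , refl , trans (cong (f a ++_) eq″) (sym s≡)
  cutOnly-sound (a ∷ c) (x ∷ s) u t ok u∈ 0<u eq | ok₁ , ok₂ | inj₂ le with ++-split (f a) (x ∷ s) eq le
  ... | []    , fa≡ , eq′ = [ a ] , c , refl , trans (++-identityʳ (f a)) (trans fa≡ (++-identityʳ (x ∷ s)))
  ... | y ∷ o , fa≡ , eq′ = ⊥-elim (true≢false (trans
      (sym (subst (λ v → startsWithAny M v ≡ true) eq′ (startsWithAny-∈ t u∈)))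
        (not-true _ (everyᵇ-sound (λ o → not (startsWithAny M (o ++ f* c))) (tails (drop 1 (f a))) ok₁
          (subst (λ v → y ∷ o ∈ tails (drop 1 v)) (sym fa≡)
              (subst (_∈ tails (s ++ y ∷ o)) (++-identityʳ (y ∷ o))
              (tails-infix {s = s} {y ∷ o} (cong (s ++_) (sym (++-identityʳ (y ∷ o)))) z<s)))))))

  -- An image under `f` alone may be shorter than a mark. Those under f ∘ η are long enough for
  -- pairs to suffice, at the price that only the words ηⁿ⁺¹(0) are shown to be synchronized.
  image₂ : Word 4 → Word n
  image₂ v = f* ((η *) v)

  image₂-++ : ∀ u v → image₂ (u ++ v) ≡ image₂ u ++ image₂ v
  image₂-++ u v = trans (cong f* (η-++ u v)) (f*-++ ((η *) u) ((η *) v))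

  sized : Word n → Bool
  sized u = (1 ≤ᵇ length u) ∧ (length u ≤ᵇ ℓ)

  synchronizing : Bool
  synchronizing = everyᵇ (λ p → cutOnly ((η *) p)) singletons-and-pairs

  marked : Word n → Bool
  marked y = not (N ≤ᵇ length y) ∨ somewhere (startsWithAny M) (take N y)

  somewhere-any : ∀ v → somewhere (startsWithAny M) v ≡ true → ∃[ s ] ∃[ x ] ∃[ t ]
      (x ∈ M × v ≡ s ++ x ++ t)
  somewhere-any (a ∷ v) p with ∨-true (startsWithAny M (a ∷ v)) p
  ... | inj₁ q = let x , t , x∈ , eq = startsWithAny-sound M (a ∷ v) q in [] , x , t , x∈ , eq
  ... | inj₂ q = let s , x , t , x∈ , eq = somewhere-any v q in a ∷ s , x , t , x∈ , cong (a ∷_) eq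

  module _ (sizes : everyᵇ sized M ≡ true) (ok : synchronizing ≡ true)
      (long : ∀ a → ℓ ≤ length (image₂ [ a ])) where

    synchronized : ∀ n → Synchronized (η^ (suc n) ⟨0⟩)
    synchronized n s u t u∈ eq with ∧-true (1 ≤ᵇ length u) (everyᵇ-sound sized M sizes u∈)
    ... | 0<u , |u| with within-pair {h = image₂} image₂-++ u (λ a → ≤-trans (≤ᵇ-true _ |u|) (long a))
        (η^ n ⟨0⟩) s t eq
    ... | x , w , y , s′ , t′ , eq₁ , |w| , eq₂ , eq₃
      with cutOnly-sound ((η *) w) s′ u t′ (everyᵇ-sound (λ p → cutOnly ((η *) p)) singletons-and-pairs ok
          (small w |w| eq₁ eq₃)) u∈ (≤ᵇ-true 1 0<u) eq₃
      where
      small : ∀ w → length w ≤ 2 → η^ n ⟨0⟩ ≡ x ++ w ++ y → image₂ w ≡ s′ ++ u ++ t′ → w ∈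
          singletons-and-pairs
      small []            _ _  eq = ⊥-elim (<⇒≢ (≤ᵇ-true 1 0<u) (cong length (sym (infix-empty s′ u eq))))
      small (0F ∷ [])     _ _  _ = here refl
      small (1F ∷ [])     _ _  _ = there (here refl)
      small (2F ∷ [])     _ _  _ = there (there (here refl))
      small (3F ∷ [])     _ _  _ = there (there (there (here refl)))
      small (c ∷ d ∷ [])  _ eq _ = there (there (there (there (pairs-only n c d (x , y , eq)))))
      small (_ ∷ _ ∷ _ ∷ _) (s≤s (s≤s ())) _ _
    ... | c₁ , c₂ , eq₄ , eq₅ = (η *) x ++ c₁ , c₂ ++ (η *) y ,
          trans (cong (η *) eq₁) (trans (η-++ x (w ++ y))
              (trans (cong ((η *) x ++_) (trans (η-++ w y)
              (trans (cong (_++ (η *) y) eq₄) (++-assoc c₁ c₂ _)))) (sym (++-assoc ((η *) x) c₁ _)))) ,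
          trans (f*-++ ((η *) x) c₁) (trans (cong (image₂ x ++_) eq₅) (sym eq₂))

  module _ (ok : everyTail image₂ marked ≡ true) (long : ∀ a → N ≤ length (image₂ [ a ])) (0<N : 0 < N)
      where

    marker-occurs : ∀ n k → Infix k (image₂ (η^ n ⟨0⟩)) → N ≤ length k → ∃[ s ] ∃[ x ] ∃[ t ]
        (x ∈ M × k ≡ s ++ x ++ t)
    marker-occurs n k inf N≤ = found (everyTail-sound image₂ image₂-++ marked ok n k′
        (subst (0 <_) (sym |k′|) 0<N)
        (λ a → subst (_≤ length (image₂ [ a ])) (sym |k′|) (long a))
            (infix-trans ([] , drop N k , sym (take++drop≡id N k)) inf))
      where
      k′ = take N k
      |k′| : length k′ ≡ N
      |k′| = trans (length-take N k) (m≤n⇒m⊓n≡m N≤)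
      found : ∃[ t ] marked (k′ ++ t) ≡ true → ∃[ s ] ∃[ x ] ∃[ t ] (x ∈ M × k ≡ s ++ x ++ t)
      found (t , p) with ∨-true (not (N ≤ᵇ length (k′ ++ t))) p
      ... | inj₁ q = ⊥-elim (true≢false (trans (sym
          (≤ᵇ-complete (subst (N ≤_) (sym (length-++ k′))
          (subst (λ l → N ≤ l + length t) (sym |k′|) (m≤m+n N _))))) (not-true _ q)))
      ... | inj₂ q with somewhere-any k′ (subst (λ v → somewhere (startsWithAny M) v ≡ true)
          (subst (λ l → take l (k′ ++ t) ≡ k′) |k′| (take-exact k′ t)) q)
      ... | s , x , t′ , x∈ , eq = s , x , t′ ++ drop N k , x∈ ,
            trans (sym (take++drop≡id N k)) (trans (cong (_++ drop N k) eq)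
                (trans (++-assoc s (x ++ t′) _) (cong (s ++_) (++-assoc x t′ _))))

-- Direct verification of the repetitions with short periods.

module Periods (w₁ w₂ : Fin n → ℕ) (test : ℕ → ℕ → ℕ → Word n → Bool) where

  -- The second word is `y` without its first `p` letters, whose weights are `a` and `b`. The test
  -- sees the longest excess with this period; shorter ones are its prefixes.
  periods : ℕ → Word n → Word n → ℕ → ℕ → ℕ → Bool
  periods zero    y r       p a b = true
  periods (suc m) y []      p a b = test p a b []
  periods (suc m) y (c ∷ r) p a b =
    if test p a b (commonPrefix y (c ∷ r)) then periods m y r (suc p) (a + w₁ c) (b + w₂ c) else false

  commonPrefix-[] : ∀ (y : Word n) → commonPrefix y [] ≡ []
  commonPrefix-[] []      = refl
  commonPrefix-[] (_ ∷ _) = refl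

  periods-sound : ∀ m y v r p a b → periods m y (v ++ r) p a b ≡ true → length v < m →
                  test (p + length v) (a + weight w₁ v) (b + weight w₂ v) (commonPrefix y r) ≡ true
  periods-sound (suc m) y [] [] p a b ok _
    rewrite +-identityʳ p | +-identityʳ a | +-identityʳ b | commonPrefix-[] y = ok
  periods-sound (suc m) y [] (c ∷ r) p a b ok _
    rewrite +-identityʳ p | +-identityʳ a | +-identityʳ b
    with test p a b (commonPrefix y (c ∷ r))
  ... | true = refl
  periods-sound (suc m) y (c ∷ v) r p a b ok (s≤s lt) with test p a b (commonPrefix y (c ∷ v ++ r))
  ... | true rewrite +-suc p (length v) | sym (+-assoc a (w₁ c) (weight w₁ v)) | sym
      (+-assoc b (w₂ c) (weight w₂ v)) =
    periods-sound m y v r (suc p) (a + w₁ c) (b + w₂ c) ok lt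

  allPeriods : ℕ → Word n → Bool
  allPeriods m y = periods m y y 0 0 0

  allPeriods-sound : ∀ m u k t {s} → allPeriods m ((u ++ k) ++ s) ≡ true → u ++ k ≡ k ++ t → length u < m →
                     ∃[ e ] test (length u) (weight w₁ u) (weight w₂ u) (k ++ e) ≡ true
  allPeriods-sound m u k t {s} ok eq lt = commonPrefix (t ++ s) s ,
    subst (λ c → test (length u) (weight w₁ u) (weight w₂ u) c ≡ true)
      (trans (cong (λ y → commonPrefix y (k ++ s)) (trans (cong (_++ s) eq) (++-assoc k t s)))
          (commonPrefix-++ k (t ++ s) s))
      (periods-sound m ((u ++ k) ++ s) u (k ++ s) 0 0 0
          (subst (λ r → periods m ((u ++ k) ++ s) r 0 0 0 ≡ true) (++-assoc u k s) ok) lt)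

forkBounded : (Fin 4 → Word n) → (Fin n → ℕ) → ℕ → Bool
forkBounded f w c = allF 4 λ a → allF 4 λ b → (a == b) ∨ (weight w (commonPrefix (f a) (f b)) ≤ᵇ c)

forkBounded-sound : ∀ (f : Fin 4 → Word n) w c → forkBounded f w c ≡ true → ∀ {e} → Blocks.Fork f e → weight
    w e ≤ c
forkBounded-sound f w c ok (inj₁ refl) = z≤n
forkBounded-sound f w c ok (inj₂ (a , b , a≢b , refl))
  with ∨-true (a == b) (allF-sound 4 (λ b → (a == b) ∨ (weight w (commonPrefix (f a) (f b)) ≤ᵇ c))
      (allF-sound 4 (λ a → allF 4 λ b → (a == b) ∨ (weight w (commonPrefix (f a) (f b)) ≤ᵇ c)) ok a) b)
... | inj₁ p = ⊥-elim (true≢false (trans (sym p) a≢b))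
... | inj₂ p = ≤ᵇ-true _ p

-- acc is the weight of the current stretch of agreement between a word and its shift.

runs : (Fin n → ℕ) → ℕ → Word n → Word n → ℕ → Bool
runs w c (a ∷ y) (b ∷ r) acc = if a == b then (if acc + w a ≤ᵇ c then runs w c y r (acc + w a) else false)
    else runs w c y r 0
runs w c _       _       acc = true

module _ (w : Fin n → ℕ) (c : ℕ) where

  runs-agree : ∀ k {x y} acc → acc ≤ c → runs w c (k ++ x) (k ++ y) acc ≡ true → acc + weight w k ≤ c
  runs-agree []      acc le ok = subst (_≤ c) (sym (+-identityʳ acc)) le
  runs-agree (a ∷ k) acc le ok rewrite ==-refl a with acc + w a ≤ᵇ c in le′
  ... | true = subst (_≤ c) (+-assoc acc (w a) (weight w k)) (runs-agree k (acc + w a) (≤ᵇ-true _ le′) ok)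

  runs-skip : ∀ s s′ {y r} acc → acc ≤ c → length s ≡ length s′ → runs w c (s ++ y) (s′ ++ r) acc ≡ true →
              ∃[ acc′ ] (acc′ ≤ c × runs w c y r acc′ ≡ true)
  runs-skip []      []       acc le _  ok = acc , le , ok
  runs-skip (a ∷ s) (b ∷ s′) acc le |s| ok with a == b
  ... | false = runs-skip s s′ 0 z≤n (cong pred |s|) ok
  ... | true with acc + w a ≤ᵇ c in le′
  ... | true = runs-skip s s′ (acc + w a) (≤ᵇ-true _ le′) (cong pred |s|) ok

  shift-split : ∀ (s u z : Word n) → ∃[ s′ ] (drop (length u) (s ++ u ++ z) ≡ s′ ++ z × length s ≡ length
      s′)
  shift-split s u z = go s u
    where
    go : ∀ s u → ∃[ s′ ] (drop (length u) (s ++ u ++ z) ≡ s′ ++ z × length s ≡ length s′)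
    go s [] = s , refl , refl
    go [] (a ∷ u) = let s′ , eq , |s| = go [] u in s′ , eq , |s|
    go (b ∷ s) (a ∷ u) = let s′ , eq , |s| = go (s ∷ʳ a) u in
      s′ , trans (cong (drop (length u)) (sym (++-assoc s [ a ] (u ++ z)))) eq ,
      trans (sym (trans (length-++ s) (+-comm (length s) 1))) |s|

  runs-sound : ∀ W s u k t t′ → W ≡ s ++ (u ++ k) ++ t′ → u ++ k ≡ k ++ t →
               runs w c W (drop (length u) W) 0 ≡ true → weight w k ≤ c
  runs-sound W s u k t t′ refl eq ok with shift-split s u (k ++ t′)
  ... | s′ , eq′ , |s| with runs-skip s s′ 0 z≤n |s| (subst₂ (λ y r → runs w c y r 0 ≡ true)
         (trans (cong (λ v → s ++ v ++ t′) eq) (cong (s ++_) (++-assoc k t t′)))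
         (trans (cong (λ v → drop (length u) (s ++ v)) (++-assoc u k t′)) eq′) ok)
  ... | acc , le , ok′ = ≤-trans (m≤n+m (weight w k) acc) (runs-agree k acc le ok′)

-- The repetitions in ηⁿ(0).

ηᶠ : Fin 4 → Word 4
ηᶠ = List⁺.toList ∘ η

γᶠ : Fin 4 → Word 3
γᶠ = List⁺.toList ∘ γ

η³ η⁴ : Word 4 → Word 4
η³ v = (η *) ((η *) ((η *) v))
η⁴ v = (η *) (η³ v)

γη² : Word 4 → Word 3
γη² v = (γ *) ((η *) ((η *) v))

-- The excess over the period satisfies θ k + 5 ≤ 19/22 θ u, where 5 absorbs the letters
-- gained at both ends on passing to the images, except for one class of repetitions.
Tame : ℕ → ℕ → ℕ → ℕ → Set
Tame θu κu θk κk = 22 * (θk + 5) ≤ 19 * θu × 22 * κk ≤ 19 * κu + 20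

Exceptional : ℕ → ℕ → ℕ → ℕ → Set
Exceptional θu κu θk κk = (θu ≡ 180 × κu ≡ 36) × (θk ≤ 151 × κk ≤ 29)

Claim : Word 4 → Word 4 → Set
Claim u k = Tame (weight θ u) (weight κ u) (weight θ k) (weight κ k) ⊎ Exceptional (weight θ u) (weight κ u)
    (weight θ k) (weight κ k)

tame? exceptional? : ℕ → ℕ → Word 4 → Bool
tame? a b k = (22 * (weight θ k + 5) ≤ᵇ 19 * a) ∧ (22 * weight κ k ≤ᵇ 19 * b + 20)
exceptional? a b k = ((a ≡ᵇ 180) ∧ (b ≡ᵇ 36)) ∧ ((weight θ k ≤ᵇ 151) ∧ (weight κ k ≤ᵇ 29))

-- Periods below 11 are passed over. `Tame` cannot hold for very short ones: 22 · 5 exceeds 19 ·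
-- θ(u) as soon as θ(u) is at most 5.
testᶿ : ℕ → ℕ → ℕ → Word 4 → Bool
testᶿ p a b k = (p <ᵇ 11) ∨ (tame? a b k ∨ exceptional? a b k)

-- 19/22 is 41/22 - 1, the bound for the excess relative to the period; the period 0, with which the
-- enumeration starts, is exempt.
testᵞ : ℕ → ℕ → ℕ → Word 3 → Bool
testᵞ p a b k = (p <ᵇ 1) ∨ (22 * length k ≤ᵇ 19 * p)

-- This fixes which periods have to be inspected: a preperiod of at most 10 letters has an image of
-- at most 2 · 33 = 66 letters under η and at most 216 under γ.
lightTen : Word 4 → Bool
lightTen y = (weight θ (take 10 y) ≤ᵇ 33) ∧ (6 * weight θ (take 10 y) + 3 * weight κ (take 10 y) ≤ᵇ 216)

heavySixty : Word 4 → Bool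
heavySixty y = not (60 ≤ᵇ length y) ∨ (16 ≤ᵇ weight κ (take 60 y))

module Sη = Sync ηᶠ M₁ 6 15
module Sγ = Sync γᶠ M₀ 20 52
module Dη = Descent ηᶠ M₁
module Dγ = Descent γᶠ M₀

longer : (h : Word 4 → Word n) → ℕ → Bool
longer h l = allF 4 λ a → l ≤ᵇ length (h [ a ])

longer-sound : (h : Word 4 → Word n) (l : ℕ) → longer h l ≡ true → ∀ a → l ≤ length (h [ a ])
longer-sound h l ok a = ≤ᵇ-true l (allF-sound 4 (λ a → l ≤ᵇ length (h [ a ])) ok a)

abstract
  periodsᶿ-ok : everyTail η³ (Periods.allPeriods θ κ testᶿ 67) ≡ true
  periodsᶿ-ok = refl

  periodsᵞ-ok : everyTail γη² (Periods.allPeriods (const 0) (const 0) testᵞ 217) ≡ true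
  periodsᵞ-ok = refl

  runs-ok : everyᵇ (λ p → runs θ 927 (η⁴ p) (drop 360 (η⁴ p)) 0) pairs ≡ true
  runs-ok = refl

  lightTen-ok : everyTail (λ v → (η *) ((η *) v)) lightTen ≡ true
  lightTen-ok = refl

  heavySixty-ok : everyTail η³ heavySixty ≡ true
  heavySixty-ok = refl

  sizesη-ok : everyᵇ Sη.sized M₁ ≡ true
  sizesη-ok = refl

  sizesγ-ok : everyᵇ Sγ.sized M₀ ≡ true
  sizesγ-ok = refl

  syncη-ok : Sη.synchronizing ≡ true
  syncη-ok = refl

  syncγ-ok : Sγ.synchronizing ≡ true
  syncγ-ok = refl

  markedη-ok : everyTail Sη.image₂ Sη.marked ≡ true
  markedη-ok = refl

  markedγ-ok : everyTail Sγ.image₂ Sγ.marked ≡ true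
  markedγ-ok = refl

  divη : Dη.divergent ≡ true
  divη = refl

  divηᴿ : Dη.Reversed.divergent ≡ true
  divηᴿ = refl

  divγ : Dγ.divergent ≡ true
  divγ = refl

  divγᴿ : Dγ.Reversed.divergent ≡ true
  divγᴿ = refl

  longη : ∀ a → 15 ≤ length (Sη.image₂ [ a ])
  longη = longer-sound Sη.image₂ 15 refl

  longγ : ∀ a → 52 ≤ length (Sγ.image₂ [ a ])
  longγ = longer-sound Sγ.image₂ 52 refl

  longη³ : ∀ a → 132 ≤ length (η³ [ a ])
  longη³ = longer-sound η³ 132 refl

  longη⁴ : ∀ a → 720 ≤ length (η⁴ [ a ])
  longη⁴ = longer-sound η⁴ 720 refl

  longγη² : ∀ a → 432 ≤ length (γη² [ a ])
  longγη² = longer-sound γη² 432 refl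

  longη² : ∀ a → 10 ≤ length ((η *) ((η *) [ a ]))
  longη² = longer-sound (λ v → (η *) ((η *) v)) 10 refl

  forkᶿʳ : ∀ {e} → Dη.Fork e → weight θ e ≤ 13
  forkᶿʳ = forkBounded-sound ηᶠ θ 13 refl

  forkᶿˡ : ∀ {e} → Dη.Reversed.Fork e → weight θ e ≤ 10
  forkᶿˡ = forkBounded-sound (reverse ∘ ηᶠ) θ 10 refl

  forkᵏʳ : ∀ {e} → Dη.Fork e → weight κ e ≤ 2
  forkᵏʳ = forkBounded-sound ηᶠ κ 2 refl

  forkᵏˡ : ∀ {e} → Dη.Reversed.Fork e → weight κ e ≤ 2
  forkᵏˡ = forkBounded-sound (reverse ∘ ηᶠ) κ 2 refl

  forkᵞʳ : ∀ {e} → Dγ.Fork e → weight (const 1) e ≤ 15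
  forkᵞʳ = forkBounded-sound γᶠ (const 1) 15 refl

  forkᵞˡ : ∀ {e} → Dγ.Reversed.Fork e → weight (const 1) e ≤ 12
  forkᵞˡ = forkBounded-sound (reverse ∘ γᶠ) (const 1) 12 refl

weight-≤ : ∀ (w : Fin n → ℕ) c → (∀ a → w a ≤ c) → ∀ v → weight w v ≤ c * length v
weight-≤ w c le []      = z≤n
weight-≤ w c le (a ∷ v) = subst (w a + weight w v ≤_) (sym (*-suc c (length v)))
    (+-mono-≤ (le a) (weight-≤ w c le v))

weight-≥ : ∀ (w : Fin n → ℕ) c → (∀ a → c ≤ w a) → ∀ v → c * length v ≤ weight w v
weight-≥ w c le []      = subst (_≤ 0) (sym (*-zeroʳ c)) z≤n
weight-≥ w c le (a ∷ v) = subst (_≤ w a + weight w v) (sym (*-suc c (length v)))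
    (+-mono-≤ (le a) (weight-≥ w c le v))

η³-++ : ∀ u v → η³ (u ++ v) ≡ η³ u ++ η³ v
η³-++ u v = trans (cong ((η *) ∘ (η *)) (η-++ u v))
    (trans (cong (η *) (η-++ ((η *) u) ((η *) v))) (η-++ ((η *) ((η *) u)) ((η *) ((η *) v))))

η⁴-++ : ∀ u v → η⁴ (u ++ v) ≡ η⁴ u ++ η⁴ v
η⁴-++ u v = trans (cong (η *) (η³-++ u v)) (η-++ (η³ u) (η³ v))

η²-++ : ∀ u v → (η *) ((η *) (u ++ v)) ≡ (η *) ((η *) u) ++ (η *) ((η *) v)
η²-++ u v = trans (cong (η *) (η-++ u v)) (η-++ ((η *) u) ((η *) v))

γη²-++ : ∀ u v → γη² (u ++ v) ≡ γη² u ++ γη² v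
γη²-++ u v = trans (cong (γ *) (η²-++ u v)) (γ-++ ((η *) ((η *) u)) ((η *) ((η *) v)))

length-η : ∀ v → weight (const 1) ((η *) v) ≡ 2 * weight θ v + 0 * weight κ v
length-η v = trans (weight-* η (const 1) (λ a → 2 * θ a + 0 * κ a)
    (λ { 0F → refl ; 1F → refl ; 2F → refl ; 3F → refl }) v) (weight-linear θ κ 2 0 v)

infix-prefix : ∀ (u k : Word n) {w} → Infix (u ++ k) w → Infix u w
infix-prefix u k = infix-trans ([] , k , refl)

infix-suffix : ∀ (u k : Word n) {w} → Infix (u ++ k) w → Infix k w
infix-suffix u k = infix-trans (u , [] , cong (u ++_) (sym (++-identityʳ k)))

infix-length : ∀ {f w : Word n} → Infix f w → length f ≤ length w
infix-length {f = f} (s , t , refl) = subst (length f ≤_)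
    (sym (trans (length-++ s) (cong (λ z → length s + z) (length-++ f))))
    (≤-trans (m≤m+n _ _) (m≤n+m _ (length s)))

square-part : ∀ (u k : Word n) {t} → u ++ k ≡ k ++ t → length u ≤ length k → Infix (u ++ u) (u ++ k)
square-part u k eq le with ++-split k u (sym eq) le
... | k′ , refl , _ = [] , k′ , sym (++-assoc u u k′)

module _ {a b x y x′ y′ : ℕ} where

  tame-mono : x′ ≤ x → y′ ≤ y → Tame a b x y → Tame a b x′ y′
  tame-mono p q (r , s) = ≤-trans (*-monoʳ-≤ 22 (+-monoˡ-≤ 5 p)) r , ≤-trans (*-monoʳ-≤ 22 q) s

  exceptional-mono : x′ ≤ x → y′ ≤ y → Exceptional a b x y → Exceptional a b x′ y′
  exceptional-mono p q (e , r , s) = e , ≤-trans p r , ≤-trans q s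

  -- The forks add at most 10 + 13 to θ of the excess, and 23 + 5 ≤ 6 · 5. For κ they add 4, which
  -- the 5 in the θ-bound outweighs, so that the 20 is preserved.
  tame-step : Tame a b x y → x′ ≤ 10 + (6 * x + 0 * y) + 13 → y′ ≤ 2 + (1 * x + 1 * y) + 2 →
              Tame (6 * a + 0 * b) (1 * a + 1 * b) x′ y′
  tame-step (r , s) p q =
    ≤-trans (*-monoʳ-≤ 22 (+-monoˡ-≤ 5 p)) (≤-trans (subst₂ _≤_ (e₁ x) (e₂ x) (m≤m+n (616 + 132 * x) 44))
        (subst₂ _≤_ refl (e₃ a b) (*-monoʳ-≤ 6 r))) ,
    ≤-trans (*-monoʳ-≤ 22 q) (≤-trans (subst₂ _≤_ (e₄ x y) (e₅ x y) (m≤m+n (88 + 22 * x + 22 * y) 22))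
        (subst₂ _≤_ refl (e₆ a b) (+-mono-≤ r s)))
    where
    e₁ : ∀ x → 616 + 132 * x ≡ 22 * ((10 + (6 * x + 0) + 13) + 5)
    e₁ = solve-∀
    e₂ : ∀ x → (616 + 132 * x) + 44 ≡ 6 * (22 * (x + 5))
    e₂ = solve-∀
    e₃ : ∀ a b → 6 * (19 * a) ≡ 19 * (6 * a + 0 * b)
    e₃ = solve-∀
    e₄ : ∀ x y → 88 + 22 * x + 22 * y ≡ 22 * (2 + (1 * x + 1 * y) + 2)
    e₄ = solve-∀
    e₅ : ∀ x y → (88 + 22 * x + 22 * y) + 22 ≡ 22 * (x + 5) + 22 * y
    e₅ = solve-∀
    e₆ : ∀ a b → 19 * a + (19 * b + 20) ≡ 19 * (1 * a + 1 * b) + 20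
    e₆ = solve-∀

-- The reserve 6 · 22 · 5 = 660 less 3 · 20 = 60 covers the cost 22 · 27 = 594 of the forks, with 6
-- to spare.
tame-γ : ∀ a b x y → Tame a b x y → 22 * (12 + (6 * x + 3 * y) + 15) ≤ 19 * (6 * a + 3 * b)
tame-γ a b x y (r , s) = ≤-trans (m≤m+n _ 6) (+-cancelʳ-≤ 60 _ _
    (subst₂ _≤_ (e₁ x y) (e₂ a b) (+-mono-≤ (*-monoʳ-≤ 6 r) (*-monoʳ-≤ 3 s))))
  where
  e₁ : ∀ x y → 6 * (22 * (x + 5)) + 3 * (22 * y) ≡ (22 * (12 + (6 * x + 3 * y) + 15) + 6) + 60
  e₁ = solve-∀
  e₂ : ∀ a b → 6 * (19 * a) + 3 * (19 * b + 20) ≡ 19 * (6 * a + 3 * b) + 60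
  e₂ = solve-∀

no-tame-square : ∀ a b → ¬ Tame a b a b
no-tame-square a b (r , _) = <-irrefl refl (<-≤-trans
    (≤-trans (s≤s (m≤m+n (19 * a) (3 * a + 109))) (≤-reflexive (e a))) r)
  where
  e : ∀ a → suc (19 * a + (3 * a + 109)) ≡ 22 * (a + 5)
  e = solve-∀

no-exceptional-square : ∀ a b → ¬ Exceptional a b a b
no-exceptional-square _ _ ((refl , _) , le , _) = <⇒≱ (≤ᵇ-true 152 {180} refl) le

testᶿ-sound : ∀ p a b (k : Word 4) {e} → 11 ≤ p → testᶿ p a b (k ++ e) ≡ true →
              Tame a b (weight θ k) (weight κ k) ⊎ Exceptional a b (weight θ k) (weight κ k)
testᶿ-sound p a b k {e} le ok with ∨-true (p <ᵇ 11) ok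
... | inj₁ q = ⊥-elim (<⇒≱ (≤ᵇ-true (suc p) q) le)
... | inj₂ ok with ∨-true (tame? a b (k ++ e)) ok
... | inj₁ q = let q₁ , q₂ = ∧-true (22 * (weight θ (k ++ e) + 5) ≤ᵇ 19 * a) q in
      inj₁ (tame-mono {a} {b} {weight θ (k ++ e)} {weight κ (k ++ e)} (weight-prefix θ k refl)
          (weight-prefix κ k refl) (≤ᵇ-true _ q₁ , ≤ᵇ-true _ q₂))
... | inj₂ q with ∧-true ((a ≡ᵇ 180) ∧ (b ≡ᵇ 36)) q
... | q₁ , q₂ with ∧-true (a ≡ᵇ 180) q₁ | ∧-true (weight θ (k ++ e) ≤ᵇ 151) q₂
... | q₁₁ , q₁₂ | q₂₁ , q₂₂ = inj₂ (exceptional-mono {a} {b} {weight θ (k ++ e)} {weight κ (k ++ e)}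
    (weight-prefix θ k refl) (weight-prefix κ k refl)
      ((≡ᵇ-true a q₁₁ , ≡ᵇ-true b q₁₂) , ≤ᵇ-true _ q₂₁ , ≤ᵇ-true _ q₂₂))
  where
  ≡ᵇ-true : ∀ m {n} → (m ≡ᵇ n) ≡ true → m ≡ n
  ≡ᵇ-true m p = ≡ᵇ⇒≡ m _ (Equivalence.from T-≡ p)

length-sum-≤ : ∀ {m} (u k : Word n) → length u ≤ m → length k ≤ length u → length (u ++ k) ≤ m + m
length-sum-≤ u k p q = subst (_≤ _) (sym (length-++ u)) (+-mono-≤ p (≤-trans q p))

direct : ∀ n u k t → 11 ≤ length u → length u ≤ 66 → length k ≤ length u → u ++ k ≡ k ++ t → Infix (u ++ k)
    (η^ n ⟨0⟩) → Claim u k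
direct n u k t 11≤ ≤66 k≤u eq inf
  with everyTail-sound η³ η³-++ (Periods.allPeriods θ κ testᶿ 67) periodsᶿ-ok n (u ++ k)
         (≤-trans (s≤s z≤n) (≤-trans 11≤ (subst (length u ≤_) (sym (length-++ u)) (m≤m+n _ _))))
         (λ a → ≤-trans (length-sum-≤ u k ≤66 k≤u) (longη³ a)) (infix-trans inf (η^-infix 3 n))
... | s , ok with Periods.allPeriods-sound θ κ testᶿ 67 u k t {s} ok eq (s≤s ≤66)
... | e , ok′ = testᶿ-sound (length u) (weight θ u) (weight κ u) k {e} 11≤ ok′

-- Inspection covers |k| ≤ |u| only, as u ++ k has to fit into the image of one letter. A longer
-- excess would contain the square of `u`, which the inspected case refutes.
direct-any : ∀ n u k t → 11 ≤ length u → length u ≤ 66 → u ++ k ≡ k ++ t → Infix (u ++ k) (η^ n ⟨0⟩) → Claim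
    u k
direct-any n u k t 11≤ ≤66 eq inf with ≤-total (length k) (length u)
... | inj₁ le = direct n u k t 11≤ ≤66 le eq inf
... | inj₂ le = ⊥-elim ([ no-tame-square (weight θ u) (weight κ u) , no-exceptional-square (weight θ u)
    (weight κ u) ]′
      (direct n u u u 11≤ ≤66 ≤-refl refl (infix-trans (square-part u k eq le) inf)))

light : ∀ n u → length u ≤ 10 → 0 < length u → Infix u (η^ n ⟨0⟩) → weight θ u ≤ 33 × 6 * weight θ u + 3 *
    weight κ u ≤ 216
light n u ≤10 0<u inf
  with everyTail-sound (λ v → (η *) ((η *) v)) η²-++ lightTen lightTen-ok n u 0<u
      (λ a → ≤-trans ≤10 (longη² a)) (infix-trans inf (η^-infix 2 n))
... | t , ok with ∧-true (weight θ (take 10 (u ++ t)) ≤ᵇ 33) ok | take-prefix 10 u {t} ≤10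
... | ok₁ , ok₂ | e , eq = ≤-trans (weight-prefix θ u eq) (≤ᵇ-true _ ok₁) ,
      ≤-trans (+-mono-≤ (*-monoʳ-≤ 6 (weight-prefix θ u eq)) (*-monoʳ-≤ 3 (weight-prefix κ u eq)))
          (≤ᵇ-true _ ok₂)

long-κ : ∀ n u → 60 ≤ length u → Infix u (η^ n ⟨0⟩) → 16 ≤ weight κ u
long-κ n u 60≤ inf = ≤-trans (found (everyTail-sound η³ η³-++ heavySixty heavySixty-ok n u′
    (subst (0 <_) (sym |u′|) z<s)
    (λ a → subst (_≤ length (η³ [ a ])) (sym |u′|) (≤-trans (≤ᵇ-true 60 refl) (longη³ a)))
    (infix-trans ([] , drop 60 u , sym (take++drop≡id 60 u)) (infix-trans inf (η^-infix 3 n)))))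
    (weight-prefix κ u′ (sym (take++drop≡id 60 u)))
  where
  u′ = take 60 u
  |u′| : length u′ ≡ 60
  |u′| = trans (length-take 60 u) (m≤n⇒m⊓n≡m 60≤)
  found : ∃[ t ] heavySixty (u′ ++ t) ≡ true → 16 ≤ weight κ u′
  found (t , ok) with ∨-true (not (60 ≤ᵇ length (u′ ++ t))) ok
  ... | inj₁ q = ⊥-elim (true≢false (trans (sym (≤ᵇ-complete
      (subst (60 ≤_) (sym (length-++ u′)) (subst (λ l → 60 ≤ l + length t) (sym |u′|) (m≤m+n 60 _)))))
      (not-true _ q)))
  ... | inj₂ q = subst (λ v → 16 ≤ weight κ v) (subst (λ l → take l (u′ ++ t) ≡ u′) |u′| (take-exact u′ t))
      (≤ᵇ-true 16 q)

short-excess : ∀ n u k → 66 < length u → length k ≤ 14 → Infix u (η^ n ⟨0⟩) → Claim u k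
short-excess n u k 66<u k≤ inf = inj₁
  ( ≤-trans (*-monoʳ-≤ 22 (+-monoˡ-≤ 5 (≤-trans (weight-≤ θ 5
      (λ { 0F → ≤ᵇ-true 3 refl ; 1F → ≤ᵇ-true 2 refl ; 2F → ≤ᵇ-true 2 refl ; 3F → ≤-refl }) k)
      (*-monoʳ-≤ 5 k≤))))
      (≤-trans (≤ᵇ-true 1650 {19 * (2 * 67)} refl)
          (*-monoʳ-≤ 19 (≤-trans (*-monoʳ-≤ 2 66<u)
          (weight-≥ θ 2 (λ { 0F → ≤ᵇ-true 2 refl ; 1F → ≤-refl ; 2F → ≤-refl ; 3F → ≤ᵇ-true 2 refl }) u))))
  , ≤-trans (*-monoʳ-≤ 22 (≤-trans (weight-≤ κ 1 (λ { 0F → z≤n ; 1F → ≤-refl ; 2F → ≤-refl ; 3F → ≤-refl })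
      k) (*-monoʳ-≤ 1 k≤)))
      (≤-trans (≤ᵇ-true 308 {324} refl) (+-monoˡ-≤ 20
          (*-monoʳ-≤ 19 (long-κ n u (≤-trans (≤ᵇ-true 60 {67} refl) 66<u) inf)))) )

-- These are the η-images of the exceptional class. The general estimate gives 6 · 151 + 23 = 929
-- and is too weak; 927 is the largest value with 22 · (927 + 5) ≤ 19 · 1080, so that they are tame
-- again.
period-360 : ∀ n u k t → length u ≡ 360 → weight θ u ≡ 1080 → u ++ k ≡ k ++ t → Infix (u ++ k) (η^ n ⟨0⟩) →
    weight θ k ≤ 927
period-360 n u k t |u| θu eq inf = [ short k t eq inf , long ]′ (≤-total (length k) (length u))
  where
  short : ∀ k t → u ++ k ≡ k ++ t → Infix (u ++ k) (η^ n ⟨0⟩) → length k ≤ length u → weight θ k ≤ 927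
  short k t eq inf le with Local.local η⁴ η⁴-++ n (u ++ k)
      (subst (0 <_) (sym (trans (length-++ u) (cong (_+ length k) |u|))) z<s)
                            (λ a → ≤-trans (length-sum-≤ {m = 360} u k (≤-reflexive |u|) le) (longη⁴ a))
                                (infix-trans inf (η^-infix 4 n))
  ... | p , p∈ , s , t′ , W≡ = runs-sound θ 927 (η⁴ p) s u k t t′ W≡ eq
        (subst (λ l → runs θ 927 (η⁴ p) (drop l (η⁴ p)) 0 ≡ true) (sym |u|)
            (everyᵇ-sound (λ p → runs θ 927 (η⁴ p) (drop 360 (η⁴ p)) 0) pairs runs-ok p∈))
  long : length u ≤ length k → weight θ k ≤ 927
  long le = ⊥-elim (<⇒≱ (≤ᵇ-true 928 {1080} refl) (subst (_≤ 927) θu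
      (short u u refl (infix-trans (square-part u k eq le) inf) ≤-refl)))

module Step (n : ℕ) (ih : ∀ u k t → 11 ≤ length u → u ++ k ≡ k ++ t → Infix (u ++ k) (η^ (suc n) ⟨0⟩) →
    Claim u k)
            (u k t : Word 4) (66<u : 66 < length u) (eq : u ++ k ≡ k ++ t)
                (inf : Infix (u ++ k) (η^ (suc (suc n)) ⟨0⟩)) where

  from-preperiod : Dη.Preperiod (η^ (suc n) ⟨0⟩) u k → Claim u k
  from-preperiod pp = inj₁ (conclude (length U ≤? 10))
    where
    open Dη.Preperiod pp
    θu : weight θ u ≡ 6 * weight θ U + 0 * weight κ U
    θu = trans (period θ) (θ-η U)
    κu : weight κ u ≡ 1 * weight θ U + 1 * weight κ U
    κu = trans (period κ) (κ-η U)
    |u| : length u ≡ 2 * weight θ U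
    |u| = trans (sym (weight-length u)) (trans (period (const 1)) (trans (length-η U) (+-identityʳ _)))
    θk : weight θ k ≤ 10 + (6 * weight θ K + 0 * weight κ K) + 13
    θk = ≤-trans (excess θ) (+-mono-≤ (+-mono-≤ (forkᶿˡ forkˡ) (≤-reflexive (θ-η K))) (forkᶿʳ forkʳ))
    κk : weight κ k ≤ 2 + (1 * weight θ K + 1 * weight κ K) + 2
    κk = ≤-trans (excess κ) (+-mono-≤ (+-mono-≤ (forkᵏˡ forkˡ) (≤-reflexive (κ-η K))) (forkᵏʳ forkʳ))

    exceptional : Exceptional (weight θ U) (weight κ U) (weight θ K) (weight κ K) → Tame (weight θ u)
        (weight κ u) (weight θ k) (weight κ k)
    exceptional ((θU , κU) , θK , κK) =
      subst (λ a → 22 * (weight θ k + 5) ≤ 19 * a) (sym θu≡) (≤-trans (*-monoʳ-≤ 22 (+-monoˡ-≤ 5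
        (period-360 (suc (suc n)) u k t (trans |u| (cong (2 *_) θU)) θu≡ eq inf)))
            (≤ᵇ-true 20504 {20520} refl)) ,
      subst (λ b → 22 * weight κ k ≤ 19 * b + 20) (sym (trans κu (cong₂ (λ x y → 1 * x + 1 * y) θU κU)))
        (≤-trans (*-monoʳ-≤ 22 (≤-trans κk (+-monoˡ-≤ 2
            (+-monoʳ-≤ 2 (+-mono-≤ (*-monoʳ-≤ 1 θK) (*-monoʳ-≤ 1 κK)))))) (≤ᵇ-true 4048 {4124} refl))
      where
      θu≡ : weight θ u ≡ 1080
      θu≡ = trans θu (cong₂ (λ x y → 6 * x + 0 * y) θU κU)

    conclude : Dec (length U ≤ 10) → Tame (weight θ u) (weight κ u) (weight θ k) (weight κ k)
    conclude (yes ≤10) = ⊥-elim (<⇒≱ 66<u (subst (_≤ 66) (sym |u|)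
        (*-monoʳ-≤ 2 (proj₁ (light (suc n) U ≤10 nonempty (infix-prefix U K within))))))
    conclude (no ≰10) with ih U K T (≰⇒> ≰10) border within
    ... | inj₁ tame = subst₂ (λ a b → Tame a b (weight θ k) (weight κ k)) (sym θu) (sym κu)
        (tame-step {weight θ U} {weight κ U} {weight θ K} {weight κ K} {weight θ k} {weight κ k} tame θk κk)
    ... | inj₂ exc  = exceptional exc

  step : Claim u k
  step with length k ≤? 14
  ... | yes ≤14 = short-excess (suc (suc n)) u k 66<u ≤14 (infix-prefix u k inf)
  ... | no  ≰14 with Sη.marker-occurs markedη-ok longη z<s n k (infix-suffix u k inf) (≰⇒> ≰14)
  ... | k₀ , x , k₁ , x∈ , k≡ = from-preperiod (Dη.descend divη divηᴿ (η^ (suc n) ⟨0⟩)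
      (Sη.synchronized sizesη-ok syncη-ok (λ a → ≤-trans (≤ᵇ-true 6 refl) (longη a)) n)
        (proj₁ inf) u k t (proj₁ (proj₂ inf)) k₀ x k₁ (≤-trans (s≤s z≤n) 66<u) eq k≡ x∈ (proj₂ (proj₂ inf)))

-- Long periods descend from level n + 2 to n + 1, where synchronization is known; at levels 0 and 1
-- the words are too short for them.
claim : ∀ n u k t → 11 ≤ length u → u ++ k ≡ k ++ t → Infix (u ++ k) (η^ n ⟨0⟩) → Claim u k
claim n u k t 11≤ eq inf with length u ≤? 66
... | yes ≤66 = direct-any n u k t 11≤ ≤66 eq inf
claim zero          u k t 11≤ eq inf | no ≰66 = ⊥-elim
    (<⇒≱ (≰⇒> ≰66) (≤-trans (infix-length (infix-prefix u k inf)) (≤ᵇ-true 1 refl)))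
claim (suc zero)    u k t 11≤ eq inf | no ≰66 = ⊥-elim
    (<⇒≱ (≰⇒> ≰66) (≤-trans (infix-length (infix-prefix u k inf)) (≤ᵇ-true 6 refl)))
claim (suc (suc n)) u k t 11≤ eq inf | no ≰66 = Step.step n (claim (suc n)) u k t (≰⇒> ≰66) eq inf

-- The powers in γ(ηⁿ(0)).

directᵞ : ∀ n u k t → 0 < length u → length u ≤ 216 → length k ≤ length u → u ++ k ≡ k ++ t → Infix (u ++ k)
    ((γ *) (η^ n ⟨0⟩)) → 22 * length k ≤ 19 * length u
directᵞ n u k t 0<u ≤216 k≤u eq inf
  with everyTail-sound γη² γη²-++ (Periods.allPeriods (const 0) (const 0) testᵞ 217) periodsᵞ-ok n (u ++ k)
         (≤-trans 0<u (subst (length u ≤_) (sym (length-++ u)) (m≤m+n _ _)))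
         (λ a → ≤-trans (length-sum-≤ u k ≤216 k≤u) (longγη² a))
             (infix-trans inf (infix-image (γ *) γ-++ (η^-infix 2 n)))
... | s , ok with Periods.allPeriods-sound (const 0) (const 0) testᵞ 217 u k t {s} ok eq (s≤s ≤216)
... | e , ok′ with ∨-true (length u <ᵇ 1) ok′
... | inj₁ q = ⊥-elim (<⇒≱ (≤ᵇ-true (suc (length u)) q) 0<u)
... | inj₂ q = ≤-trans (*-monoʳ-≤ 22 (subst (length k ≤_) (sym (length-++ k)) (m≤m+n _ _))) (≤ᵇ-true _ q)

-- Up to period 216 the bound is inspected; beyond it, an excess of at most 51 letters is harmless
-- and a longer one contains a mark and descends to `claim`.
boundᵞ : ∀ n u k t → 0 < length u → u ++ k ≡ k ++ t → Infix (u ++ k) ((γ *) (η^ n ⟨0⟩)) → 22 * length k ≤ 19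
    * length u
boundᵞ n u k t 0<u eq inf with length u ≤? 216
... | yes ≤216 = [ (λ le → directᵞ n u k t 0<u ≤216 le eq inf) ,
    (λ le → ⊥-elim (square (directᵞ n u u u 0<u ≤216 ≤-refl refl
    (infix-trans (square-part u k eq le) inf)))) ]′ (≤-total (length k) (length u))
  where
  square : ¬ 22 * length u ≤ 19 * length u
  square le = <⇒≱ (*-monoˡ-< (length u) {{>-nonZero 0<u}} (≤ᵇ-true 20 {22} refl)) le
... | no ≰216 with length k ≤? 51
... | yes ≤51 = ≤-trans (*-monoʳ-≤ 22 ≤51) (≤-trans (≤ᵇ-true 1122 {19 * 217} refl)
    (*-monoʳ-≤ 19 (≰⇒> ≰216)))
-- The occurrence is moved one level up, because only the words ηⁿ⁺¹(0) are known to be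
-- synchronized.
... | no  ≰51 = big (infix-trans inf (infix-image (γ *) γ-++ (η^-suc-infix n)))
  where
  from-preperiod : Dγ.Preperiod (η^ (suc n) ⟨0⟩) u k → 22 * length k ≤ 19 * length u
  from-preperiod pp = conclude (length U ≤? 10)
    where
    open Dγ.Preperiod pp
    |u| : length u ≡ 6 * weight θ U + 3 * weight κ U
    |u| = trans (sym (weight-length u)) (trans (period (const 1))
        (trans (weight-length ((γ *) U)) (length-γ U)))
    |k| : length k ≤ 12 + (6 * weight θ K + 3 * weight κ K) + 15
    |k| = subst (_≤ _) (weight-length k) (≤-trans (excess (const 1))
      (+-mono-≤ (+-mono-≤ (forkᵞˡ forkˡ) (≤-reflexive (trans (weight-length ((γ *) K)) (length-γ K))))
          (forkᵞʳ forkʳ)))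
    conclude : Dec (length U ≤ 10) → 22 * length k ≤ 19 * length u
    conclude (yes ≤10) = ⊥-elim (≰216 (subst (_≤ 216) (sym |u|)
        (proj₂ (light (suc n) U ≤10 nonempty (infix-prefix U K within)))))
    conclude (no ≰10) with claim (suc n) U K T (≰⇒> ≰10) border within
    ... | inj₁ tame = subst (λ l → 22 * length k ≤ 19 * l) (sym |u|)
        (≤-trans (*-monoʳ-≤ 22 |k|) (tame-γ (weight θ U) (weight κ U) (weight θ K) (weight κ K) tame))
    -- Under γ the exceptional class obeys the bound: period 6 · 180 + 3 · 36 = 1188, excess at most
    -- 12 + 6 · 151 + 3 · 29 + 15 = 1020.
    ... | inj₂ ((θU , κU) , θK , κK) = subst (λ l → 22 * length k ≤ 19 * l)
        (sym (trans |u| (cong₂ (λ x y → 6 * x + 3 * y) θU κU)))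
          (≤-trans (*-monoʳ-≤ 22 (≤-trans |k| (+-monoˡ-≤ 15
              (+-monoʳ-≤ 12 (+-mono-≤ (*-monoʳ-≤ 6 θK) (*-monoʳ-≤ 3 κK)))))) (≤ᵇ-true 22440 {22572} refl))
  big : Infix (u ++ k) ((γ *) (η^ (suc n) ⟨0⟩)) → 22 * length k ≤ 19 * length u
  big inf with Sγ.marker-occurs markedγ-ok longγ z<s n k (infix-suffix u k inf) (≰⇒> ≰51)
  ... | k₀ , x , k₁ , x∈ , k≡ = from-preperiod (Dγ.descend divγ divγᴿ (η^ (suc n) ⟨0⟩)
      (Sγ.synchronized sizesγ-ok syncγ-ok (λ a → ≤-trans (≤ᵇ-true 20 refl) (longγ a)) n)
        (proj₁ inf) u k t (proj₁ (proj₂ inf)) k₀ x k₁ 0<u eq k≡ x∈ (proj₂ (proj₂ inf)))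

free : Free⁺ (+ 41 / 22) (Factors γη^ω⟨0⟩)
free = PowerFree⁺⇒Free⁺ 41 21 {Factors γη^ω⟨0⟩} bound
  where
  bound : PowerFree⁺ 41 22 (Factors γη^ω⟨0⟩)
  bound u k t 0<u eq Fv with Limit-γ (proj₂ Limit≐Factors Fv)
  ... | n , inf = subst₂ _≤_ (e₁ (length u) (length k)) (e₂ (length u))
      (+-monoʳ-≤ (22 * length u) (boundᵞ n u k t 0<u eq inf))
    where
    e₁ : ∀ x y → 22 * x + 22 * y ≡ 22 * (x + y)
    e₁ = solve-∀
    e₂ : ∀ x → 22 * x + 19 * x ≡ 41 * x
    e₂ = solve-∀

theorem8 : (Exactly 16 (Factors γη^ω⟨0⟩ ∩ Palindrome) × Free⁺ (+ 41 / 22) (Factors γη^ω⟨0⟩))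
    × (∀ (w : ℤ-Word (Fin 3)) →
    Free (+ 52 / 27) (Factorsℤ w) →
    AtMost 16 (Factorsℤ w ∩ Palindrome) →
    (Factorsℤ w ≐ Factors γη^ω⟨0⟩) ⊎ (Factorsℤ w ≐ Factors γη^ω⟨0⟩ ᴿ))
    × (∀ (w : ω-Word (Fin 3)) →
    Recurrent w →
    Free (+ 25 / 13) (Factors w) →
    AtMost 17 (Factors w ∩ Palindrome) →
    (Factors w ≐ Factors γη^ω⟨0⟩) ⊎ (Factors w ≐ Factors γη^ω⟨0⟩ ᴿ))
theorem8 = (sixteen-palindromes , free) , bi-infinite , recurrent
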